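{- Consider the patterns of length $3$, i.e. the six permutations $123,132,213,231,312,321\in S_3$. Then: (i) For the statistic $\mathrm{nes}$, the $\mathrm{nes}$-Wilf-equivalence classes of $S_3$ having more than one element are exactly $\{132,213\}$ and $\{231,312\}$ (all other patterns form singleton classes). (ii) For the statistic $\mathrm{crs}$, the only $\mathrm{crs}$-Wilf-equivalence class of $S_3$ having more than one element is $\{132,213,321\}$. (iii) For the pair of statistics $(\mathrm{crs},\mathrm{nes})$, the only $(\mathrm{crs},\mathrm{nes})$-Wilf-equivalence class of $S_3$ having more than one element is $\{132,213\}$.
   Context: $S_n$ is the set of permutations of $[n]=\{1,\dots,n\}$, written $\sigma=\sigma(1)\cdots\sigma(n)$. For a sequence of distinct integers, its reduction $\mathrm{red}$ is the permutation of $[k]$ in the same relative order. $\sigma\in S_n$ contains $\tau\in S_k$ if some subsequence $\sigma(i_1)\cdots\sigma(i_k)$, $i_1<\dots<i_k$, has reduction $\tau$; otherwise $\sigma$ avoids $\tau$. $S_n(T)$ is the set of permutations of $[n]$ avoiding every pattern in $T$. A crossing of $\sigma$ is a pair $(i,j)$ with $i<j<\sigma(i)<\sigma(j)$ or $\sigma(i)<\sigma(j)\le i<j$; a nesting is a pair $(i,j)$ with $i<j<\sigma(j)<\sigma(i)$ or $\sigma(j)<\sigma(i)\le i<j$. $\mathrm{crs}(\sigma)$ and $\mathrm{nes}(\sigma)$ denote the numbers of crossings and nestings. For statistics $\mathrm{st}_1,\dots,\mathrm{st}_k$, two sets of patterns $T,T'$ are $(\mathrm{st}_1,\dots,\mathrm{st}_k)$-Wilf-equivalent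 if for every $n\ge 1$, $\sum_{\sigma\in S_n(T)}\prod_i x_i^{\mathrm{st}_i(\sigma)}=\sum_{\sigma\in S_n(T')}\prod_i x_i^{\mathrm{st}_i(\sigma)}$. Classes here are the equivalence classes of this relation restricted to single patterns $\{\tau\}$, $\tau\in S_3$. -}

module Defs where

open import Data.Bool using (Bool; true; false; _∧_; _∨_; not)
open import Data.Nat using (ℕ; zero; suc; _<ᵇ_; _≤ᵇ_; _≤_; _≡ᵇ_)
import Data.Nat as ℕ
open import Data.List using (List; []; _∷_; map; _++_; length; filterᵇ; concatMap; upTo)
open import Data.Bool.ListAction using (any; all)
open import Data.List.Properties using (≡-dec)
open import Relation.Nullary using (does)
open import Relation.Binary.PropositionalEquality using (_≡_)
open import Data.Product using (_×_; _,_)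
open import Function.Bundles using (_⇔_)

-- A permutation σ ∈ S_n is represented in one-line notation σ(1)⋯σ(n)
-- as a list of natural numbers.

oneTo : ℕ → List ℕ
oneTo n = map suc (upTo n)

words : ℕ → List ℕ → List (List ℕ)
words zero    A = [] ∷ []
words (suc k) A = concatMap (λ a → map (a ∷_) (words k A)) A

distinct : List ℕ → Bool
distinct []       = true
distinct (x ∷ xs) = all (λ y → not (x ≡ᵇ y)) xs ∧ distinct xs

S : ℕ → List (List ℕ)
S n = filterᵇ distinct (words n (oneTo n))

_==ᴸ_ : List ℕ → List ℕ → Bool
xs ==ᴸ ys = does (≡-dec ℕ._≟_ xs ys)

red : List ℕ → List ℕ
red s = map (λ x → suc (length (filterᵇ (λ y → y <ᵇ x) s))) s

subseqs : List ℕ → List (List ℕ)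
subseqs []       = [] ∷ []
subseqs (x ∷ xs) = map (x ∷_) (subseqs xs) ++ subseqs xs

contains : List ℕ → List ℕ → Bool
contains σ τ = any (λ s → red s ==ᴸ τ) (subseqs σ)

avoids : List ℕ → List ℕ → Bool
avoids σ τ = not (contains σ τ)

-- σ(i), 1-indexed (value 0 outside the range, never used)
at : List ℕ → ℕ → ℕ
at []       _             = 0
at (x ∷ xs) zero          = 0
at (x ∷ xs) (suc zero)    = x
at (x ∷ xs) (suc (suc i)) = at xs (suc i)

pairs : ℕ → List (ℕ × ℕ)
pairs n = concatMap (λ i → map (λ j → (i , j)) (oneTo n)) (oneTo n)

isCrossing : List ℕ → ℕ × ℕ → Bool
isCrossing σ (i , j) =
  ((i <ᵇ j) ∧ (j <ᵇ at σ i) ∧ (at σ i <ᵇ at σ j)) ∨ ((at σ i <ᵇ at σ j) ∧ (at σ j ≤ᵇ i) ∧ (i <ᵇ j))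

isNesting : List ℕ → ℕ × ℕ → Bool
isNesting σ (i , j) =
  ((i <ᵇ j) ∧ (j <ᵇ at σ j) ∧ (at σ j <ᵇ at σ i)) ∨ ((at σ j <ᵇ at σ i) ∧ (at σ i ≤ᵇ i) ∧ (i <ᵇ j))

crs : List ℕ → ℕ
crs σ = length (filterᵇ (isCrossing σ) (pairs (length σ)))

nes : List ℕ → ℕ
nes σ = length (filterᵇ (isNesting σ) (pairs (length σ)))

-- A tuple of statistics (st₁,…,st_k) is encoded as one function returning the
-- exponent vector (st₁(σ),…,st_k(σ)); the monomial ∏ xᵢ^{stᵢ(σ)} is determined by it.
Stats : Set
Stats = List ℕ → List ℕ

nesSt : Stats
nesSt σ = nes σ ∷ []

crsSt : Stats
crsSt σ = crs σ ∷ []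

crsNesSt : Stats
crsNesSt σ = crs σ ∷ nes σ ∷ []

-- coefficient of ∏ xᵢ^{vᵢ} in  Σ_{σ ∈ S_n(τ)} ∏ xᵢ^{stᵢ(σ)}
coeff : Stats → List ℕ → ℕ → List ℕ → ℕ
coeff st τ n v = length (filterᵇ (λ σ → avoids σ τ ∧ (st σ ==ᴸ v)) (S n))

-- {τ} and {τ'} are st-Wilf-equivalent: the generating polynomials agree for all
-- n ≥ 1, i.e. all their coefficients agree.
WilfEquiv : Stats → List ℕ → List ℕ → Set
WilfEquiv st τ τ' = ∀ (n : ℕ) → 1 ≤ n → ∀ (v : List ℕ) → coeff st τ n v ≡ coeff st τ' n v

data Pat3 : Set where
  p123 p132 p213 p231 p312 p321 : Pat3

pat : Pat3 → List ℕ
pat p123 = 1 ∷ 2 ∷ 3 ∷ []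
pat p132 = 1 ∷ 3 ∷ 2 ∷ []
pat p213 = 2 ∷ 1 ∷ 3 ∷ []
pat p231 = 2 ∷ 3 ∷ 1 ∷ []
pat p312 = 3 ∷ 1 ∷ 2 ∷ []
pat p321 = 3 ∷ 2 ∷ 1 ∷ []

-- Claimed partitions of S_3 into classes (two patterns lie in the same class iff
-- they get the same label).
-- (i) nes : {132,213}, {231,312}, {123}, {321}
nesClass : Pat3 → ℕ
nesClass p123 = 0
nesClass p132 = 1
nesClass p213 = 1
nesClass p231 = 2
nesClass p312 = 2
nesClass p321 = 3

crsClass : Pat3 → ℕ
crsClass p123 = 0
crsClass p132 = 1
crsClass p213 = 1
crsClass p321 = 1
crsClass p231 = 2
crsClass p312 = 3

crsNesClass : Pat3 → ℕ
crsNesClass p123 = 0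
crsNesClass p132 = 1
crsNesClass p213 = 1
crsNesClass p231 = 2
crsNesClass p312 = 3
crsNesClass p321 = 4

{-# OPTIONS --safe #-}
-- Reverse-complement-inverse preserves crossings and nestings and exchanges 132 with 213; inversion
-- preserves the number of nestings and exchanges 231 with 312; the remaining separations are visible
-- at n = 4. The substance is the crs-equivalence of 321 and 132, proved through Motzkin paths of length
-- n - 1 with two kinds of level steps, weighted by the sum of the heights of the vertices.
--
-- For a 321-avoiding σ the height at t is #{i : i < t < σ(i)}. For a 132-avoiding σ, take the
-- parenthesis word of length 2n attached to its decomposition at the last entry, and let the windows
-- centred at letter n + 1 grow by one letter on each side: the reduced length of such a window is odd,
-- 2k + 1, and k is the height. Recording whether each new letter lengthens or shortens the reduced word
-- is invertible. A node whose parentheses are at distances d and d' from the centre contributes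
-- |d - d'| to the sum of all reduced lengths, and (|d - d'| - 1) / 2 is the number of crossings between
-- the corresponding entry and the entries directly below and to the left of it.
module Submission where

open import Defs
open import Data.Bool using (Bool; true; false; T; not; _∧_; if_then_else_)
import Data.Bool.ListAction
open import Data.Bool.Properties using (T?; T-∧)
open import Data.Empty using (⊥; ⊥-elim)
open import Data.List using (List; []; _∷_; map; _++_; length; filterᵇ; foldr; upTo; applyUpTo; concatMap)
open import Data.List.Properties using (map-++; length-map; length-upTo; length-++; ≡-dec; map-∘; map-cong; ++-assoc; ++-identityʳ; ∷-injective; ∷-injectiveˡ; ∷-injectiveʳ; ∷ʳ-injective; map-upTo)
open import Data.List.Membership.Propositional using (_∈_; _∉_; find; lose)
open import Data.List.Membership.Propositional.Properties using (∈-map⁺; ∈-map⁻; ∈-++⁺ˡ; ∈-++⁺ʳ; ∈-++⁻; ∈-∃++; ∈-upTo⁺; ∈-upTo⁻; ∈-filter⁺; ∈-filter⁻; ∈-concatMap⁺; ∈-concatMap⁻)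
open import Data.List.Membership.Propositional.Properties.WithK using (unique∧set⇒bag)
open import Data.List.Relation.Binary.BagAndSetEquality using (∼bag⇒↭)
open import Data.List.Relation.Binary.Permutation.Propositional using (_↭_; ↭-sym)
import Data.List.Relation.Binary.Permutation.Propositional.Properties as PermP
open import Data.List.Relation.Unary.All using (All; []; _∷_)
import Data.List.Relation.Unary.All as All
import Data.List.Relation.Unary.All.Properties as AllP
open import Data.List.Relation.Unary.AllPairs using (AllPairs; []; _∷_)
open import Data.List.Relation.Unary.Any using (here; there)
import Data.List.Relation.Unary.Any as Any
import Data.List.Relation.Unary.Any.Properties as AnyP
open import Data.List.Relation.Unary.Unique.Propositional using (Unique)
import Data.List.Relation.Unary.Unique.Propositional.Properties as UniqueP
open import Data.Nat using (ℕ; zero; suc; _+_; _∸_; _≤_; _<_; z≤n; s≤s; s≤s⁻¹; _<?_; _≤?_; _≟_; _<ᵇ_; ∣_-_∣)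
open import Data.List.Membership.DecPropositional _≟_ using (_∈?_)
open import Data.Nat.ListAction using (sum)
open import Data.Nat.ListAction.Properties using (sum-++; sum-↭)
open import Data.Nat.Properties
open import Data.Nat.Solver using (module +-*-Solver)
open import Data.Product using (∃; ∃₂; _×_; _,_; proj₁; proj₂; uncurry)
open import Data.Sum using (_⊎_; inj₁; inj₂)
open import Data.Unit using (tt)
open import Function using (_∘_; id; case_of_)
open import Function.Bundles using (_⇔_; mk⇔; module Equivalence)
open import Relation.Binary.Definitions using (tri<; tri≈; tri>)
open import Relation.Binary.PropositionalEquality using (_≡_; _≢_; refl; sym; trans; cong; cong₂; subst; subst₂; module ≡-Reasoning)
open import Relation.Nullary using (¬_; Dec; yes; no; does; contradiction; _×-dec_; _⊎-dec_)
open import Relation.Nullary.Decidable using (dec-true; dec-false)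

-- Counting permutations

-- How many crossings the root of a node has with its subtree `α` depends on how far the block is
-- displaced from the diagonal, so `crs` obeys no recursion on trees alone. The parenthesis word
-- makes the displacement visible, because it fixes the two distances from the centre. What remains
-- is a double count. The windows containing exactly one of two matched parentheses are those whose
-- radius lies between the two distances, and the parentheses that survive reduction in a window are
-- those whose partner is outside. Exchanging the summations turns a sum over nodes into a sum over
-- windows. There are n nodes and n windows, and every term of either sum is odd; removing 1 from
-- each and halving leaves crossings on one side and heights on the other. Every equivalence comes
-- from two injections that preserve the statistics, given as relations, so no two maps have to be
-- shown mutually inverse.

private variable
  A B : Set

∈-++-∷ : ∀ (ys : List B) {zs z y} → z ∈ ys ++ y ∷ zs → z ≢ y → z ∈ ys ++ zs
∈-++-∷ ys z∈ z≢y with ∈-++⁻ ys z∈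
... | inj₁ z∈ys = ∈-++⁺ˡ z∈ys
... | inj₂ (here z≡y) = contradiction z≡y z≢y
... | inj₂ (there z∈zs) = ∈-++⁺ʳ ys z∈zs

-- A relation instead of a function, because the images come out of existential statements about
-- elements of `xs`. Each image is deleted from `ys` before the induction hypothesis is applied;
-- injectivity keeps the other images away from it.
injection-≤ : ∀ (R : A → B → Set) {xs ys} → Unique xs →
  (∀ {x} → x ∈ xs → ∃ λ y → y ∈ ys × R x y) →
  (∀ {x x' y} → x ∈ xs → x' ∈ xs → R x y → R x' y → x ≡ x') →
  length xs ≤ length ys
injection-≤ R {[]} u tot inj = z≤n
injection-≤ R {x ∷ xs} (x∉ ∷ u) tot inj with tot (here refl)
... | y , y∈ , Rxy with ∈-∃++ y∈
... | ys , zs , refl = begin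
  suc (length xs)          ≤⟨ s≤s (injection-≤ R u tot' (λ p q → inj (there p) (there q))) ⟩
  suc (length (ys ++ zs))  ≡⟨ cong suc (length-++ ys) ⟩
  suc (length ys + length zs) ≡⟨ sym (+-suc (length ys) (length zs)) ⟩
  length ys + length (y ∷ zs) ≡⟨ sym (length-++ ys) ⟩
  length (ys ++ y ∷ zs) ∎
  where
  open ≤-Reasoning
  tot' : ∀ {x'} → x' ∈ xs → ∃ λ z → z ∈ ys ++ zs × R x' z
  tot' {x'} x'∈ with tot (there x'∈)
  ... | z , z∈ , Rx'z = z , ∈-++-∷ ys z∈ z≢y , Rx'z
    where
    z≢y : z ≢ y
    z≢y refl = All.lookup x∉ x'∈ (inj (here refl) (there x'∈) Rxy Rx'z)

unique-⊆⇒≤ : ∀ {xs ys : List A} → Unique xs → (∀ {x} → x ∈ xs → x ∈ ys) → length xs ≤ length ys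
unique-⊆⇒≤ u sub = injection-≤ _≡_ u (λ x∈ → _ , sub x∈ , refl) (λ { _ _ refl refl → refl })

∉⇒All≢ : ∀ {x : A} {xs} → x ∉ xs → All (x ≢_) xs
∉⇒All≢ {xs = xs} x∉ = All.tabulate λ { y∈ refl → x∉ y∈ }

unique-⊆⇒⊇ : ∀ {xs ys : List ℕ} → Unique xs → (∀ {x} → x ∈ xs → x ∈ ys) →
  length ys ≤ length xs → ∀ {y} → y ∈ ys → y ∈ xs
unique-⊆⇒⊇ {xs} {ys} u sub le {y} y∈ with y ∈? xs
... | yes p = p
... | no y∉ = contradiction (≤-trans (unique-⊆⇒≤ (∉⇒All≢ y∉ ∷ u) sub') le) (<-irrefl refl)
  where
  sub' : ∀ {x} → x ∈ y ∷ xs → x ∈ ys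
  sub' (here refl) = y∈
  sub' (there p) = sub p

unique-⊆⇒↭ : ∀ {xs ys : List ℕ} → Unique xs → Unique ys → (∀ {x} → x ∈ xs → x ∈ ys) →
  length ys ≤ length xs → xs ↭ ys
unique-⊆⇒↭ u v sub le =
  ∼bag⇒↭ (unique∧set⇒bag u v (mk⇔ sub (unique-⊆⇒⊇ u sub le)))

unique-map : ∀ (f : A → B) {xs} → (∀ {x y} → x ∈ xs → y ∈ xs → f x ≡ f y → x ≡ y) →
  Unique xs → Unique (map f xs)
unique-map f inj [] = []
unique-map f {x ∷ xs} inj (x∉ ∷ u) = All.tabulate neq ∷ unique-map f (λ p q → inj (there p) (there q)) u
  where
  neq : ∀ {z} → z ∈ map f xs → f x ≢ z
  neq z∈ refl with ∈-map⁻ f z∈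
  ... | y , y∈ , e = All.lookup x∉ y∈ (inj (here refl) (there y∈) e)

∈-filterᵇ⁺ : ∀ (p : A → Bool) {x xs} → x ∈ xs → T (p x) → x ∈ filterᵇ p xs
∈-filterᵇ⁺ p = ∈-filter⁺ (T? ∘ p)

∈-filterᵇ⁻ : ∀ (p : A → Bool) {x xs} → x ∈ filterᵇ p xs → x ∈ xs × T (p x)
∈-filterᵇ⁻ p = ∈-filter⁻ (T? ∘ p)

∈-oneTo⁺ : ∀ {n i} → 1 ≤ i → i ≤ n → i ∈ oneTo n
∈-oneTo⁺ {i = suc i} _ (s≤s i≤n) = ∈-map⁺ suc (∈-upTo⁺ (s≤s i≤n))

∈-oneTo⁻ : ∀ {n i} → i ∈ oneTo n → 1 ≤ i × i ≤ n
∈-oneTo⁻ i∈ with ∈-map⁻ suc i∈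
... | j , j∈ , refl = s≤s z≤n , ∈-upTo⁻ j∈

oneTo-unique : ∀ n → Unique (oneTo n)
oneTo-unique n = UniqueP.map⁺ suc-injective (UniqueP.upTo⁺ n)

length-oneTo : ∀ n → length (oneTo n) ≡ n
length-oneTo n = trans (length-map suc (upTo n)) (length-upTo n)

∈-words⁺ : ∀ k {X σ} → length σ ≡ k → All (_∈ X) σ → σ ∈ words k X
∈-words⁺ zero {σ = []} _ _ = here refl
∈-words⁺ (suc k) {X} {σ = x ∷ σ} e (x∈ ∷ a) =
  ∈-concatMap⁺ (λ a → map (a ∷_) (words k X)) (Any.map (λ { refl → ∈-map⁺ (x ∷_) (∈-words⁺ k (suc-injective e) a) }) x∈)

∈-words⁻ : ∀ k {X σ} → σ ∈ words k X → length σ ≡ k × All (_∈ X) σ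
∈-words⁻ zero (here refl) = refl , []
∈-words⁻ (suc k) {X} σ∈ with find (∈-concatMap⁻ (λ a → map (a ∷_) (words k X)) {xs = X} σ∈)
... | a , a∈ , q with ∈-map⁻ (a ∷_) q
... | τ , τ∈ , refl with ∈-words⁻ k τ∈
... | e , all = cong suc e , a∈ ∷ all

words-unique : ∀ k {X} → Unique X → Unique (words k X)
words-unique zero u = [] ∷ []
words-unique (suc k) {X} u = go u
  where
  go : ∀ {Y} → Unique Y → Unique (concatMap (λ a → map (a ∷_) (words k X)) Y)
  go [] = []
  go {y ∷ Y} (y∉ ∷ v) = UniqueP.++⁺ (UniqueP.map⁺ ∷-injectiveʳ (words-unique k u)) (go v) disj
    where
    disj : ∀ {σ} → ¬ (σ ∈ map (y ∷_) (words k X) × σ ∈ concatMap (λ a → map (a ∷_) (words k X)) Y)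
    disj (p , q) with ∈-map⁻ (y ∷_) p | find (∈-concatMap⁻ (λ a → map (a ∷_) (words k X)) {xs = Y} q)
    ... | τ , _ , refl | a , a∈ , r with ∈-map⁻ (a ∷_) r
    ... | _ , _ , refl = All.lookup y∉ a∈ refl

T-not⇒¬ : ∀ b → T (not b) → ¬ T b
T-not⇒¬ false _ ()

¬⇒T-not : ∀ b → ¬ T b → T (not b)
¬⇒T-not false _ = tt
¬⇒T-not true f = f tt

all⇒All : ∀ (p : A → Bool) xs → T (Data.Bool.ListAction.all p xs) → All (T ∘ p) xs
all⇒All p [] _ = []
all⇒All p (x ∷ xs) t with Equivalence.to T-∧ t
... | a , b = a ∷ all⇒All p xs b

All⇒all : ∀ (p : A → Bool) {xs} → All (T ∘ p) xs → T (Data.Bool.ListAction.all p xs)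
All⇒all p [] = tt
All⇒all p (x ∷ xs) = Equivalence.from T-∧ (x , All⇒all p xs)

distinct⇒Unique : ∀ xs → T (distinct xs) → Unique xs
distinct⇒Unique [] _ = []
distinct⇒Unique (x ∷ xs) t with Equivalence.to T-∧ t
... | a , b = All.map (λ {y} q e → T-not⇒¬ _ q (≡⇒≡ᵇ x y e)) (all⇒All _ xs a) ∷ distinct⇒Unique xs b

Unique⇒distinct : ∀ {xs} → Unique xs → T (distinct xs)
Unique⇒distinct [] = tt
Unique⇒distinct {x ∷ xs} (x∉ ∷ u) = Equivalence.from T-∧
  (All⇒all _ (All.map (λ {y} q → ¬⇒T-not _ (λ t → q (≡ᵇ⇒≡ x y t))) x∉) , Unique⇒distinct u)

record Perm (n : ℕ) (σ : List ℕ) : Set where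
  constructor perm
  field
    len    : length σ ≡ n
    range  : ∀ {v} → v ∈ σ → 1 ≤ v × v ≤ n
    unique : Unique σ

open Perm public

∈-S⁺ : ∀ {n σ} → Perm n σ → σ ∈ S n
∈-S⁺ {n} p = ∈-filterᵇ⁺ distinct
  (∈-words⁺ n (len p) (All.tabulate λ v∈ → uncurry ∈-oneTo⁺ (range p v∈))) (Unique⇒distinct (unique p))

∈-S⁻ : ∀ {n σ} → σ ∈ S n → Perm n σ
∈-S⁻ {n} {σ} σ∈ with ∈-filterᵇ⁻ distinct {xs = words n (oneTo n)} σ∈
... | w∈ , d with ∈-words⁻ n w∈
... | e , all = perm e (λ v∈ → ∈-oneTo⁻ (All.lookup all v∈)) (distinct⇒Unique σ d)

S-unique : ∀ n → Unique (S n)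
S-unique n = UniqueP.filter⁺ (T? ∘ distinct) (words-unique n (oneTo-unique n))

==ᴸ⇒≡ : ∀ xs ys → T (xs ==ᴸ ys) → xs ≡ ys
==ᴸ⇒≡ xs ys t with ≡-dec _≟_ xs ys
... | yes e = e

≡⇒==ᴸ : ∀ xs ys → xs ≡ ys → T (xs ==ᴸ ys)
≡⇒==ᴸ xs ys e with ≡-dec _≟_ xs ys
... | yes _ = tt
... | no ne = ne e

-- Comparing coefficients by injections

Avoids : List ℕ → List ℕ → Set
Avoids σ τ = ¬ T (contains σ τ)

-- One such injection bounds every coefficient of the generating polynomial at once, since it
-- preserves the whole exponent vector. `wilf` combines one in each direction.
record Transfer (st : Stats) (τ τ' : List ℕ) (n : ℕ) : Set₁ where
  field
    _∼_   : List ℕ → List ℕ → Set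
    total : ∀ {σ} → Perm n σ → Avoids σ τ → ∃ λ σ' → Perm n σ' × Avoids σ' τ' × st σ' ≡ st σ × σ ∼ σ'
    inj   : ∀ {σ ρ σ'} → Perm n σ → Avoids σ τ → Perm n ρ → Avoids ρ τ → Perm n σ' → σ ∼ σ' → ρ ∼ σ' → σ ≡ ρ

coeff-≤ : ∀ {st τ τ' n} → Transfer st τ τ' n → ∀ v → coeff st τ n v ≤ coeff st τ' n v
coeff-≤ {st} {τ} {τ'} {n} tr v =
  injection-≤ (λ σ σ' → Perm n σ' × σ ∼ σ') (UniqueP.filter⁺ (T? ∘ P τ) (S-unique n)) tot
    (λ σ∈ ρ∈ (p , r) (_ , r') →
      let (pσ , aσ , _) = split σ∈ ; (pρ , aρ , _) = split ρ∈ in inj pσ aσ pρ aρ p r r')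
  where
  open Transfer tr
  P : List ℕ → List ℕ → Bool
  P τ σ = avoids σ τ ∧ (st σ ==ᴸ v)
  split : ∀ {σ} → σ ∈ filterᵇ (P τ) (S n) → Perm n σ × Avoids σ τ × st σ ≡ v
  split {σ} σ∈ with ∈-filterᵇ⁻ (P τ) {xs = S n} σ∈
  ... | s , t with Equivalence.to (T-∧ {avoids σ τ}) t
  ... | a , b = ∈-S⁻ s , T-not⇒¬ _ a , ==ᴸ⇒≡ (st σ) v b
  tot : ∀ {σ} → σ ∈ filterᵇ (P τ) (S n) → ∃ λ σ' → σ' ∈ filterᵇ (P τ') (S n) × Perm n σ' × σ ∼ σ'
  tot {σ} σ∈ with split σ∈
  ... | pσ , aσ , e with total pσ aσ
  ... | σ' , p' , a' , e' , r = σ' , ∈-filterᵇ⁺ (P τ') (∈-S⁺ p')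
    (Equivalence.from (T-∧ {avoids σ' τ'}) (¬⇒T-not _ a' , ≡⇒==ᴸ (st σ') v (trans e' e))) , p' , r

wilf : ∀ {st τ τ'} → (∀ n → 1 ≤ n → Transfer st τ τ' n) → (∀ n → 1 ≤ n → Transfer st τ' τ n) → WilfEquiv st τ τ'
wilf f g n 1≤n v = ≤-antisym (coeff-≤ (f n 1≤n) v) (coeff-≤ (g n 1≤n) v)

-- Sums of indicators

private variable
  P Q R : Set

χ : Dec P → ℕ
χ d = if does d then 1 else 0

χ-yes : (d : Dec P) → P → χ d ≡ 1
χ-yes d p rewrite dec-true d p = refl

χ-no : (d : Dec P) → ¬ P → χ d ≡ 0
χ-no d p rewrite dec-false d p = refl

χ-cong : (d : Dec P) (e : Dec Q) → (P → Q) → (Q → P) → χ d ≡ χ e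
χ-cong (yes p) e f g = sym (χ-yes e (f p))
χ-cong (no ¬p) e f g = sym (χ-no e (¬p ∘ g))

χ-⊎ : (d : Dec P) (e : Dec Q) (f : Dec R) → (P → Q ⊎ R) → (Q → P) → (R → P) → ¬ (Q × R) → χ d ≡ χ e + χ f
χ-⊎ d (yes q) (yes r) to a b dis = contradiction (q , r) dis
χ-⊎ d (yes q) (no ¬r) to a b dis = χ-yes d (a q)
χ-⊎ d (no ¬q) (yes r) to a b dis = χ-yes d (b r)
χ-⊎ d (no ¬q) (no ¬r) to a b dis = χ-no d λ p → case to p of λ { (inj₁ q) → ¬q q ; (inj₂ r) → ¬r r }

infix 6 ∑
∑ : List A → (A → ℕ) → ℕ
∑ xs f = sum (map f xs)

∑-cong : ∀ (xs : List A) {f g : A → ℕ} → (∀ {x} → x ∈ xs → f x ≡ g x) → ∑ xs f ≡ ∑ xs g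
∑-cong [] h = refl
∑-cong (x ∷ xs) h = cong₂ _+_ (h (here refl)) (∑-cong xs (h ∘ there))

∑-0 : ∀ (xs : List A) {f : A → ℕ} → (∀ {x} → x ∈ xs → f x ≡ 0) → ∑ xs f ≡ 0
∑-0 [] h = refl
∑-0 (x ∷ xs) h rewrite h (here refl) = ∑-0 xs (h ∘ there)

+-interchange : ∀ a b c d → (a + b) + (c + d) ≡ (a + c) + (b + d)
+-interchange = solve 4 (λ a b c d → (a :+ b) :+ (c :+ d) := (a :+ c) :+ (b :+ d)) refl
  where open +-*-Solver

∑-+ : ∀ (xs : List A) (f g : A → ℕ) → ∑ xs (λ x → f x + g x) ≡ ∑ xs f + ∑ xs g
∑-+ [] f g = refl
∑-+ (x ∷ xs) f g rewrite ∑-+ xs f g = +-interchange (f x) (g x) (∑ xs f) (∑ xs g)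

∑-swap : ∀ (xs : List A) (ys : List B) (f : A → B → ℕ) →
  ∑ xs (λ x → ∑ ys (f x)) ≡ ∑ ys (λ y → ∑ xs (λ x → f x y))
∑-swap [] ys f = sym (∑-0 ys (λ _ → refl))
∑-swap (x ∷ xs) ys f rewrite ∑-swap xs ys f = sym (∑-+ ys (f x) _)

∑-++ : ∀ (xs ys : List A) (f : A → ℕ) → ∑ (xs ++ ys) f ≡ ∑ xs f + ∑ ys f
∑-++ xs ys f rewrite map-++ f xs ys = sum-++ (map f xs) (map f ys)

∑-map : ∀ (g : A → B) (xs : List A) (f : B → ℕ) → ∑ (map g xs) f ≡ ∑ xs (f ∘ g)
∑-map g xs f = cong sum (sym (map-∘ xs))

∑-↭ : ∀ {xs ys : List A} (f : A → ℕ) → xs ↭ ys → ∑ xs f ≡ ∑ ys f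
∑-↭ f p = sum-↭ (PermP.map⁺ f p)

∑-filterᵇ : ∀ (p : A → Bool) xs → length (filterᵇ p xs) ≡ ∑ xs (λ x → χ (T? (p x)))
∑-filterᵇ p [] = refl
∑-filterᵇ p (x ∷ xs) with p x
... | true = cong suc (∑-filterᵇ p xs)
... | false = ∑-filterᵇ p xs

∑-concatMap : ∀ (g : A → List B) xs (f : B → ℕ) → ∑ (concatMap g xs) f ≡ ∑ xs (λ x → ∑ (g x) f)
∑-concatMap g [] f = refl
∑-concatMap g (x ∷ xs) f = trans (∑-++ (g x) (concatMap g xs) f) (cong (∑ (g x) f +_) (∑-concatMap g xs f))

∑-χ-∃ : ∀ (xs : List A) {P : A → Set} (P? : ∀ x → Dec (P x)) → 0 < ∑ xs (χ ∘ P?) → ∃ λ x → x ∈ xs × P x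
∑-χ-∃ (x ∷ xs) P? lt with P? x
... | yes p = x , here refl , p
... | no _ = let (y , y∈ , q) = ∑-χ-∃ xs P? lt in y , there y∈ , q

∑-≥ : ∀ (xs : List A) (f : A → ℕ) {x} → x ∈ xs → f x ≤ ∑ xs f
∑-≥ (x ∷ xs) f (here refl) = m≤m+n (f x) _
∑-≥ (x ∷ xs) f (there x∈) = ≤-trans (∑-≥ xs f x∈) (m≤n+m _ (f x))

-- Permutations as functions on positions

at-∈ : ∀ σ {i} → 1 ≤ i → i ≤ length σ → at σ i ∈ σ
at-∈ [] {suc i} _ ()
at-∈ (x ∷ σ) {suc zero} _ _ = here refl
at-∈ (x ∷ σ) {suc (suc i)} _ (s≤s le) = there (at-∈ σ (s≤s z≤n) le)

∈-at : ∀ {σ v} → v ∈ σ → ∃ λ i → 1 ≤ i × i ≤ length σ × at σ i ≡ v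
∈-at (here refl) = 1 , s≤s z≤n , s≤s z≤n , refl
∈-at (there v∈) with ∈-at v∈
... | suc i , _ , le , e = suc (suc i) , s≤s z≤n , s≤s le , e

map-at : ∀ σ → map (at σ) (oneTo (length σ)) ≡ σ
map-at [] = refl
map-at (x ∷ σ) = cong (x ∷_) (trans lemma (map-at σ))
  where
  lemma : map (at (x ∷ σ)) (map suc (applyUpTo suc (length σ))) ≡ map (at σ) (oneTo (length σ))
  lemma = trans (cong (map (at (x ∷ σ)) ∘ map suc) (sym (map-upTo suc (length σ))))
    (trans (cong (map (at (x ∷ σ))) (sym (map-∘ (upTo (length σ)))))
      (trans (sym (map-∘ (upTo (length σ)))) (map-∘ (upTo (length σ)))))

at-map : ∀ (f : ℕ → ℕ) xs {i} → 1 ≤ i → i ≤ length xs → at (map f xs) i ≡ f (at xs i)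
at-map f [] {suc i} _ ()
at-map f (x ∷ xs) {suc zero} _ _ = refl
at-map f (x ∷ xs) {suc (suc i)} _ (s≤s le) = at-map f xs (s≤s z≤n) le

at-applyUpTo : ∀ (f : ℕ → ℕ) n {i} → i < n → at (applyUpTo f n) (suc i) ≡ f i
at-applyUpTo f (suc n) {zero} _ = refl
at-applyUpTo f (suc n) {suc i} (s≤s lt) = at-applyUpTo (f ∘ suc) n lt

at-map-oneTo : ∀ (f : ℕ → ℕ) {n i} → 1 ≤ i → i ≤ n → at (map f (oneTo n)) i ≡ f i
at-map-oneTo f {n} {suc i} 1≤i le = trans (at-map f (oneTo n) 1≤i (≤-trans le (≤-reflexive (sym (length-oneTo n)))))
  (cong f (trans (at-map suc (upTo n) 1≤i (≤-trans le (≤-reflexive (sym (length-upTo n))))) (cong suc (at-applyUpTo id n le))))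

at-injective : ∀ {σ i j} → Unique σ → 1 ≤ i → i ≤ length σ → 1 ≤ j → j ≤ length σ → at σ i ≡ at σ j → i ≡ j
at-injective {[]} {suc i} _ _ ()
at-injective {x ∷ σ} {suc zero} {suc zero} u _ _ _ _ e = refl
at-injective {x ∷ σ} {suc zero} {suc (suc j)} (x∉ ∷ u) _ _ _ (s≤s le) e = contradiction e (All.lookup x∉ (at-∈ σ (s≤s z≤n) le))
at-injective {x ∷ σ} {suc (suc i)} {suc zero} (x∉ ∷ u) _ (s≤s le) _ _ e = contradiction (sym e) (All.lookup x∉ (at-∈ σ (s≤s z≤n) le))
at-injective {x ∷ σ} {suc (suc i)} {suc (suc j)} (x∉ ∷ u) _ (s≤s le) _ (s≤s le') e =
  cong suc (at-injective u (s≤s z≤n) le (s≤s z≤n) le' e)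

at-ext : ∀ σ τ → length σ ≡ length τ → (∀ {i} → 1 ≤ i → i ≤ length σ → at σ i ≡ at τ i) → σ ≡ τ
at-ext σ τ e h = trans (sym (map-at σ)) (trans (map-cong-∈ (oneTo (length σ)) λ i∈ → uncurry h (∈-oneTo⁻ i∈))
    (trans (cong (map (at τ) ∘ oneTo) e) (map-at τ)))
  where
  map-cong-∈ : ∀ (xs : List ℕ) {f g : ℕ → ℕ} → (∀ {x} → x ∈ xs → f x ≡ g x) → map f xs ≡ map g xs
  map-cong-∈ [] h = refl
  map-cong-∈ (x ∷ xs) h = cong₂ _∷_ (h (here refl)) (map-cong-∈ xs (h ∘ there))

Perm-↭ : ∀ {n σ} → Perm n σ → σ ↭ oneTo n
Perm-↭ {n} p = unique-⊆⇒↭ (unique p) (oneTo-unique n) (λ v∈ → uncurry ∈-oneTo⁺ (range p v∈))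
  (≤-reflexive (trans (length-oneTo n) (sym (len p))))

module _ {n σ} (p : Perm n σ) where

  at-range : ∀ {i} → 1 ≤ i → i ≤ n → 1 ≤ at σ i × at σ i ≤ n
  at-range 1≤i i≤n = range p (at-∈ σ 1≤i (≤-trans i≤n (≤-reflexive (sym (len p)))))

  at-inj : ∀ {i j} → 1 ≤ i → i ≤ n → 1 ≤ j → j ≤ n → at σ i ≡ at σ j → i ≡ j
  at-inj 1≤i i≤n 1≤j j≤n rewrite sym (len p) = at-injective (unique p) 1≤i i≤n 1≤j j≤n

  at-sur : ∀ {v} → 1 ≤ v → v ≤ n → ∃ λ i → 1 ≤ i × i ≤ n × at σ i ≡ v
  at-sur 1≤v v≤n with ∈-at {σ} (PermP.∈-resp-↭ (↭-sym (Perm-↭ p)) (∈-oneTo⁺ 1≤v v≤n))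
  ... | i , a , b , e = i , a , ≤-trans b (≤-reflexive (len p)) , e

  ∑-at : ∀ (f : ℕ → ℕ) → ∑ (oneTo n) (f ∘ at σ) ≡ ∑ (oneTo n) f
  ∑-at f = trans (sym (∑-map (at σ) (oneTo n) f)) (∑-↭ f (subst (_↭ oneTo n) (sym σ≡) (Perm-↭ p)))
    where
    σ≡ : map (at σ) (oneTo n) ≡ σ
    σ≡ = subst (λ m → map (at σ) (oneTo m) ≡ σ) (len p) (map-at σ)

  -- Together with {i : i < t, σ(i) < t} the two sides make up {i : i < t} and {i : σ(i) < t}.
  cut : ∀ t → ∑ (oneTo n) (λ i → χ ((i <? t) ×-dec (t ≤? at σ i))) ≡ ∑ (oneTo n) (λ i → χ ((at σ i <? t) ×-dec (t ≤? i)))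
  cut t = +-cancelˡ-≡ (∑ (oneTo n) both) _ _ (begin
    ∑ (oneTo n) both + ∑ (oneTo n) a  ≡⟨ sym (∑-+ (oneTo n) both a) ⟩
    ∑ (oneTo n) (λ i → both i + a i)  ≡⟨ ∑-cong (oneTo n) (λ {i} _ → sym (χ-⊎ (i <? t) ((i <? t) ×-dec (at σ i <? t)) ((i <? t) ×-dec (t ≤? at σ i)) (λ l → split l (at σ i)) proj₁ proj₁ λ { ((_ , x) , (_ , y)) → <⇒≱ x y })) ⟩
    ∑ (oneTo n) (λ i → χ (i <? t))    ≡⟨ sym (∑-at (λ i → χ (i <? t))) ⟩
    ∑ (oneTo n) (λ i → χ (at σ i <? t)) ≡⟨ ∑-cong (oneTo n) (λ {i} _ → χ-⊎ (at σ i <? t) ((i <? t) ×-dec (at σ i <? t)) ((at σ i <? t) ×-dec (t ≤? i)) (λ l → split' l i) proj₂ proj₁ λ { ((x , _) , (_ , y)) → <⇒≱ x y }) ⟩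
    ∑ (oneTo n) (λ i → both i + b i)  ≡⟨ ∑-+ (oneTo n) both b ⟩
    ∑ (oneTo n) both + ∑ (oneTo n) b  ∎)
    where
    open ≡-Reasoning
    both a b : ℕ → ℕ
    both i = χ ((i <? t) ×-dec (at σ i <? t))
    a i = χ ((i <? t) ×-dec (t ≤? at σ i))
    b i = χ ((at σ i <? t) ×-dec (t ≤? i))
    split : ∀ {i} → i < t → ∀ v → (i < t × v < t) ⊎ (i < t × t ≤ v)
    split l v with v <? t
    ... | yes q = inj₁ (l , q)
    ... | no q = inj₂ (l , ≮⇒≥ q)
    split' : ∀ {v} → v < t → ∀ i → (i < t × v < t) ⊎ (v < t × t ≤ i)
    split' l i with i <? t
    ... | yes q = inj₁ (q , l)
    ... | no q = inj₂ (l , ≮⇒≥ q)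

-- Crossings and nestings as sums over pairs of arcs

Cross Nest : ℕ → ℕ → ℕ → ℕ → Set
Cross i v j w = (i < j × j < v × v < w) ⊎ (v < w × w ≤ i × i < j)
Nest i v j w = (i < j × j < w × w < v) ⊎ (w < v × v ≤ i × i < j)

cross? : ∀ i v j w → Dec (Cross i v j w)
cross? i v j w = ((i <? j) ×-dec ((j <? v) ×-dec (v <? w))) ⊎-dec ((v <? w) ×-dec ((w ≤? i) ×-dec (i <? j)))

nest? : ∀ i v j w → Dec (Nest i v j w)
nest? i v j w = ((i <? j) ×-dec ((j <? w) ×-dec (w <? v))) ⊎-dec ((w <? v) ×-dec ((v ≤? i) ×-dec (i <? j)))

pairSum : (ℕ → ℕ → ℕ → ℕ → ℕ) → List ℕ → ℕ
pairSum f σ = ∑ (oneTo (length σ)) λ i → ∑ (oneTo (length σ)) λ j → f i (at σ i) j (at σ j)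

∑-pairs : ∀ n (f : ℕ × ℕ → ℕ) → ∑ (pairs n) f ≡ ∑ (oneTo n) (λ i → ∑ (oneTo n) (λ j → f (i , j)))
∑-pairs n f = trans (∑-concatMap (λ i → map (i ,_) (oneTo n)) (oneTo n) f) (∑-cong (oneTo n) λ {i} _ → ∑-map (i ,_) (oneTo n) f)

-- `does (cross? i v j w)` unfolds to the same boolean expression as `isCrossing`, so only the list
-- of pairs has to be turned into a double sum.
crs-∑ : ∀ σ → crs σ ≡ pairSum (λ i v j w → χ (cross? i v j w)) σ
crs-∑ σ = trans (∑-filterᵇ (isCrossing σ) (pairs (length σ))) (∑-pairs (length σ) _)

nes-∑ : ∀ σ → nes σ ≡ pairSum (λ i v j w → χ (nest? i v j w)) σ
nes-∑ σ = trans (∑-filterᵇ (isNesting σ) (pairs (length σ))) (∑-pairs (length σ) _)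

-- Occurrences of patterns of length 3

Order : Pat3 → ℕ → ℕ → ℕ → Set
Order p123 a b c = a < b × b < c
Order p132 a b c = a < c × c < b
Order p213 a b c = b < a × a < c
Order p231 a b c = c < a × a < b
Order p312 a b c = b < c × c < a
Order p321 a b c = c < b × b < a

Occurs : Pat3 → List ℕ → Set
Occurs p σ = ∃ λ i → ∃ λ j → ∃ λ k → 1 ≤ i × i < j × j < k × k ≤ length σ × Order p (at σ i) (at σ j) (at σ k)

<ᵇ-true : ∀ {m n} → m < n → (m <ᵇ n) ≡ true
<ᵇ-true lt = dec-true (_ <? _) lt

<ᵇ-false : ∀ {m n} → n ≤ m → (m <ᵇ n) ≡ false
<ᵇ-false le = dec-false (_ <? _) (≤⇒≯ le)

ranks : List ℕ → List ℕ
ranks s = map (λ x → suc (∑ s (λ y → χ (y <? x)))) s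

red≡ranks : ∀ s → red s ≡ ranks s
red≡ranks s = map-cong (λ x → cong suc (∑-filterᵇ (λ y → y <ᵇ x) s)) s

red-Order : ∀ p {a b c} → Order p a b c → red (a ∷ b ∷ c ∷ []) ≡ pat p
red-Order p {a} {b} {c} o = trans (red≡ranks (a ∷ b ∷ c ∷ [])) (go p o)
  where
  go : ∀ p → Order p a b c → ranks (a ∷ b ∷ c ∷ []) ≡ pat p
  go p123 (u , v)
    rewrite <ᵇ-false (≤-refl {a}) | <ᵇ-false (≤-refl {b}) | <ᵇ-false (≤-refl {c}) | <ᵇ-true u | <ᵇ-true v
          | <ᵇ-true (<-trans u v) | <ᵇ-false (<⇒≤ u) | <ᵇ-false (<⇒≤ v) | <ᵇ-false (<⇒≤ (<-trans u v)) = refl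
  go p132 (u , v)
    rewrite <ᵇ-false (≤-refl {a}) | <ᵇ-false (≤-refl {b}) | <ᵇ-false (≤-refl {c}) | <ᵇ-true u | <ᵇ-true v
          | <ᵇ-true (<-trans u v) | <ᵇ-false (<⇒≤ u) | <ᵇ-false (<⇒≤ v) | <ᵇ-false (<⇒≤ (<-trans u v)) = refl
  go p213 (u , v)
    rewrite <ᵇ-false (≤-refl {a}) | <ᵇ-false (≤-refl {b}) | <ᵇ-false (≤-refl {c}) | <ᵇ-true u | <ᵇ-true v
          | <ᵇ-true (<-trans u v) | <ᵇ-false (<⇒≤ u) | <ᵇ-false (<⇒≤ v) | <ᵇ-false (<⇒≤ (<-trans u v)) = refl
  go p231 (u , v)
    rewrite <ᵇ-false (≤-refl {a}) | <ᵇ-false (≤-refl {b}) | <ᵇ-false (≤-refl {c}) | <ᵇ-true u | <ᵇ-true v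
          | <ᵇ-true (<-trans u v) | <ᵇ-false (<⇒≤ u) | <ᵇ-false (<⇒≤ v) | <ᵇ-false (<⇒≤ (<-trans u v)) = refl
  go p312 (u , v)
    rewrite <ᵇ-false (≤-refl {a}) | <ᵇ-false (≤-refl {b}) | <ᵇ-false (≤-refl {c}) | <ᵇ-true u | <ᵇ-true v
          | <ᵇ-true (<-trans u v) | <ᵇ-false (<⇒≤ u) | <ᵇ-false (<⇒≤ v) | <ᵇ-false (<⇒≤ (<-trans u v)) = refl
  go p321 (u , v)
    rewrite <ᵇ-false (≤-refl {a}) | <ᵇ-false (≤-refl {b}) | <ᵇ-false (≤-refl {c}) | <ᵇ-true u | <ᵇ-true v
          | <ᵇ-true (<-trans u v) | <ᵇ-false (<⇒≤ u) | <ᵇ-false (<⇒≤ v) | <ᵇ-false (<⇒≤ (<-trans u v)) = refl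

Distinct³ : List ℕ → Set
Distinct³ (a ∷ b ∷ c ∷ []) = a ≢ b × b ≢ c × a ≢ c
Distinct³ _ = ⊥

pat-distinct : ∀ p → Distinct³ (pat p)
pat-distinct p123 = (λ ()) , (λ ()) , (λ ())
pat-distinct p132 = (λ ()) , (λ ()) , (λ ())
pat-distinct p213 = (λ ()) , (λ ()) , (λ ())
pat-distinct p231 = (λ ()) , (λ ()) , (λ ())
pat-distinct p312 = (λ ()) , (λ ()) , (λ ())
pat-distinct p321 = (λ ()) , (λ ()) , (λ ())

unpat : List ℕ → Pat3
unpat (1 ∷ 2 ∷ _) = p123
unpat (1 ∷ _)     = p132
unpat (2 ∷ 1 ∷ _) = p213
unpat (2 ∷ _)     = p231
unpat (3 ∷ 1 ∷ _) = p312
unpat _           = p321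

unpat-pat : ∀ p → unpat (pat p) ≡ p
unpat-pat p123 = refl
unpat-pat p132 = refl
unpat-pat p213 = refl
unpat-pat p231 = refl
unpat-pat p312 = refl
unpat-pat p321 = refl

classify : ∀ {a b c} → a ≢ b → b ≢ c → a ≢ c → ∃ λ p → Order p a b c
classify {a} {b} {c} ab bc ac with <-cmp a b | <-cmp b c | <-cmp a c
... | tri≈ _ e _ | _ | _ = contradiction e ab
... | tri< _ _ _ | tri≈ _ e _ | _ = contradiction e bc
... | tri> _ _ _ | tri≈ _ e _ | _ = contradiction e bc
... | tri< _ _ _ | tri< _ _ _ | tri≈ _ e _ = contradiction e ac
... | tri< _ _ _ | tri> _ _ _ | tri≈ _ e _ = contradiction e ac
... | tri> _ _ _ | tri< _ _ _ | tri≈ _ e _ = contradiction e ac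
... | tri> _ _ _ | tri> _ _ _ | tri≈ _ e _ = contradiction e ac
... | tri< x _ _ | tri< y _ _ | _ = p123 , x , y
... | tri< x _ _ | tri> _ _ y | tri< z _ _ = p132 , z , y
... | tri< x _ _ | tri> _ _ y | tri> _ _ z = p231 , z , x
... | tri> _ _ x | tri< y _ _ | tri< z _ _ = p213 , x , z
... | tri> _ _ x | tri< y _ _ | tri> _ _ z = p312 , y , z
... | tri> _ _ x | tri> _ _ y | _ = p321 , y , x

-- Reductions are computed in one direction only, from the order to the pattern. Conversely, three
-- distinct entries are in one of the six orders, which yields some `pat q`, and `pat` is injective.
red-pat⁻ : ∀ p s → red s ≡ pat p → ∃ λ a → ∃ λ b → ∃ λ c → s ≡ a ∷ b ∷ c ∷ [] × Order p a b c
-- `Distinct³ (red s)` is empty unless `red s`, and hence `s`, has exactly three entries; this fixes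
-- the shape of `s` in the only remaining clause.
red-pat⁻ p s e with subst Distinct³ (sym e) (pat-distinct p)
red-pat⁻ p (a ∷ b ∷ c ∷ []) e | ab , bc , ac
  with classify {a} {b} {c} (λ { refl → ab refl }) (λ { refl → bc refl }) (λ { refl → ac refl })
... | q , o = a , b , c , refl , subst (λ r → Order r a b c) q≡p o
  where
  q≡p : q ≡ p
  q≡p = trans (sym (unpat-pat q)) (trans (cong unpat (trans (sym (red-Order q o)) e)) (unpat-pat p))

[]∈subseqs : ∀ σ → [] ∈ subseqs σ
[]∈subseqs [] = here refl
[]∈subseqs (x ∷ σ) = ∈-++⁺ʳ (map (x ∷_) (subseqs σ)) ([]∈subseqs σ)

∈-subseqs-∷⁻ : ∀ x {σ s} → s ∈ subseqs (x ∷ σ) → (∃ λ s' → s' ∈ subseqs σ × s ≡ x ∷ s') ⊎ s ∈ subseqs σ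
∈-subseqs-∷⁻ x {σ} s∈ with ∈-++⁻ (map (x ∷_) (subseqs σ)) s∈
... | inj₁ p = inj₁ (∈-map⁻ (x ∷_) p)
... | inj₂ p = inj₂ p

keep : ∀ x σ {s} → s ∈ subseqs σ → (x ∷ s) ∈ subseqs (x ∷ σ)
keep x σ p = ∈-++⁺ˡ (∈-map⁺ (x ∷_) p)

skip : ∀ x σ {s} → s ∈ subseqs σ → s ∈ subseqs (x ∷ σ)
skip x σ p = ∈-++⁺ʳ (map (x ∷_) (subseqs σ)) p

data Positions (n : ℕ) : ℕ → List ℕ → Set where
  []  : ∀ {m} → Positions n m []
  _∷_ : ∀ {m i is} → m < i × i ≤ n → Positions n i is → Positions n m (i ∷ is)

shift : ∀ {n m is} → Positions n m is → Positions (suc n) (suc m) (map suc is)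
shift [] = []
shift ((a , b) ∷ p) = (s≤s a , s≤s b) ∷ shift p

lower : ∀ {n m m' is} → m' ≤ m → Positions n m is → Positions n m' is
lower le [] = []
lower le ((a , b) ∷ p) = (≤-<-trans le a , b) ∷ p

unshift : ∀ {n m is} → Positions (suc n) (suc m) is → ∃ λ js → is ≡ map suc js × Positions n m js
unshift [] = [] , refl , []
unshift (_∷_ {i = suc i} (s≤s a , s≤s b) p) with unshift p
... | js , refl , q = i ∷ js , refl , (a , b) ∷ q

map-at-suc : ∀ x σ {m is} → Positions (length σ) m is → map (at (x ∷ σ)) (map suc is) ≡ map (at σ) is
map-at-suc x σ [] = refl
map-at-suc x σ (_∷_ {i = suc i} _ p) = cong (at σ (suc i) ∷_) (map-at-suc x σ p)

∈-subseqs⁻ : ∀ σ {s} → s ∈ subseqs σ → ∃ λ is → Positions (length σ) 0 is × map (at σ) is ≡ s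
∈-subseqs⁻ [] (here refl) = [] , [] , refl
∈-subseqs⁻ (x ∷ σ) s∈ with ∈-subseqs-∷⁻ x {σ} s∈
... | inj₁ (s' , p , refl) with ∈-subseqs⁻ σ p
... | is , q , refl = 1 ∷ map suc is , (s≤s z≤n , s≤s z≤n) ∷ shift q , cong (x ∷_) (map-at-suc x σ q)
∈-subseqs⁻ (x ∷ σ) s∈ | inj₂ p with ∈-subseqs⁻ σ p
... | is , q , refl = map suc is , lower z≤n (shift q) , map-at-suc x σ q

∈-subseqs⁺ : ∀ σ {is} → Positions (length σ) 0 is → map (at σ) is ∈ subseqs σ
∈-subseqs⁺ σ [] = []∈subseqs σ
∈-subseqs⁺ (x ∷ σ) (_∷_ {i = suc zero} _ p) with unshift p
... | js , refl , q rewrite map-at-suc x σ q = keep x σ (∈-subseqs⁺ σ q)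
∈-subseqs⁺ (x ∷ σ) {_ ∷ is} (_∷_ {i = suc (suc i)} (_ , s≤s b) p) with unshift p
... | js , refl , q rewrite map-at-suc x σ q = skip x σ (∈-subseqs⁺ σ {suc i ∷ js} ((s≤s z≤n , b) ∷ q))

contains⁺ : ∀ p {σ} → Occurs p σ → T (contains σ (pat p))
contains⁺ p {σ} (i , j , k , 1≤i , i<j , j<k , k≤n , o) =
  AnyP.any⁺ _ (lose (∈-subseqs⁺ σ {i ∷ j ∷ k ∷ []} ((1≤i , ≤-trans (<⇒≤ (<-trans i<j j<k)) k≤n) ∷ (i<j , ≤-trans (<⇒≤ j<k) k≤n) ∷ (j<k , k≤n) ∷ []))
    (≡⇒==ᴸ _ (pat p) (red-Order p o)))

contains⁻ : ∀ p {σ} → T (contains σ (pat p)) →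
  ∃ λ a → ∃ λ b → ∃ λ c → (a ∷ b ∷ c ∷ []) ∈ subseqs σ × Order p a b c
contains⁻ p {σ} t with find (AnyP.any⁻ _ (subseqs σ) t)
... | s , s∈ , q with red-pat⁻ p s (==ᴸ⇒≡ (red s) (pat p) q)
... | a , b , c , refl , o = a , b , c , s∈ , o

contains⇒Occurs : ∀ p {σ} → T (contains σ (pat p)) → Occurs p σ
contains⇒Occurs p {σ} t with contains⁻ p {σ} t
... | a , b , c , s∈ , o with ∈-subseqs⁻ σ s∈
... | _ , (i ∷ j ∷ k ∷ []) , refl = _ , _ , _ , proj₁ i , proj₁ j , proj₁ k , proj₂ k , o

subseq⇒contains : ∀ p {σ a b c} → (a ∷ b ∷ c ∷ []) ∈ subseqs σ → Order p a b c → T (contains σ (pat p))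
subseq⇒contains p s∈ o = AnyP.any⁺ _ (lose s∈ (≡⇒==ᴸ _ (pat p) (red-Order p o)))

-- Inversion and reverse-complement-inverse

-- For an involution ρ of [n] this describes σ' = ρ ∘ σ⁻¹ ∘ ρ.
Conj : (ℕ → ℕ) → ℕ → List ℕ → List ℕ → Set
Conj ρ n σ σ' = ∀ {i} → 1 ≤ i → i ≤ n → at σ' (ρ (at σ i)) ≡ ρ i

position : List ℕ → ℕ → ℕ
position [] v = 0
position (x ∷ σ) v with x ≟ v
... | yes _ = 1
... | no _  = suc (position σ v)

position-∈ : ∀ σ {v} → v ∈ σ → 1 ≤ position σ v × position σ v ≤ length σ × at σ (position σ v) ≡ v
position-∈ (x ∷ σ) {v} v∈ with x ≟ v
... | yes e = s≤s z≤n , s≤s z≤n , e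
... | no ne with v∈
... | here e = contradiction (sym e) ne
... | there v∈' with position σ v | position-∈ σ v∈'
... | suc k | _ , le , e = s≤s z≤n , s≤s le , e

module _ {n σ} (p : Perm n σ) where

  private
    ∈σ : ∀ {v} → 1 ≤ v → v ≤ n → v ∈ σ
    ∈σ 1≤v v≤n with at-sur p 1≤v v≤n
    ... | i , 1≤i , i≤n , refl = at-∈ σ 1≤i (≤-trans i≤n (≤-reflexive (sym (len p))))

  position-range : ∀ {v} → 1 ≤ v → v ≤ n → 1 ≤ position σ v × position σ v ≤ n
  position-range 1≤v v≤n with position-∈ σ (∈σ 1≤v v≤n)
  ... | a , b , _ = a , ≤-trans b (≤-reflexive (len p))

  at-position : ∀ {v} → 1 ≤ v → v ≤ n → at σ (position σ v) ≡ v
  at-position 1≤v v≤n = proj₂ (proj₂ (position-∈ σ (∈σ 1≤v v≤n)))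

  position-at : ∀ {i} → 1 ≤ i → i ≤ n → position σ (at σ i) ≡ i
  position-at {i} a b with at-range p a b
  ... | c , d with position-range c d
  ... | e , f = at-inj p e f a b (at-position c d)

module Conjugate (n : ℕ) (ρ : ℕ → ℕ) (ρ-range : ∀ {i} → 1 ≤ i → i ≤ n → 1 ≤ ρ i × ρ i ≤ n)
  (ρρ : ∀ {i} → 1 ≤ i → i ≤ n → ρ (ρ i) ≡ i) where

  conj : ∀ {σ} → Perm n σ → ∃ λ σ' → Perm n σ' × Conj ρ n σ σ'
  conj {σ} p = map f (oneTo n) , perm (trans (length-map f (oneTo n)) (length-oneTo n)) rng uni , com
    where
    f : ℕ → ℕ
    f v = ρ (position σ (ρ v))
    f-range : ∀ {v} → 1 ≤ v → v ≤ n → 1 ≤ f v × f v ≤ n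
    f-range a b = let (c , d) = ρ-range a b ; (e , g) = position-range p c d in ρ-range e g
    rng : ∀ {v} → v ∈ map f (oneTo n) → 1 ≤ v × v ≤ n
    rng v∈ with ∈-map⁻ f v∈
    ... | u , u∈ , refl = uncurry f-range (∈-oneTo⁻ u∈)
    back : ∀ {v} → 1 ≤ v → v ≤ n → ρ (at σ (ρ (f v))) ≡ v
    back {v} a b = let (c , d) = ρ-range a b ; (e , g) = position-range p c d in
      trans (cong (ρ ∘ at σ) (ρρ e g)) (trans (cong ρ (at-position p c d)) (ρρ a b))
    uni : Unique (map f (oneTo n))
    uni = unique-map f (λ {x} {y} x∈ y∈ e → trans (sym (uncurry back (∈-oneTo⁻ x∈)))
      (trans (cong (ρ ∘ at σ ∘ ρ) e) (uncurry back (∈-oneTo⁻ y∈)))) (oneTo-unique n)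
    com : Conj ρ n σ (map f (oneTo n))
    com {i} a b = let (c , d) = at-range p a b ; (e , g) = ρ-range c d in
      trans (at-map-oneTo f e g) (cong ρ (trans (cong (position σ) (ρρ c d)) (position-at p a b)))

  conj-inj : ∀ {σ τ σ'} → Perm n σ → Perm n τ → Perm n σ' → Conj ρ n σ σ' → Conj ρ n τ σ' → σ ≡ τ
  conj-inj {σ} {τ} {σ'} p q r f g = at-ext σ τ (trans (len p) (sym (len q))) λ a b →
    let b' = ≤-trans b (≤-reflexive (len p)) ; (c , d) = at-range p a b' ; (c' , d') = at-range q a b'
        (e , h) = ρ-range c d ; (e' , h') = ρ-range c' d' in
    trans (sym (ρρ c d)) (trans (cong ρ (at-inj r e h e' h' (trans (f a b') (sym (g a b'))))) (ρρ c' d'))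

  module _ {σ σ'} (p : Perm n σ) (p' : Perm n σ') (c : Conj ρ n σ σ') where

    ρ∘at-sur : ∀ {k} → 1 ≤ k → k ≤ n → ∃ λ i → 1 ≤ i × i ≤ n × ρ (at σ i) ≡ k
    ρ∘at-sur a b with ρ-range a b
    ... | d , e with at-sur p d e
    ... | i , f , g , h = i , f , g , trans (cong ρ h) (ρρ a b)

    ∑-ρ : ∀ f → ∑ (oneTo n) (f ∘ ρ) ≡ ∑ (oneTo n) f
    ∑-ρ f = trans (sym (∑-map ρ (oneTo n) f)) (∑-↭ f (unique-⊆⇒↭
      (unique-map ρ (λ x∈ y∈ e → trans (sym (uncurry ρρ (∈-oneTo⁻ x∈))) (trans (cong ρ e) (uncurry ρρ (∈-oneTo⁻ y∈)))) (oneTo-unique n))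
      (oneTo-unique n) sub (≤-reflexive (sym (length-map ρ (oneTo n))))))
      where
      sub : ∀ {x} → x ∈ map ρ (oneTo n) → x ∈ oneTo n
      sub x∈ with ∈-map⁻ ρ x∈
      ... | y , y∈ , refl = let (a , b) = ∈-oneTo⁻ y∈ ; (d , e) = ρ-range a b in ∈-oneTo⁺ d e

    ∑-ρ∘at : ∀ f → ∑ (oneTo n) (λ i → f (ρ (at σ i))) ≡ ∑ (oneTo n) f
    ∑-ρ∘at f = trans (∑-at p (f ∘ ρ)) (∑-ρ f)

    -- Both `i` and `j` are replaced by ρ(σ(i)) and ρ(σ(j)), which run through all positions; there
    -- σ' takes the values ρ(i) and ρ(j).
    pairSum-conj : ∀ f → pairSum f σ' ≡ ∑ (oneTo n) λ i → ∑ (oneTo n) λ j → f (ρ (at σ i)) (ρ i) (ρ (at σ j)) (ρ j)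
    pairSum-conj f rewrite len p' = trans (sym (∑-ρ∘at _)) (∑-cong (oneTo n) λ {i} i∈ →
      trans (sym (∑-ρ∘at _)) (∑-cong (oneTo n) λ {j} j∈ →
        cong₂ (λ x y → f (ρ (at σ i)) x (ρ (at σ j)) y) (uncurry c (∈-oneTo⁻ i∈)) (uncurry c (∈-oneTo⁻ j∈))))

    -- An occurrence in σ' at positions ρ(σ(i)) < ρ(σ(j)) < ρ(σ(k)) has the values ρ(i), ρ(j), ρ(k):
    -- positions and values trade places, so the order of the values in σ' tells in which order i,
    -- j, k occur in σ.
    occurs-conj : ∀ q q' →
      (∀ {i j k} → 1 ≤ i → i ≤ n → 1 ≤ j → j ≤ n → 1 ≤ k → k ≤ n →
        ρ (at σ i) < ρ (at σ j) → ρ (at σ j) < ρ (at σ k) → Order q (ρ i) (ρ j) (ρ k) → Occurs q' σ) →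
      Avoids σ (pat q') → Avoids σ' (pat q)
    occurs-conj q q' h av t with contains⇒Occurs q {σ'} t
    ... | x , y , z , 1≤x , x<y , y<z , z≤ , o
      with z≤n' ← ≤-trans z≤ (≤-reflexive (len p'))
      with y≤n ← ≤-trans (<⇒≤ y<z) z≤n' with 1≤y ← ≤-trans 1≤x (<⇒≤ x<y)
      with ρ∘at-sur 1≤x (≤-trans (<⇒≤ x<y) y≤n) | ρ∘at-sur 1≤y y≤n | ρ∘at-sur (≤-trans 1≤y (<⇒≤ y<z)) z≤n'
    ... | i , a1 , a2 , refl | j , b1 , b2 , refl | k , c1 , c2 , refl
      rewrite c a1 a2 | c b1 b2 | c c1 c2 = av (contains⁺ q' {σ} (h a1 a2 b1 b2 c1 c2 x<y y<z o))

pairSum-length : ∀ {n σ} → Perm n σ → ∀ f → pairSum f σ ≡ ∑ (oneTo n) λ i → ∑ (oneTo n) λ j → f i (at σ i) j (at σ j)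
pairSum-length p f rewrite len p = refl

module ReverseComplementInverse (n : ℕ) where

  ρ : ℕ → ℕ
  ρ i = suc n ∸ i

  ρ-range : ∀ {i} → 1 ≤ i → i ≤ n → 1 ≤ ρ i × ρ i ≤ n
  ρ-range {suc i} _ i≤n = m<n⇒0<n∸m i≤n , m∸n≤m n i

  open Conjugate n ρ ρ-range (λ _ i≤n → m∸[m∸n]≡n (≤-trans i≤n (n≤1+n n))) public

  ρ-< : ∀ {i j} → i ≤ n → ρ i < ρ j → j < i
  ρ-< i≤n lt = ≰⇒> λ i≤j → <⇒≱ lt (∸-monoʳ-≤ (suc n) i≤j)

  ρ-≤ : ∀ {i j} → j ≤ n → ρ i ≤ ρ j → j ≤ i
  ρ-≤ {i} {j} j≤n le = ≮⇒≥ λ i<j → <⇒≱ (∸-monoʳ-< i<j (≤-trans j≤n (n≤1+n n))) le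

  ρ-<⁺ : ∀ {i j} → i ≤ n → j < i → ρ i < ρ j
  ρ-<⁺ i≤n j<i = ∸-monoʳ-< j<i (≤-trans i≤n (n≤1+n n))

  ρ-≤⁺ : ∀ {i j} → j ≤ i → ρ i ≤ ρ j
  ρ-≤⁺ = ∸-monoʳ-≤ (suc n)

  module _ {σ σ'} (p : Perm n σ) (p' : Perm n σ') (c : Conj ρ n σ σ') where
    private
      conjugated : ∀ {F G : ℕ → ℕ → ℕ → ℕ → Set} (F? : ∀ i v j w → Dec (F i v j w)) (G? : ∀ i v j w → Dec (G i v j w)) →
        (∀ {i v j w} → i ≤ n → v ≤ n → j ≤ n → w ≤ n → F (ρ v) (ρ i) (ρ w) (ρ j) → G i v j w) →
        (∀ {i v j w} → i ≤ n → v ≤ n → j ≤ n → w ≤ n → G i v j w → F (ρ v) (ρ i) (ρ w) (ρ j)) →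
        pairSum (λ i v j w → χ (F? i v j w)) σ' ≡ pairSum (λ i v j w → χ (G? i v j w)) σ
      conjugated F? G? to from = trans (pairSum-conj p p' c (λ i v j w → χ (F? i v j w))) (trans (∑-cong (oneTo n) λ {i} i∈ → ∑-cong (oneTo n) λ {j} j∈ →
          let (1≤i , i≤n) = ∈-oneTo⁻ i∈ ; (1≤j , j≤n) = ∈-oneTo⁻ j∈
              v≤n = proj₂ (at-range p 1≤i i≤n) ; w≤n = proj₂ (at-range p 1≤j j≤n) in
          χ-cong (F? (ρ (at σ i)) (ρ i) (ρ (at σ j)) (ρ j)) (G? i (at σ i) j (at σ j)) (to i≤n v≤n j≤n w≤n) (from i≤n v≤n j≤n w≤n))
        (sym (pairSum-length p (λ i v j w → χ (G? i v j w)))))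

    crs-invariant : crs σ' ≡ crs σ
    crs-invariant = trans (crs-∑ σ') (trans (conjugated cross? (λ i v j w → cross? j w i v)
      (λ { i≤ v≤ j≤ w≤ (inj₁ (a , b , d)) → inj₁ (ρ-< i≤ d , ρ-< w≤ b , ρ-< v≤ a)
         ; i≤ v≤ j≤ w≤ (inj₂ (a , b , d)) → inj₂ (ρ-< v≤ d , ρ-≤ v≤ b , ρ-< i≤ a) })
      (λ { i≤ v≤ j≤ w≤ (inj₁ (a , b , d)) → inj₁ (ρ-<⁺ v≤ d , ρ-<⁺ w≤ b , ρ-<⁺ i≤ a)
         ; i≤ v≤ j≤ w≤ (inj₂ (a , b , d)) → inj₂ (ρ-<⁺ i≤ d , ρ-≤⁺ b , ρ-<⁺ v≤ a) }))
      (trans (∑-swap (oneTo (length σ)) (oneTo (length σ)) _) (sym (crs-∑ σ))))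

    nes-invariant : nes σ' ≡ nes σ
    nes-invariant = trans (nes-∑ σ') (trans (conjugated nest? nest?
      (λ { i≤ v≤ j≤ w≤ (inj₁ (a , b , d)) → inj₁ (ρ-< j≤ d , ρ-< w≤ b , ρ-< v≤ a)
         ; i≤ v≤ j≤ w≤ (inj₂ (a , b , d)) → inj₂ (ρ-< v≤ d , ρ-≤ v≤ b , ρ-< j≤ a) })
      (λ { i≤ v≤ j≤ w≤ (inj₁ (a , b , d)) → inj₁ (ρ-<⁺ v≤ d , ρ-<⁺ w≤ b , ρ-<⁺ j≤ a)
         ; i≤ v≤ j≤ w≤ (inj₂ (a , b , d)) → inj₂ (ρ-<⁺ j≤ d , ρ-≤⁺ b , ρ-<⁺ v≤ a) })) (sym (nes-∑ σ)))

  transfer-132-213 : Transfer crsNesSt (pat p132) (pat p213) n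
  transfer-132-213 = record
    { _∼_ = Conj ρ n
    ; total = λ p av → let (σ' , p' , c) = conj p in σ' , p'
        , occurs-conj p p' c p213 p132 (λ a1 a2 b1 b2 c1 c2 x<y y<z (o , o') →
            _ , _ , _ , c1 , ρ-< a2 o' , ρ-< b2 o , ≤-trans b2 (≤-reflexive (sym (len p)))
            , ρ-< (proj₂ (at-range p b1 b2)) y<z , ρ-< (proj₂ (at-range p a1 a2)) x<y) av
        , cong₂ (λ x y → x ∷ y ∷ []) (crs-invariant p p' c) (nes-invariant p p' c) , c
    ; inj = λ p _ q _ r → conj-inj p q r }

  transfer-213-132 : Transfer crsNesSt (pat p213) (pat p132) n
  transfer-213-132 = record
    { _∼_ = Conj ρ n
    ; total = λ p av → let (σ' , p' , c) = conj p in σ' , p'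
        , occurs-conj p p' c p132 p213 (λ a1 a2 b1 b2 c1 c2 x<y y<z (o , o') →
            _ , _ , _ , b1 , ρ-< c2 o' , ρ-< a2 o , ≤-trans a2 (≤-reflexive (sym (len p)))
            , ρ-< (proj₂ (at-range p b1 b2)) y<z , ρ-< (proj₂ (at-range p a1 a2)) x<y) av
        , cong₂ (λ x y → x ∷ y ∷ []) (crs-invariant p p' c) (nes-invariant p p' c) , c
    ; inj = λ p _ q _ r → conj-inj p q r }

-- σ and σ⁻¹ exchange upper and lower nestings, except that a fixed point is nested below the
-- lower arcs over it only; cut shows that it lies under equally many upper and lower arcs.
module Inverse (n : ℕ) where

  open Conjugate n id _,_ (λ _ _ → refl) public

  Upper Lower : ℕ → ℕ → ℕ → ℕ → Set
  Upper i v j w = i < j × j < w × w < v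
  Lower i v j w = w < v × v < i × i < j

  upper? : ∀ i v j w → Dec (Upper i v j w)
  upper? i v j w = (i <? j) ×-dec ((j <? w) ×-dec (w <? v))

  lower? : ∀ i v j w → Dec (Lower i v j w)
  lower? i v j w = (w <? v) ×-dec ((v <? i) ×-dec (i <? j))

  module _ {σ σ'} (p : Perm n σ) (p' : Perm n σ') (c : Conj id n σ σ') where
    private
      ∑∑ : (ℕ → ℕ → ℕ) → ℕ
      ∑∑ f = ∑ (oneTo n) λ i → ∑ (oneTo n) (f i)

      ∑∑-+ : ∀ f g → ∑∑ (λ i j → f i j + g i j) ≡ ∑∑ f + ∑∑ g
      ∑∑-+ f g = trans (∑-cong (oneTo n) λ {i} _ → ∑-+ (oneTo n) (f i) (g i)) (∑-+ (oneTo n) _ _)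

      ∑∑-cong : ∀ {f g : ℕ → ℕ → ℕ} → (∀ {i j} → 1 ≤ i → i ≤ n → 1 ≤ j → j ≤ n → f i j ≡ g i j) → ∑∑ f ≡ ∑∑ g
      ∑∑-cong h = ∑-cong (oneTo n) λ i∈ → ∑-cong (oneTo n) λ j∈ → let (a , b) = ∈-oneTo⁻ i∈ ; (d , e) = ∈-oneTo⁻ j∈ in h a b d e

      s : ℕ → ℕ
      s = at σ

      U L FL FU : ℕ → ℕ → ℕ
      U i j = χ (upper? i (s i) j (s j))
      L i j = χ (lower? i (s i) j (s j))
      FL i j = χ ((s i ≟ i) ×-dec ((s j <? i) ×-dec (i ≤? j)))
      FU i j = χ ((s i ≟ i) ×-dec ((j <? i) ×-dec (i ≤? s j)))

      fixed : ∑∑ FL ≡ ∑∑ FU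
      fixed = ∑-cong (oneTo n) λ {i} _ → case s i ≟ i of λ
        { (yes e) → trans (∑-cong (oneTo n) λ {j} _ → χ-cong ((s i ≟ i) ×-dec ((s j <? i) ×-dec (i ≤? j))) ((s j <? i) ×-dec (i ≤? j)) proj₂ (e ,_))
            (trans (sym (cut p i)) (∑-cong (oneTo n) λ {j} _ → χ-cong ((j <? i) ×-dec (i ≤? s j)) ((s i ≟ i) ×-dec ((j <? i) ×-dec (i ≤? s j))) (e ,_) proj₂))
        ; (no ne) → trans (∑-0 (oneTo n) λ {j} _ → χ-no ((s i ≟ i) ×-dec ((s j <? i) ×-dec (i ≤? j))) (ne ∘ proj₁))
            (sym (∑-0 (oneTo n) λ {j} _ → χ-no ((s i ≟ i) ×-dec ((j <? i) ×-dec (i ≤? s j))) (ne ∘ proj₁))) }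

      nes≡ : ∑∑ (λ i j → χ (nest? i (s i) j (s j))) ≡ ∑∑ U + (∑∑ L + ∑∑ FL)
      nes≡ = trans (∑∑-cong λ {i} {j} a b d e → trans
          (χ-⊎ (nest? i (s i) j (s j)) (upper? i (s i) j (s j)) ((s j <? s i) ×-dec ((s i ≤? i) ×-dec (i <? j))) id inj₁ inj₂
            λ { ((x , y , z) , (u , v , w)) → <⇒≱ (<-trans (<-trans x y) z) v })
          (cong (U i j +_) (χ-⊎ ((s j <? s i) ×-dec ((s i ≤? i) ×-dec (i <? j))) (lower? i (s i) j (s j)) ((s i ≟ i) ×-dec ((s j <? i) ×-dec (i ≤? j)))
            (λ (x , y , z) → case m≤n⇒m<n∨m≡n y of λ { (inj₁ lt) → inj₁ (x , lt , z) ; (inj₂ q) → inj₂ (q , subst (s j <_) q x , <⇒≤ z) })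
            (λ (x , y , z) → x , <⇒≤ y , z)
            (λ (q , x , z) → subst (s j <_) (sym q) x , ≤-reflexive q , ≤∧≢⇒< z λ { refl → <-irrefl q x })
            (λ ((_ , x , _) , (y , _)) → <-irrefl y x))))
        (trans (∑∑-+ U _) (cong (∑∑ U +_) (∑∑-+ L FL)))

      nes'≡ : ∑∑ (λ i j → χ (nest? (s i) i (s j) j)) ≡ ∑∑ (λ i j → L j i) + (∑∑ (λ i j → U j i) + ∑∑ (λ i j → FU i j))
      nes'≡ = trans (∑∑-cong λ {i} {j} a b d e → trans
          (χ-⊎ (nest? (s i) i (s j) j) (lower? j (s j) i (s i)) ((j <? i) ×-dec ((i ≤? s i) ×-dec (s i <? s j))) id inj₁ inj₂
            λ { ((x , y , z) , (u , v , w)) → <⇒≱ (<-trans (<-trans x y) z) v })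
          (cong (L j i +_) (χ-⊎ ((j <? i) ×-dec ((i ≤? s i) ×-dec (s i <? s j))) (upper? j (s j) i (s i)) ((s i ≟ i) ×-dec ((j <? i) ×-dec (i ≤? s j)))
            (λ (x , y , z) → case m≤n⇒m<n∨m≡n y of λ { (inj₁ lt) → inj₁ (x , lt , z) ; (inj₂ q) → inj₂ (sym q , x , subst (_≤ s j) (sym q) (<⇒≤ z)) })
            (λ (x , y , z) → x , <⇒≤ y , z)
            (λ (q , x , z) → x , ≤-reflexive (sym q) , ≤∧≢⇒< (subst (_≤ s j) (sym q) z) λ r → <-irrefl (at-inj p d e a b (sym r)) x)
            (λ ((_ , x , _) , (y , _)) → <-irrefl (sym y) x))))
        (trans (∑∑-+ (λ i j → L j i) _) (cong (∑∑ (λ i j → L j i) +_) (∑∑-+ (λ i j → U j i) FU)))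

    nes-invariant : nes σ' ≡ nes σ
    nes-invariant = begin
      nes σ'                                         ≡⟨ nes-∑ σ' ⟩
      pairSum (λ i v j w → χ (nest? i v j w)) σ'     ≡⟨ pairSum-conj p p' c (λ i v j w → χ (nest? i v j w)) ⟩
      ∑∑ (λ i j → χ (nest? (s i) i (s j) j))         ≡⟨ nes'≡ ⟩
      ∑∑ (λ i j → L j i) + (∑∑ (λ i j → U j i) + ∑∑ FU) ≡⟨ cong₂ (λ x y → x + (y + ∑∑ FU)) (∑-swap (oneTo n) (oneTo n) (λ i j → L j i)) (∑-swap (oneTo n) (oneTo n) (λ i j → U j i)) ⟩
      ∑∑ L + (∑∑ U + ∑∑ FU)                          ≡⟨ cong (λ x → ∑∑ L + (∑∑ U + x)) (sym fixed) ⟩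
      ∑∑ L + (∑∑ U + ∑∑ FL)                          ≡⟨ sym (+-assoc (∑∑ L) (∑∑ U) (∑∑ FL)) ⟩
      ∑∑ L + ∑∑ U + ∑∑ FL                            ≡⟨ cong (_+ ∑∑ FL) (+-comm (∑∑ L) (∑∑ U)) ⟩
      ∑∑ U + ∑∑ L + ∑∑ FL                            ≡⟨ +-assoc (∑∑ U) (∑∑ L) (∑∑ FL) ⟩
      ∑∑ U + (∑∑ L + ∑∑ FL)                          ≡⟨ sym nes≡ ⟩
      ∑∑ (λ i j → χ (nest? i (s i) j (s j)))         ≡⟨ sym (pairSum-length p (λ i v j w → χ (nest? i v j w))) ⟩
      pairSum (λ i v j w → χ (nest? i v j w)) σ      ≡⟨ sym (nes-∑ σ) ⟩
      nes σ                                          ∎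
      where open ≡-Reasoning

  transfer-231-312 : Transfer nesSt (pat p231) (pat p312) n
  transfer-231-312 = record
    { _∼_ = Conj id n
    ; total = λ p av → let (σ' , p' , c) = conj p in σ' , p'
        , occurs-conj p p' c p312 p231 (λ a1 a2 b1 b2 c1 c2 x<y y<z (o , o') →
            _ , _ , _ , b1 , o , o' , ≤-trans a2 (≤-reflexive (sym (len p))) , x<y , y<z) av
        , cong (_∷ []) (nes-invariant p p' c) , c
    ; inj = λ p _ q _ r → conj-inj p q r }

  transfer-312-231 : Transfer nesSt (pat p312) (pat p231) n
  transfer-312-231 = record
    { _∼_ = Conj id n
    ; total = λ p av → let (σ' , p' , c) = conj p in σ' , p'
        , occurs-conj p p' c p231 p312 (λ a1 a2 b1 b2 c1 c2 x<y y<z (o , o') →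
            _ , _ , _ , c1 , o , o' , ≤-trans b2 (≤-reflexive (sym (len p))) , x<y , y<z) av
        , cong (_∷ []) (nes-invariant p p' c) , c
    ; inj = λ p _ q _ r → conj-inj p q r }

-- 321-avoiding permutations and bicoloured Motzkin paths

oneTo-suc : ∀ n → oneTo (suc n) ≡ 1 ∷ map suc (oneTo n)
oneTo-suc n = cong (λ xs → 1 ∷ map suc xs) (sym (map-upTo suc n))

∑-single : ∀ {A : Set} {xs : List A} {x} (f : A → ℕ) → Unique xs → x ∈ xs → (∀ {y} → y ∈ xs → y ≢ x → f y ≡ 0) → ∑ xs f ≡ f x
∑-single {xs = y ∷ xs} f (y∉ ∷ u) (here refl) z =
  trans (cong (f y +_) (∑-0 xs λ z∈ → z (there z∈) λ { refl → All.lookup y∉ z∈ refl })) (+-identityʳ (f y))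
∑-single {xs = y ∷ xs} f (y∉ ∷ u) (there x∈) z rewrite z (here refl) (All.lookup y∉ x∈) = ∑-single f u x∈ (z ∘ there)

Step : Set
Step = Bool × Bool

-- Path k w s: the steps w lead from height k to height 0, staying nonnegative, and s is the sum of
-- the heights of all vertices. The step (b , a) raises the height by [b] - [a], so that there are two
-- kinds of level steps.
data Path : ℕ → List Step → ℕ → Set where
  []     : Path 0 [] 0
  up     : ∀ {k w s} → Path (suc k) w s → Path k ((true , false) ∷ w) (k + s)
  down   : ∀ {k w s} → Path k w s → Path (suc k) ((false , true) ∷ w) (suc k + s)
  level₀ : ∀ {k w s} → Path k w s → Path k ((false , false) ∷ w) (k + s)
  level₁ : ∀ {k w s} → Path k w s → Path k ((true , true) ∷ w) (k + s)

path-step : ∀ {P Q : Set} (b : Dec P) (a : Dec Q) {h h' w s} → h' + χ a ≡ h + χ b → Path h' w s → Path h ((does b , does a) ∷ w) (h + s)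
path-step (yes _) (yes _) {h} {h'} e p rewrite +-cancelʳ-≡ 1 h' h e = level₁ p
path-step (no _)  (no _)  {h} {h'} e p rewrite +-cancelʳ-≡ 0 h' h e = level₀ p
path-step (yes _) (no _)  {h} {h'} e p rewrite +-identityʳ h' | +-comm h 1 | e = up p
path-step (no _)  (yes _) {h} {h'} e p rewrite +-identityʳ h | +-comm h' 1 | sym e = down p

-- Determinism works from the end of the path, where the height is 0, so the weight depends on the
-- step word alone. Two permutations with the same step word therefore have equally many crossings.
path-functional : ∀ {k l w s t} → Path k w s → Path l w t → k ≡ l × s ≡ t
path-functional [] [] = refl , refl
path-functional (up p) (up q) with path-functional p q
... | refl , refl = refl , refl
path-functional (down p) (down q) with path-functional p q
... | refl , refl = refl , refl
path-functional (level₀ p) (level₀ q) with path-functional p q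
... | refl , refl = refl , refl
path-functional (level₁ p) (level₁ q) with path-functional p q
... | refl , refl = refl , refl

-- For a permutation this amounts to avoiding 321: if the entries form a union of two increasing
-- sequences at all, exceedances and nonexceedances are such a pair.
record Monotone (n : ℕ) (σ : List ℕ) : Set where
  field
    exceedances    : ∀ {i j} → 1 ≤ i → i < j → j ≤ n → i < at σ i → j < at σ j → at σ i < at σ j
    nonexceedances : ∀ {i j} → 1 ≤ i → i < j → j ≤ n → at σ i ≤ i → at σ j ≤ j → at σ i < at σ j
open Monotone

module _ {n σ} (p : Perm n σ) where
  private
    s : ℕ → ℕ
    s = at σ
    toLen : ∀ {k} → k ≤ n → k ≤ length σ
    toLen k≤n = ≤-trans k≤n (≤-reflexive (sym (len p)))

  -- By cut, an exceedance passing over j forces a later value ≤ j, and dually; such a value completes a 321.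
  avoids⇒monotone : Avoids σ (pat p321) → Monotone n σ
  avoids⇒monotone av = record { exceedances = ex ; nonexceedances = nx }
    where
    ex : ∀ {i j} → 1 ≤ i → i < j → j ≤ n → i < at σ i → j < at σ j → at σ i < at σ j
    ex {i} {j} 1≤i i<j j≤n i<si j<sj with <-cmp (s i) (s j)
    ... | tri< lt _ _ = lt
    ... | tri≈ _ e _ = contradiction (at-inj p 1≤i (≤-trans (<⇒≤ i<j) j≤n) (≤-trans 1≤i (<⇒≤ i<j)) j≤n e) (<⇒≢ i<j)
    ... | tri> _ _ sj<si with ∑-χ-∃ (oneTo n) (λ k → (s k <? suc j) ×-dec (suc j ≤? k))
          (subst (0 <_) (cut p (suc j)) (≤-trans (≤-reflexive (sym (χ-yes ((j <? suc j) ×-dec (suc j ≤? s j)) (≤-refl , j<sj))))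
            (∑-≥ (oneTo n) (λ k → χ ((k <? suc j) ×-dec (suc j ≤? s k))) (∈-oneTo⁺ (≤-trans 1≤i (<⇒≤ i<j)) j≤n))))
    ... | k , k∈ , s≤s sk≤j , j<k = ⊥-elim (av (contains⁺ p321 {σ} (i , j , k , 1≤i , i<j , j<k , toLen (proj₂ (∈-oneTo⁻ k∈)) , ≤-<-trans sk≤j j<sj , sj<si)))
    nx : ∀ {i j} → 1 ≤ i → i < j → j ≤ n → at σ i ≤ i → at σ j ≤ j → at σ i < at σ j
    nx {i} {j} 1≤i i<j j≤n si≤i sj≤j with <-cmp (s i) (s j)
    ... | tri< lt _ _ = lt
    ... | tri≈ _ e _ = contradiction (at-inj p 1≤i (≤-trans (<⇒≤ i<j) j≤n) (≤-trans 1≤i (<⇒≤ i<j)) j≤n e) (<⇒≢ i<j)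
    ... | tri> _ _ sj<si with ∑-χ-∃ (oneTo n) (λ k → (k <? s i) ×-dec (s i ≤? s k))
          (subst (0 <_) (sym (cut p (s i))) (≤-trans (≤-reflexive (sym (χ-yes ((s j <? s i) ×-dec (s i ≤? j)) (sj<si , ≤-trans si≤i (<⇒≤ i<j)))))
            (∑-≥ (oneTo n) (λ k → χ ((s k <? s i) ×-dec (s i ≤? k))) (∈-oneTo⁺ (≤-trans 1≤i (<⇒≤ i<j)) j≤n))))
    ... | k , k∈ , k<si , si≤sk with ∈-oneTo⁻ k∈
    ... | 1≤k , k≤n = ⊥-elim (av (contains⁺ p321 {σ} (k , i , j , 1≤k , k<i , i<j , toLen j≤n , sj<si ,
        ≤∧≢⇒< si≤sk λ e → <⇒≢ k<i (at-inj p 1≤k k≤n 1≤i (≤-trans (<⇒≤ i<j) j≤n) (sym e)))))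
      where
      k<i : k < i
      k<i = <-≤-trans k<si si≤i

  -- Two of the three positions of a 321 are of the same kind, and entries of the same kind
  -- increase.
  monotone⇒avoids : Monotone n σ → Avoids σ (pat p321)
  monotone⇒avoids m t with contains⇒Occurs p321 {σ} t
  ... | i , j , k , 1≤i , i<j , j<k , k≤ , sk<sj , sj<si
      with k≤n ← ≤-trans k≤ (≤-reflexive (len p)) with j≤n ← ≤-trans (<⇒≤ j<k) k≤n with 1≤j ← ≤-trans 1≤i (<⇒≤ i<j)
      with i <? s i | j <? s j | k <? s k
  ... | yes a | yes b | _ = <-asym (exceedances m 1≤i i<j j≤n a b) sj<si
  ... | no a | no b | _ = <-asym (nonexceedances m 1≤i i<j j≤n (≮⇒≥ a) (≮⇒≥ b)) sj<si
  ... | _ | yes b | yes c = <-asym (exceedances m 1≤j j<k k≤n b c) sk<sj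
  ... | _ | no b | no c = <-asym (nonexceedances m 1≤j j<k k≤n (≮⇒≥ b) (≮⇒≥ c)) sk<sj
  ... | yes a | no _ | yes c = <-asym (exceedances m 1≤i (<-trans i<j j<k) k≤n a c) (<-trans sk<sj sj<si)
  ... | no a | yes _ | no c = <-asym (nonexceedances m 1≤i (<-trans i<j j<k) k≤n (≮⇒≥ a) (≮⇒≥ c)) (<-trans sk<sj sj<si)

  height : ℕ → ℕ
  height t = ∑ (oneTo n) λ i → χ ((i <? t) ×-dec (t <? s i))

  -- An upper crossing is charged to its first arc and a lower crossing to its second. The arc at
  -- `i` then collects exactly `height (s i)`, and `s i` runs through all values.
  crs≡∑height : Monotone n σ → crs σ ≡ ∑ (oneTo n) height
  crs≡∑height m = begin
    crs σ ≡⟨ crs-∑ σ ⟩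
    pairSum (λ i v j w → χ (cross? i v j w)) σ ≡⟨ pairSum-length p (λ i v j w → χ (cross? i v j w)) ⟩
    ∑∑ (λ i j → χ (cross? i (s i) j (s j))) ≡⟨ ∑-cong (oneTo n) (λ {i} _ → trans (∑-cong (oneTo n) λ {j} _ →
        χ-⊎ (cross? i (s i) j (s j)) (upper? i j) (lower? i j) id inj₁ inj₂ λ { ((_ , x , y) , (_ , z , u)) → <⇒≱ (<-trans x y) (≤-trans z (<⇒≤ u)) }) (∑-+ (oneTo n) (λ j → χ (upper? i j)) (λ j → χ (lower? i j)))) ⟩
    ∑ (oneTo n) (λ i → ∑ (oneTo n) (λ j → χ (upper? i j)) + ∑ (oneTo n) (λ j → χ (lower? i j))) ≡⟨ ∑-+ (oneTo n) _ _ ⟩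
    ∑∑ (λ i j → χ (upper? i j)) + ∑∑ (λ i j → χ (lower? i j)) ≡⟨ cong (∑∑ (λ i j → χ (upper? i j)) +_) (∑-swap (oneTo n) (oneTo n) _) ⟩
    ∑∑ (λ i j → χ (upper? i j)) + ∑∑ (λ i j → χ (lower? j i)) ≡⟨ sym (∑-+ (oneTo n) _ _) ⟩
    ∑ (oneTo n) (λ i → ∑ (oneTo n) (λ j → χ (upper? i j)) + ∑ (oneTo n) (λ j → χ (lower? j i))) ≡⟨ ∑-cong (oneTo n) (λ i∈ → uncurry over (∈-oneTo⁻ i∈)) ⟩
    ∑ (oneTo n) (height ∘ s) ≡⟨ ∑-at p height ⟩
    ∑ (oneTo n) height ∎
    where
    open ≡-Reasoning
    ∑∑ : (ℕ → ℕ → ℕ) → ℕ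
    ∑∑ f = ∑ (oneTo n) λ i → ∑ (oneTo n) (f i)
    upper? : ∀ i j → Dec (i < j × j < s i × s i < s j)
    upper? i j = (i <? j) ×-dec ((j <? s i) ×-dec (s i <? s j))
    lower? : ∀ i j → Dec (s i < s j × s j ≤ i × i < j)
    lower? i j = (s i <? s j) ×-dec ((s j ≤? i) ×-dec (i <? j))
    over : ∀ {i} → 1 ≤ i → i ≤ n → ∑ (oneTo n) (λ j → χ (upper? i j)) + ∑ (oneTo n) (λ j → χ (lower? j i)) ≡ height (s i)
    over {i} 1≤i i≤n with i <? s i
    ... | yes i<si = trans (cong₂ _+_
          (∑-cong (oneTo n) λ {j} j∈ → χ-cong (upper? i j) ((j <? s i) ×-dec (s i <? s j)) proj₂
            λ (x , y) → ≰⇒> (λ j≤i → case m≤n⇒m<n∨m≡n j≤i of λ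
              { (inj₁ j<i) → <-asym y (exceedances m (proj₁ (∈-oneTo⁻ j∈)) j<i i≤n (<-trans x y) i<si)
              ; (inj₂ refl) → <-irrefl refl y }) , x , y)
          (∑-0 (oneTo n) λ {j} _ → χ-no (lower? j i) λ (_ , x , y) → <-asym i<si (≤-<-trans x y)))
        (+-identityʳ _)
    ... | no i≮si = trans (cong₂ _+_
          (∑-0 (oneTo n) λ {j} _ → χ-no (upper? i j) λ (x , y , _) → i≮si (<-trans x y))
          (∑-cong (oneTo n) λ {j} j∈ → χ-cong (lower? j i) ((s j <? s i) ×-dec (s i ≤? j)) (λ (x , y , _) → x , y)
            λ (x , y) → x , y , ≰⇒> (λ i≤j → case m≤n⇒m<n∨m≡n i≤j of λ
              { (inj₁ i<j) → <-asym x (nonexceedances m 1≤i i<j (proj₂ (∈-oneTo⁻ j∈)) (≮⇒≥ i≮si) (≤-trans (<⇒≤ x) y))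
              ; (inj₂ refl) → <-irrefl refl x })))
        -- `cut` at `s i` exchanges the arcs leading down over `s i` for those leading up. An upward
        -- arc ending exactly at `s i` would be the arc of `i`, which is not an exceedance.
        (trans (sym (cut p (s i))) (∑-cong (oneTo n) λ {j} j∈ → χ-cong ((j <? s i) ×-dec (s i ≤? s j)) ((j <? s i) ×-dec (s i <? s j))
          (λ (x , y) → x , ≤∧≢⇒< y λ e → i≮si (subst (_< s i) (sym (at-inj p 1≤i i≤n (proj₁ (∈-oneTo⁻ j∈)) (proj₂ (∈-oneTo⁻ j∈)) e)) x))
          (λ (x , y) → x , <⇒≤ y)))

  exc? : ∀ t → Dec (t < s t)
  exc? t = t <? s t

  excValue? : ∀ v → Dec (position σ v < v)
  excValue? v = position σ v <? v

  -- Both sides count the arcs that cross the gap between `t` and `t + 1` upwards: on the left those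
  -- ending at `t + 1` are split off, on the right those starting at `t`.
  height-step : ∀ {t} → 1 ≤ t → t < n → height (suc t) + χ (excValue? (suc t)) ≡ height t + χ (exc? t)
  height-step {t} 1≤t t<n = trans (sym left) right
    where
    open ≡-Reasoning
    v = suc t
    q = position σ v
    1≤q = proj₁ (position-range p {v} (s≤s z≤n) t<n)
    q≤n = proj₂ (position-range p {v} (s≤s z≤n) t<n)
    sq≡v : s q ≡ v
    sq≡v = at-position p (s≤s z≤n) t<n
    mid? : ∀ i → Dec (i < v × v ≤ s i)
    mid? i = (i <? v) ×-dec (v ≤? s i)
    left : ∑ (oneTo n) (χ ∘ mid?) ≡ height v + χ (excValue? v)
    left = begin
      ∑ (oneTo n) (χ ∘ mid?) ≡⟨ ∑-cong (oneTo n) (λ {i} i∈ → χ-⊎ (mid? i) ((i <? v) ×-dec (v <? s i)) ((i ≟ q) ×-dec (q <? v))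
          (λ (x , y) → case m≤n⇒m<n∨m≡n y of λ { (inj₁ lt) → inj₁ (x , lt) ; (inj₂ e) → let i≡q = at-inj p (proj₁ (∈-oneTo⁻ i∈)) (proj₂ (∈-oneTo⁻ i∈)) 1≤q q≤n (trans (sym e) (sym sq≡v)) in inj₂ (i≡q , subst (_< v) i≡q x) })
          (λ (x , y) → x , <⇒≤ y) (λ { (refl , y) → y , ≤-reflexive (sym sq≡v) }) λ { ((_ , x) , (refl , _)) → <-irrefl (sym sq≡v) x }) ⟩
      ∑ (oneTo n) (λ i → χ ((i <? v) ×-dec (v <? s i)) + χ ((i ≟ q) ×-dec (q <? v))) ≡⟨ ∑-+ (oneTo n) _ _ ⟩
      height v + ∑ (oneTo n) (λ i → χ ((i ≟ q) ×-dec (q <? v))) ≡⟨ cong (height v +_) (∑-single (λ i → χ ((i ≟ q) ×-dec (q <? v))) (oneTo-unique n) (∈-oneTo⁺ 1≤q q≤n)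
          λ {i} _ ne → χ-no ((i ≟ q) ×-dec (q <? v)) (ne ∘ proj₁)) ⟩
      height v + χ ((q ≟ q) ×-dec (q <? v)) ≡⟨ cong (height v +_) (χ-cong ((q ≟ q) ×-dec (q <? v)) (q <? v) proj₂ (refl ,_)) ⟩
      height v + χ (excValue? v) ∎
    right : ∑ (oneTo n) (χ ∘ mid?) ≡ height t + χ (exc? t)
    right = begin
      ∑ (oneTo n) (χ ∘ mid?) ≡⟨ ∑-cong (oneTo n) (λ {i} _ → χ-⊎ (mid? i) ((i <? t) ×-dec (t <? s i)) ((i ≟ t) ×-dec (t <? s t))
          (λ { (s≤s x , y) → case m≤n⇒m<n∨m≡n x of λ { (inj₁ lt) → inj₁ (lt , y) ; (inj₂ refl) → inj₂ (refl , y) } })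
          (λ (x , y) → m≤n⇒m≤1+n x , y) (λ { (refl , y) → ≤-refl , y }) λ { ((x , _) , (refl , _)) → <-irrefl refl x }) ⟩
      ∑ (oneTo n) (λ i → χ ((i <? t) ×-dec (t <? s i)) + χ ((i ≟ t) ×-dec (t <? s t))) ≡⟨ ∑-+ (oneTo n) _ _ ⟩
      height t + ∑ (oneTo n) (λ i → χ ((i ≟ t) ×-dec (t <? s t))) ≡⟨ cong (height t +_) (∑-single (λ i → χ ((i ≟ t) ×-dec (t <? s t))) (oneTo-unique n) (∈-oneTo⁺ 1≤t (<⇒≤ t<n))
          λ {i} _ ne → χ-no ((i ≟ t) ×-dec (t <? s t)) (ne ∘ proj₁)) ⟩
      height t + χ ((t ≟ t) ×-dec (t <? s t)) ≡⟨ cong (height t +_) (χ-cong ((t ≟ t) ×-dec (t <? s t)) (t <? s t) proj₂ (refl ,_)) ⟩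
      height t + χ (exc? t) ∎

  height-n : height n ≡ 0
  height-n = ∑-0 (oneTo n) λ {i} i∈ → χ-no ((i <? n) ×-dec (n <? s i)) λ (_ , x) → <⇒≱ x (proj₂ (uncurry (at-range p) (∈-oneTo⁻ i∈)))

  height-1 : height 1 ≡ 0
  height-1 = ∑-0 (oneTo n) λ {i} i∈ → χ-no ((i <? 1) ×-dec (1 <? s i)) λ (x , _) → <⇒≱ x (proj₁ (∈-oneTo⁻ i∈))

steps : (ℕ → Bool) → (ℕ → Bool) → ℕ → ℕ → List Step
steps f g t zero = []
steps f g t (suc m) = (f t , g (suc t)) ∷ steps f g (suc t) m

excBit valueBit : List ℕ → ℕ → Bool
excBit σ t = does (t <? at σ t)
valueBit σ v = does (position σ v <? v)

-- The step from `t` to `t + 1` records whether position `t` is an exceedance and whether `t + 1` is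
-- the value of one. The last position is never an exceedance and 1 is never the value of one, so n
-- - 1 steps contain all the information.
encode : List ℕ → List Step
encode σ = steps (excBit σ) (valueBit σ) 1 (length σ ∸ 1)

∑range : (ℕ → ℕ) → ℕ → ℕ → ℕ
∑range f t zero = 0
∑range f t (suc m) = f t + ∑range f (suc t) m

∑range-suc : ∀ f t m → ∑range (f ∘ suc) t m ≡ ∑range f (suc t) m
∑range-suc f t zero = refl
∑range-suc f t (suc m) = cong (f (suc t) +_) (∑range-suc f (suc t) m)

∑-oneTo : ∀ f n → ∑ (oneTo n) f ≡ ∑range f 1 n
∑-oneTo f zero = refl
∑-oneTo f (suc n) = trans (cong (λ xs → ∑ xs f) (oneTo-suc n)) (cong (f 1 +_)
  (trans (∑-map suc (oneTo n) f) (trans (∑-oneTo (f ∘ suc) n) (∑range-suc f 1 n))))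

encode-path : ∀ {n σ} → Perm (suc n) σ → Monotone (suc n) σ → Path 0 (encode σ) (crs σ)
encode-path {n} {σ} p m rewrite crs≡∑height p m | ∑-oneTo (height p) (suc n) | len p =
  subst (λ h → Path h w (∑range (height p) 1 (suc n))) (height-1 p) (go 1 n (s≤s z≤n) (+-comm n 1))
  where
  w = steps (excBit σ) (valueBit σ) 1 n
  -- A path with `m` remaining steps has `m + 1` remaining vertices, hence `suc m` heights.
  go : ∀ t m → 1 ≤ t → m + t ≡ suc n → Path (height p t) (steps (excBit σ) (valueBit σ) t m) (∑range (height p) t (suc m))
  go t zero 1≤t refl rewrite height-n p = []
  go t (suc m) 1≤t e = path-step (exc? p t) (excValue? p (suc t)) (height-step p 1≤t t<n)
      (go (suc t) m (s≤s z≤n) (trans (+-suc m t) e))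
    where
    t<n : t < suc n
    t<n = ≤-trans (s≤s (m≤n+m t m)) (≤-reflexive e)

open Monotone

does⇒ : ∀ {P Q : Set} (p : Dec P) (q : Dec Q) → does p ≡ does q → P → Q
does⇒ p (yes q) e _ = q
does⇒ (no ¬p) (no ¬q) e x = contradiction x ¬p
does⇒ (yes _) (no _) ()

steps-inj : ∀ {f g f' g'} t m → steps f g t m ≡ steps f' g' t m →
  ∀ {i} → t ≤ i → i < m + t → f i ≡ f' i × g (suc i) ≡ g' (suc i)
steps-inj t zero e t≤i i<t = contradiction t≤i (<⇒≱ i<t)
steps-inj {f} {g} {f'} {g'} t (suc m) e {i} t≤i i<t with m≤n⇒m<n∨m≡n t≤i
... | inj₂ refl = cong proj₁ (∷-injectiveˡ e) , cong proj₂ (∷-injectiveˡ e)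
... | inj₁ t<i = steps-inj (suc t) m (∷-injectiveʳ e) t<i (≤-trans i<t (≤-reflexive (sym (+-suc m t))))

record SameShape (n : ℕ) (σ τ : List ℕ) : Set where
  field
    exc   : ∀ {i} → 1 ≤ i → i ≤ n → i < at σ i → i < at τ i
    value : ∀ {v} → 1 ≤ v → v ≤ n → does (position σ v <? v) ≡ does (position τ v <? v)
open SameShape

encode≡⇒SameShape : ∀ {n σ τ} → Perm (suc n) σ → Perm (suc n) τ → encode σ ≡ encode τ → SameShape (suc n) σ τ
encode≡⇒SameShape {n} {σ} {τ} p q e = record { exc = ex ; value = va }
  where
  bits : ∀ {i} → 1 ≤ i → i < n + 1 → does (i <? at σ i) ≡ does (i <? at τ i) × does (position σ (suc i) <? suc i) ≡ does (position τ (suc i) <? suc i)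
  bits = steps-inj 1 n (subst₂ (λ a b → steps (excBit σ) (valueBit σ) 1 (a ∸ 1) ≡ steps (excBit τ) (valueBit τ) 1 (b ∸ 1)) (len p) (len q) e)
  n+1 : n + 1 ≡ suc n
  n+1 = +-comm n 1
  ex : ∀ {i} → 1 ≤ i → i ≤ suc n → i < at σ i → i < at τ i
  ex {i} 1≤i i≤n lt = does⇒ (i <? at σ i) (i <? at τ i) (proj₁ (bits 1≤i (≤-trans (≤-trans lt (proj₂ (at-range p 1≤i i≤n))) (≤-reflexive (sym n+1))))) lt
  va : ∀ {v} → 1 ≤ v → v ≤ suc n → does (position σ v <? v) ≡ does (position τ v <? v)
  va {suc zero} 1≤v v≤n = trans (dec-false (position σ 1 <? 1) (≤⇒≯ (proj₁ (position-range p 1≤v v≤n)))) (sym (dec-false (position τ 1 <? 1) (≤⇒≯ (proj₁ (position-range q 1≤v v≤n)))))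
  va {suc (suc v)} 1≤v (s≤s v≤n) = proj₂ (bits {suc v} (s≤s z≤n) (≤-trans (s≤s v≤n) (≤-reflexive (sym n+1))))

-- At the first disagreement i, the smaller value σ(i) would appear in τ after i but still in the same
-- increasing subsequence as τ(i) > σ(i).
no-drop : ∀ {n σ τ i} → Perm n σ → Perm n τ → Monotone n τ → SameShape n σ τ → SameShape n τ σ → 1 ≤ i → i ≤ n →
  (∀ {j} → 1 ≤ j → j < i → at σ j ≡ at τ j) → ¬ (at σ i < at τ i)
no-drop {n} {σ} {τ} {i} p q m στ τσ 1≤i i≤n same lt = absurd
  where
  v = at σ i
  1≤v = proj₁ (at-range p 1≤i i≤n)
  v≤n = proj₂ (at-range p 1≤i i≤n)
  j = position τ v
  1≤j = proj₁ (position-range q 1≤v v≤n)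
  j≤n = proj₂ (position-range q 1≤v v≤n)
  τj≡v = at-position q 1≤v v≤n
  pv≡i : position σ v ≡ i
  pv≡i = position-at p 1≤i i≤n
  i<j : i < j
  i<j with <-cmp i j
  ... | tri< x _ _ = x
  ... | tri≈ _ e _ = contradiction (trans (sym τj≡v) (cong (at τ) (sym e))) (<⇒≢ lt)
  ... | tri> _ _ j<i = contradiction (at-inj p 1≤j j≤n 1≤i i≤n (trans (same 1≤j j<i) τj≡v)) (<⇒≢ j<i)
  absurd : ⊥
  absurd with i <? v
  ... | yes i<v = <-asym lt (subst (at τ i <_) τj≡v (exceedances m 1≤i i<j j≤n (exc στ 1≤i i≤n i<v)
         (subst (j <_) (sym τj≡v) (does⇒ (position σ v <? v) (j <? v) (value στ 1≤v v≤n) (subst (_< v) (sym pv≡i) i<v)))))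
  ... | no i≮v = <-asym lt (subst (at τ i <_) τj≡v (nonexceedances m 1≤i i<j j≤n (≮⇒≥ λ x → i≮v (exc τσ 1≤i i≤n x))
         (subst (_≤ j) (sym τj≡v) (≮⇒≥ λ x → i≮v (subst (_< v) pv≡i (does⇒ (j <? v) (position σ v <? v) (sym (value στ 1≤v v≤n)) x))))))

encode-injective : ∀ {n σ τ} → Perm (suc n) σ → Monotone (suc n) σ → Perm (suc n) τ → Monotone (suc n) τ → encode σ ≡ encode τ → σ ≡ τ
encode-injective {n} {σ} {τ} p mσ q mτ e = at-ext σ τ (trans (len p) (sym (len q)))
    λ {i} 1≤i i≤ → below (suc i) 1≤i ≤-refl (≤-trans i≤ (≤-reflexive (len p)))
  where
  στ = encode≡⇒SameShape p q e
  τσ = encode≡⇒SameShape q p (sym e)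
  below : ∀ m {i} → 1 ≤ i → i < m → i ≤ suc n → at σ i ≡ at τ i
  below (suc m) {i} 1≤i (s≤s i≤m) i≤n with <-cmp (at σ i) (at τ i)
  ... | tri≈ _ x _ = x
  ... | tri< x _ _ = contradiction x (no-drop p q mτ στ τσ 1≤i i≤n λ 1≤j j<i → below m 1≤j (<-≤-trans j<i i≤m) (≤-trans (<⇒≤ j<i) i≤n))
  ... | tri> _ _ x = contradiction x (no-drop q p mσ τσ στ 1≤i i≤n λ 1≤j j<i → sym (below m 1≤j (<-≤-trans j<i i≤m) (≤-trans (<⇒≤ j<i) i≤n)))

-- Reconstructing a 321-avoiding permutation from its path

excValues nonexcValues : ℕ → List Step → List ℕ
excValues t [] = []
excValues t ((b , true) ∷ w) = suc t ∷ excValues (suc t) w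
excValues t ((b , false) ∷ w) = excValues (suc t) w
nonexcValues t [] = []
nonexcValues t ((b , true) ∷ w) = nonexcValues (suc t) w
nonexcValues t ((b , false) ∷ w) = suc t ∷ nonexcValues (suc t) w

-- Weave t w E N out: the positions from t on receive the entries of out; exceedances take their values
-- from the queue E, the other positions from the queue N.
data Weave : ℕ → List Step → List ℕ → List ℕ → List ℕ → Set where
  last   : ∀ {t x} → x ≤ t → Weave t [] [] (x ∷ []) (x ∷ [])
  exceed : ∀ {t e a w E N out} → t < e → Weave (suc t) w E N out → Weave t ((true , a) ∷ w) (e ∷ E) N (e ∷ out)
  stay   : ∀ {t x a w E N out} → x ≤ t → Weave (suc t) w E N out → Weave t ((false , a) ∷ w) E (x ∷ N) (x ∷ out)

excValues-> : ∀ t w {v} → v ∈ excValues t w → t < v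
excValues-> t ((b , true) ∷ w) (here refl) = ≤-refl
excValues-> t ((b , true) ∷ w) (there p) = <-trans ≤-refl (excValues-> (suc t) w p)
excValues-> t ((b , false) ∷ w) p = <-trans ≤-refl (excValues-> (suc t) w p)

nonexcValues-> : ∀ t w {v} → v ∈ nonexcValues t w → t < v
nonexcValues-> t ((b , false) ∷ w) (here refl) = ≤-refl
nonexcValues-> t ((b , false) ∷ w) (there p) = <-trans ≤-refl (nonexcValues-> (suc t) w p)
nonexcValues-> t ((b , true) ∷ w) p = <-trans ≤-refl (nonexcValues-> (suc t) w p)

excValues-≤ : ∀ t w {v} → v ∈ excValues t w → v ≤ t + length w
excValues-≤ t ((b , true) ∷ w) (here refl) rewrite +-suc t (length w) = s≤s (m≤m+n t _)
excValues-≤ t ((b , true) ∷ w) (there p) rewrite +-suc t (length w) = excValues-≤ (suc t) w p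
excValues-≤ t ((b , false) ∷ w) p rewrite +-suc t (length w) = excValues-≤ (suc t) w p

nonexcValues-≤ : ∀ t w {v} → v ∈ nonexcValues t w → v ≤ t + length w
nonexcValues-≤ t ((b , false) ∷ w) (here refl) rewrite +-suc t (length w) = s≤s (m≤m+n t _)
nonexcValues-≤ t ((b , false) ∷ w) (there p) rewrite +-suc t (length w) = nonexcValues-≤ (suc t) w p
nonexcValues-≤ t ((b , true) ∷ w) p rewrite +-suc t (length w) = nonexcValues-≤ (suc t) w p

excValues-sorted : ∀ t w → AllPairs _<_ (excValues t w)
excValues-sorted t [] = []
excValues-sorted t ((b , true) ∷ w) = All.tabulate (excValues-> (suc t) w) ∷ excValues-sorted (suc t) w
excValues-sorted t ((b , false) ∷ w) = excValues-sorted (suc t) w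

nonexcValues-sorted : ∀ t w → AllPairs _<_ (nonexcValues t w)
nonexcValues-sorted t [] = []
nonexcValues-sorted t ((b , true) ∷ w) = nonexcValues-sorted (suc t) w
nonexcValues-sorted t ((b , false) ∷ w) = All.tabulate (nonexcValues-> (suc t) w) ∷ nonexcValues-sorted (suc t) w

values-disjoint : ∀ t w {v} → v ∈ excValues t w → v ∈ nonexcValues t w → ⊥
values-disjoint t ((b , true) ∷ w) (here refl) q = <-irrefl refl (nonexcValues-> (suc t) w q)
values-disjoint t ((b , true) ∷ w) (there p) q = values-disjoint (suc t) w p q
values-disjoint t ((b , false) ∷ w) p (here refl) = <-irrefl refl (excValues-> (suc t) w p)
values-disjoint t ((b , false) ∷ w) p (there q) = values-disjoint (suc t) w p q

-- Coming down from height `k` takes at least `k` steps that announce an exceedance value. This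
-- keeps the queue `E` from being empty when a position has to be an exceedance.
height≤excValues : ∀ {k w s} t → Path k w s → k ≤ length (excValues t w)
height≤excValues t [] = z≤n
height≤excValues t (up p) = ≤-trans (n≤1+n _) (height≤excValues (suc t) p)
height≤excValues t (down p) = s≤s (height≤excValues (suc t) p)
height≤excValues t (level₀ p) = height≤excValues (suc t) p
height≤excValues t (level₁ p) = m≤n⇒m≤1+n (height≤excValues (suc t) p)

-- X holds the exceedance values > t already assigned to positions < t, and Y the values ≤ t still to be
-- assigned; a path at height k has |X| = k and |Y| = k + 1.
weave : ∀ t {k w s} → Path k w s → ∀ X E Y → length X ≡ k → X ++ E ≡ excValues t w → length Y ≡ suc k → All (_≤ t) Y →
  ∃ λ out → Weave t w E (Y ++ nonexcValues t w) out
weave t [] [] [] (y ∷ []) refl refl refl (y≤t ∷ []) = y ∷ [] , last y≤t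
weave t {k} {_ ∷ w} (up p) X [] Y ex eX eY aY = contradiction
  (≤-trans (height≤excValues (suc t) p) (≤-reflexive (trans (cong length (trans (sym eX) (++-identityʳ X))) ex))) (<-irrefl refl)
weave t {k} {_ ∷ w} (up p) X (e ∷ E) Y ex eX eY aY
  with weave (suc t) p (X ++ e ∷ []) E (Y ++ suc t ∷ []) (trans (length-++ X) (trans (+-comm _ 1) (cong suc ex)))
         (trans (++-assoc X _ E) eX) (trans (length-++ Y) (trans (+-comm _ 1) (cong suc eY))) (AllP.++⁺ (All.map m≤n⇒m≤1+n aY) (≤-refl ∷ []))
... | out , W rewrite ++-assoc Y (suc t ∷ []) (nonexcValues (suc t) w) =
  e ∷ out , exceed (<-trans ≤-refl (excValues-> (suc t) w (subst (e ∈_) eX (∈-++⁺ʳ X (here refl))))) W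
weave t (down p) (x ∷ X) E (y ∷ Y) ex eX eY (y≤t ∷ aY)
  with weave (suc t) p X E Y (suc-injective ex) (∷-injectiveʳ eX) (suc-injective eY) (All.map m≤n⇒m≤1+n aY)
... | out , W = y ∷ out , stay y≤t W
weave t {k} {_ ∷ w} (level₀ p) X E (y ∷ Y) ex eX eY (y≤t ∷ aY)
  with weave (suc t) p X E (Y ++ suc t ∷ []) ex eX (trans (length-++ Y) (trans (+-comm _ 1) eY)) (AllP.++⁺ (All.map m≤n⇒m≤1+n aY) (≤-refl ∷ []))
... | out , W rewrite ++-assoc Y (suc t ∷ []) (nonexcValues (suc t) w) = y ∷ out , stay y≤t W
weave t {k} {_ ∷ w} (level₁ p) X [] Y ex eX eY aY = contradiction
  (≤-trans (s≤s (height≤excValues (suc t) p)) (≤-reflexive (trans (cong length (trans (sym eX) (++-identityʳ X))) ex))) (<-irrefl refl)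
weave t (level₁ p) [] (e ∷ E) Y ex eX eY aY
  with weave (suc t) p [] E Y ex (∷-injectiveʳ eX) eY (All.map m≤n⇒m≤1+n aY)
... | out , W = e ∷ out , exceed (≤-reflexive (sym (∷-injectiveˡ eX))) W
weave t {k} {_ ∷ w} (level₁ p) (x ∷ X) (e ∷ E) Y ex eX eY aY
  with weave (suc t) p (X ++ e ∷ []) E Y (trans (length-++ X) (trans (+-comm _ 1) ex)) (trans (++-assoc X _ E) (∷-injectiveʳ eX)) eY (All.map m≤n⇒m≤1+n aY)
... | out , W = e ∷ out , exceed (<-trans ≤-refl (excValues-> (suc t) w (subst (e ∈_) (∷-injectiveʳ eX) (∈-++⁺ʳ X (here refl))))) W

weave-length : ∀ {t w E N out} → Weave t w E N out → length out ≡ suc (length w)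
weave-length (last _) = refl
weave-length (exceed _ W) = cong suc (weave-length W)
weave-length (stay _ W) = cong suc (weave-length W)

weave-∈ : ∀ {t w E N out v} → Weave t w E N out → v ∈ out → v ∈ E ⊎ v ∈ N
weave-∈ (last _) (here refl) = inj₂ (here refl)
weave-∈ (exceed _ W) (here refl) = inj₁ (here refl)
weave-∈ (exceed _ W) (there p) with weave-∈ W p
... | inj₁ q = inj₁ (there q)
... | inj₂ q = inj₂ q
weave-∈ (stay _ W) (here refl) = inj₂ (here refl)
weave-∈ (stay _ W) (there p) with weave-∈ W p
... | inj₁ q = inj₁ q
... | inj₂ q = inj₂ (there q)

weave-unique : ∀ {t w E N out} → Weave t w E N out → AllPairs _<_ E → AllPairs _<_ N → (∀ {v} → v ∈ E → v ∈ N → ⊥) → Unique out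
weave-unique (last _) _ _ _ = [] ∷ []
weave-unique (exceed _ W) (e< ∷ sE) sN dis = All.tabulate (λ { v∈ refl → case weave-∈ W v∈ of λ
  { (inj₁ q) → <-irrefl refl (All.lookup e< q) ; (inj₂ q) → dis (here refl) q } }) ∷ weave-unique W sE sN (dis ∘ there)
weave-unique (stay _ W) sE (x< ∷ sN) dis = All.tabulate (λ { v∈ refl → case weave-∈ W v∈ of λ
  { (inj₁ q) → dis q (here refl) ; (inj₂ q) → <-irrefl refl (All.lookup x< q) } }) ∷ weave-unique W sE sN (λ p q → dis p (there q))

weave-tag : ∀ {t w E N out} → Weave t w E N out → ∀ i → i < length out →
  (at out (suc i) ∈ E × t + i < at out (suc i)) ⊎ (at out (suc i) ∈ N × at out (suc i) ≤ t + i)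
weave-tag {t} (last x≤t) zero _ rewrite +-identityʳ t = inj₂ (here refl , x≤t)
weave-tag (last x≤t) (suc i) (s≤s ())
weave-tag {t} (exceed lt W) zero _ rewrite +-identityʳ t = inj₁ (here refl , lt)
weave-tag {t} (exceed lt W) (suc i) (s≤s i<) rewrite +-suc t i with weave-tag W i i<
... | inj₁ (a , b) = inj₁ (there a , b)
... | inj₂ q = inj₂ q
weave-tag {t} (stay le W) zero _ rewrite +-identityʳ t = inj₂ (here refl , le)
weave-tag {t} (stay le W) (suc i) (s≤s i<) rewrite +-suc t i with weave-tag W i i<
... | inj₁ q = inj₁ q
... | inj₂ (a , b) = inj₂ (there a , b)

weave-exceedances : ∀ {t w E N out} → Weave t w E N out → AllPairs _<_ E → ∀ i j → i < j → j < length out →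
  t + i < at out (suc i) → t + j < at out (suc j) → at out (suc i) < at out (suc j)
weave-exceedances (last _) _ _ (suc j) _ (s≤s ())
weave-exceedances {t} (exceed lt W) (e< ∷ sE) zero (suc j) _ (s≤s j<) ei ej rewrite +-suc t j with weave-tag W j j<
... | inj₁ (q , _) = All.lookup e< q
... | inj₂ (_ , le) = contradiction ej (≤⇒≯ le)
weave-exceedances {t} (exceed lt W) (e< ∷ sE) (suc i) (suc j) (s≤s i<j) (s≤s j<) ei ej rewrite +-suc t i | +-suc t j = weave-exceedances W sE i j i<j j< ei ej
weave-exceedances {t} (stay le W) sE zero (suc j) _ _ ei ej rewrite +-identityʳ t = contradiction ei (≤⇒≯ le)
weave-exceedances {t} (stay le W) sE (suc i) (suc j) (s≤s i<j) (s≤s j<) ei ej rewrite +-suc t i | +-suc t j = weave-exceedances W sE i j i<j j< ei ej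

weave-nonexceedances : ∀ {t w E N out} → Weave t w E N out → AllPairs _<_ N → ∀ i j → i < j → j < length out →
  at out (suc i) ≤ t + i → at out (suc j) ≤ t + j → at out (suc i) < at out (suc j)
weave-nonexceedances (last _) _ _ (suc j) _ (s≤s ())
weave-nonexceedances {t} (stay le W) (x< ∷ sN) zero (suc j) _ (s≤s j<) ei ej rewrite +-suc t j with weave-tag W j j<
... | inj₂ (q , _) = All.lookup x< q
... | inj₁ (_ , lt) = contradiction lt (≤⇒≯ ej)
weave-nonexceedances {t} (stay le W) (x< ∷ sN) (suc i) (suc j) (s≤s i<j) (s≤s j<) ei ej rewrite +-suc t i | +-suc t j = weave-nonexceedances W sN i j i<j j< ei ej
weave-nonexceedances {t} (exceed lt W) sN zero (suc j) _ _ ei ej rewrite +-identityʳ t = contradiction lt (≤⇒≯ ei)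
weave-nonexceedances {t} (exceed lt W) sN (suc i) (suc j) (s≤s i<j) (s≤s j<) ei ej rewrite +-suc t i | +-suc t j = weave-nonexceedances W sN i j i<j j< ei ej

-- `σ` and `g` are arbitrary functions because the recursion shortens `out`, while the bits refer to
-- positions and values of the whole permutation.
weave-steps : ∀ {t w E N out} {σ : ℕ → ℕ} {g : ℕ → Bool} → Weave t w E N out → (∀ i → i < length out → σ (t + i) ≡ at out (suc i)) →
  (∀ {v} → v ∈ excValues t w → g v ≡ true) → (∀ {v} → v ∈ nonexcValues t w → g v ≡ false) →
  steps (λ t → does (t <? σ t)) g t (length w) ≡ w
weave-steps (last _) _ _ _ = refl
weave-steps {t} {(b , a) ∷ w} {out = out} {σ} {g} W h gE gN = cong₂ _∷_ (cong₂ _,_ (bit W (trans (cong σ (sym (+-identityʳ t))) (h 0 (nonempty W)))) (vBit a gE gN))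
    (rest W)
  where
  nonempty : ∀ {t w E N out} → Weave t w E N out → 0 < length out
  nonempty W = ≤-trans (s≤s z≤n) (≤-reflexive (sym (weave-length W)))
  bit : ∀ {b a w E N out} → Weave t ((b , a) ∷ w) E N out → σ t ≡ at out 1 → does (t <? σ t) ≡ b
  bit (exceed lt _) e rewrite e = dec-true (t <? _) lt
  bit (stay le _) e rewrite e = dec-false (t <? _) (≤⇒≯ le)
  vBit : ∀ {b w} a → (∀ {v} → v ∈ excValues t ((b , a) ∷ w) → g v ≡ true) → (∀ {v} → v ∈ nonexcValues t ((b , a) ∷ w) → g v ≡ false) → g (suc t) ≡ a
  vBit true e _ = e (here refl)
  vBit false _ n = n (here refl)
  eTail : ∀ a {v} → v ∈ excValues (suc t) w → v ∈ excValues t ((b , a) ∷ w)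
  eTail true = there
  eTail false p = p
  nTail : ∀ a {v} → v ∈ nonexcValues (suc t) w → v ∈ nonexcValues t ((b , a) ∷ w)
  nTail true p = p
  nTail false = there
  rest : ∀ {E N} → Weave t ((b , a) ∷ w) E N out → steps (λ t → does (t <? σ t)) g (suc t) (length w) ≡ w
  rest (exceed _ W') = weave-steps {σ = σ} W' (λ i i< → trans (cong σ (sym (+-suc t i))) (h (suc i) (s≤s i<))) (gE ∘ eTail a) (gN ∘ nTail a)
  rest (stay _ W') = weave-steps {σ = σ} W' (λ i i< → trans (cong σ (sym (+-suc t i))) (h (suc i) (s≤s i<))) (gE ∘ eTail a) (gN ∘ nTail a)

decode : ∀ {w s} → Path 0 w s → ∃ λ σ → Perm (suc (length w)) σ × Monotone (suc (length w)) σ × encode σ ≡ w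
-- The queue of pending values starts as `1 ∷ []`: the steps announce values from 2 on, and 1 is
-- always the value of a nonexceedance.
decode {w} path with weave 1 path [] (excValues 1 w) (1 ∷ []) refl refl refl (≤-refl ∷ [])
... | σ , W = σ , p , mono , subst (λ l → steps (excBit σ) (valueBit σ) 1 (l ∸ 1) ≡ w) (sym (weave-length W)) (weave-steps {σ = at σ} W (λ _ _ → refl) high low)
  where
  E = excValues 1 w
  N = 1 ∷ nonexcValues 1 w
  disjoint : ∀ {v} → v ∈ E → v ∈ N → ⊥
  disjoint q (here refl) = <-irrefl refl (excValues-> 1 w q)
  disjoint q (there r) = values-disjoint 1 w q r
  p : Perm (suc (length w)) σ
  p = perm (weave-length W) rng (weave-unique W (excValues-sorted 1 w) (All.tabulate (nonexcValues-> 1 w) ∷ nonexcValues-sorted 1 w) disjoint)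
    where
    rng : ∀ {v} → v ∈ σ → 1 ≤ v × v ≤ suc (length w)
    rng v∈ with weave-∈ W v∈
    ... | inj₁ q = <⇒≤ (excValues-> 1 w q) , excValues-≤ 1 w q
    ... | inj₂ (here refl) = ≤-refl , s≤s z≤n
    ... | inj₂ (there q) = <⇒≤ (nonexcValues-> 1 w q) , nonexcValues-≤ 1 w q
  mono : Monotone (suc (length w)) σ
  mono = record
    { exceedances = λ { {suc i} {suc j} _ (s≤s i<j) j≤ → weave-exceedances W (excValues-sorted 1 w) i j i<j (≤-trans j≤ (≤-reflexive (sym (weave-length W)))) }
    ; nonexceedances = λ { {suc i} {suc j} _ (s≤s i<j) j≤ → weave-nonexceedances W (All.tabulate (nonexcValues-> 1 w) ∷ nonexcValues-sorted 1 w) i j i<j (≤-trans j≤ (≤-reflexive (sym (weave-length W)))) } }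
  tag : ∀ {v} → 1 ≤ v → v ≤ suc (length w) → (v ∈ E × position σ v < v) ⊎ (v ∈ N × v ≤ position σ v)
  tag {v} 1≤v v≤ with position σ v | position-range p 1≤v v≤ | at-position p 1≤v v≤
  ... | suc i | _ , i≤ | e with weave-tag W i (≤-trans i≤ (≤-reflexive (sym (weave-length W))))
  ... | inj₁ (a , b) rewrite e = inj₁ (a , b)
  ... | inj₂ (a , b) rewrite e = inj₂ (a , b)
  high : ∀ {v} → v ∈ E → does (position σ v <? v) ≡ true
  high {v} q with tag (<⇒≤ (excValues-> 1 w q)) (excValues-≤ 1 w q)
  ... | inj₁ (_ , lt) = dec-true (position σ v <? v) lt
  ... | inj₂ (r , _) = ⊥-elim (disjoint q r)
  low : ∀ {v} → v ∈ nonexcValues 1 w → does (position σ v <? v) ≡ false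
  low {v} q with tag (<⇒≤ (nonexcValues-> 1 w q)) (nonexcValues-≤ 1 w q)
  ... | inj₁ (r , _) = ⊥-elim (disjoint r (there q))
  ... | inj₂ (_ , le) = dec-false (position σ v <? v) (≤⇒≯ le)

-- 132-avoiding permutations and trees

data Tree : Set where
  leaf : Tree
  node : Tree → Tree → Tree

size : Tree → ℕ
size leaf = 0
size (node α γ) = suc (size α + size γ)

-- The 132-avoiding arrangement of y+1, …, y+n: its last entry is preceded first by all larger and
-- then by all smaller entries.
arrange : Tree → ℕ → List ℕ
arrange leaf y = []
arrange (node α γ) y = arrange γ (y + suc (size α)) ++ arrange α y ++ y + suc (size α) ∷ []

length-arrange : ∀ t y → length (arrange t y) ≡ size t
length-arrange leaf y = refl
length-arrange (node α γ) y = begin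
  length (arrange γ (y + suc (size α)) ++ arrange α y ++ _) ≡⟨ length-++ (arrange γ _) ⟩
  length (arrange γ (y + suc (size α))) + length (arrange α y ++ _) ≡⟨ cong₂ _+_ (length-arrange γ _) (length-++ (arrange α y)) ⟩
  size γ + (length (arrange α y) + 1) ≡⟨ cong (λ k → size γ + (k + 1)) (length-arrange α y) ⟩
  size γ + (size α + 1) ≡⟨ cong (size γ +_) (+-comm (size α) 1) ⟩
  size γ + suc (size α) ≡⟨ +-comm (size γ) (suc (size α)) ⟩
  suc (size α + size γ) ∎
  where open ≡-Reasoning

arrange-range : ∀ t y {v} → v ∈ arrange t y → y < v × v ≤ y + size t
arrange-range (node α γ) y v∈ with ∈-++⁻ (arrange γ (y + suc (size α))) v∈
... | inj₁ p = let (a , b) = arrange-range γ _ p in ≤-<-trans (m≤m+n y _) a , ≤-trans b (≤-reflexive (+-assoc y (suc (size α)) (size γ)))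
... | inj₂ q with ∈-++⁻ (arrange α y) q
... | inj₁ r = let (a , b) = arrange-range α y r in a , ≤-trans b (+-monoʳ-≤ y (≤-trans (m≤m+n _ (size γ)) (n≤1+n _)))
... | inj₂ (here refl) = m<m+n y (s≤s z≤n) , +-monoʳ-≤ y (s≤s (m≤m+n _ (size γ)))

arrange-unique : ∀ t y → Unique (arrange t y)
arrange-unique leaf y = []
arrange-unique (node α γ) y = UniqueP.++⁺ (arrange-unique γ _) (UniqueP.++⁺ (arrange-unique α y) ([] ∷ [])
    λ { (p , here refl) → <-irrefl refl (<-≤-trans (≤-<-trans (proj₂ (arrange-range α y p)) (+-monoʳ-< y ≤-refl)) ≤-refl) })
  λ (p , q) → case ∈-++⁻ (arrange α y) q of λ
    { (inj₁ r) → <-asym (proj₁ (arrange-range γ _ p)) (≤-<-trans (proj₂ (arrange-range α y r)) (+-monoʳ-< y ≤-refl))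
    ; (inj₂ (here refl)) → <-irrefl refl (proj₁ (arrange-range γ _ p)) }

arrange-perm : ∀ t → Perm (size t) (arrange t 0)
arrange-perm t = perm (length-arrange t 0) (arrange-range t 0) (arrange-unique t 0)

subseqs-++⁻ : ∀ xs ys {s} → s ∈ subseqs (xs ++ ys) → ∃₂ λ s₁ s₂ → s ≡ s₁ ++ s₂ × s₁ ∈ subseqs xs × s₂ ∈ subseqs ys
subseqs-++⁻ [] ys {s} p = [] , s , refl , here refl , p
subseqs-++⁻ (x ∷ xs) ys p with ∈-subseqs-∷⁻ x {xs ++ ys} p
... | inj₁ (s' , q , refl) with subseqs-++⁻ xs ys q
... | s₁ , s₂ , refl , a , b = x ∷ s₁ , s₂ , refl , keep x xs a , b
subseqs-++⁻ (x ∷ xs) ys p | inj₂ q with subseqs-++⁻ xs ys q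
... | s₁ , s₂ , refl , a , b = s₁ , s₂ , refl , skip x xs a , b

subseqs-++⁺ : ∀ xs ys {s₁ s₂} → s₁ ∈ subseqs xs → s₂ ∈ subseqs ys → s₁ ++ s₂ ∈ subseqs (xs ++ ys)
subseqs-++⁺ [] ys (here refl) q = q
subseqs-++⁺ (x ∷ xs) ys p q with ∈-subseqs-∷⁻ x {xs} p
... | inj₁ (s' , r , refl) = keep x (xs ++ ys) (subseqs-++⁺ xs ys r q)
... | inj₂ r = skip x (xs ++ ys) (subseqs-++⁺ xs ys r q)

subseqs-++ˡ : ∀ xs ys {s} → s ∈ subseqs xs → s ∈ subseqs (xs ++ ys)
subseqs-++ˡ xs ys {s} p = subst (_∈ subseqs (xs ++ ys)) (++-identityʳ s) (subseqs-++⁺ xs ys p ([]∈subseqs ys))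

subseqs-++ʳ : ∀ xs ys {s} → s ∈ subseqs ys → s ∈ subseqs (xs ++ ys)
subseqs-++ʳ xs ys p = subseqs-++⁺ xs ys ([]∈subseqs xs) p

subseqs-⊆ : ∀ xs {s v} → s ∈ subseqs xs → v ∈ s → v ∈ xs
subseqs-⊆ [] (here refl) ()
subseqs-⊆ (x ∷ xs) p v∈ with ∈-subseqs-∷⁻ x {xs} p
... | inj₂ r = there (subseqs-⊆ xs r v∈)
subseqs-⊆ (x ∷ xs) p (here refl) | inj₁ (s' , r , refl) = here refl
subseqs-⊆ (x ∷ xs) p (there v∈) | inj₁ (s' , r , refl) = there (subseqs-⊆ xs r v∈)

∈⇒subseq : ∀ {xs : List ℕ} {v} → v ∈ xs → (v ∷ []) ∈ subseqs xs
∈⇒subseq {x ∷ xs} (here refl) = keep x xs ([]∈subseqs xs)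
∈⇒subseq {x ∷ xs} (there p) = skip x xs (∈⇒subseq p)

-- Phrased with subsequences rather than positions, so that it passes to the factors of a
-- concatenation without reindexing.
Avoids132 : List ℕ → Set
Avoids132 σ = ∀ {a b c} → (a ∷ b ∷ c ∷ []) ∈ subseqs σ → a < c → ¬ (c < b)

-- A 132 starting in the block of `γ` stays there, since its last entry exceeds its first and
-- everything after that block is smaller. Any other lies in the block of `α`: the root comes last
-- and exceeds all of `α`, so no larger entry could be the middle of a 132 ending there.
arrange-avoids : ∀ t y → Avoids132 (arrange t y)
arrange-avoids leaf y (here ())
arrange-avoids leaf y (there ())
arrange-avoids (node α γ) y {a} {b} {c} s a<c c<b with subseqs-++⁻ (arrange γ (y + suc (size α))) _ s
... | s₁ , s₂ , e , p , q = outer s₁ e p q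
  where
  m = y + suc (size α)
  rest = arrange α y ++ m ∷ []
  above : ∀ {s v} → s ∈ subseqs (arrange γ m) → v ∈ s → m < v
  above p v∈ = proj₁ (arrange-range γ m (subseqs-⊆ (arrange γ m) p v∈))
  below : ∀ {s v} → s ∈ subseqs (arrange α y) → v ∈ s → v < m
  below p v∈ = ≤-<-trans (proj₂ (arrange-range α y (subseqs-⊆ (arrange α y) p v∈))) (+-monoʳ-< y ≤-refl)
  equal : ∀ {s v} → s ∈ subseqs (m ∷ []) → v ∈ s → v ≡ m
  equal p v∈ with subseqs-⊆ (m ∷ []) p v∈
  ... | here e = e
  inner : ∀ s₃ {s₄} → a ∷ b ∷ c ∷ [] ≡ s₃ ++ s₄ → s₃ ∈ subseqs (arrange α y) → s₄ ∈ subseqs (m ∷ []) → ⊥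
  inner [] refl p q = <-irrefl (trans (equal q (there (there (here refl)))) (sym (equal q (there (here refl))))) c<b
  inner (_ ∷ []) refl p q = <-irrefl (trans (equal q (there (here refl))) (sym (equal q (here refl)))) c<b
  inner (_ ∷ _ ∷ []) refl p q = <-asym c<b (subst (b <_) (sym (equal q (here refl))) (below p (there (here refl))))
  inner (_ ∷ _ ∷ _ ∷ []) refl p q = arrange-avoids α y p a<c c<b
  inner (_ ∷ _ ∷ _ ∷ _ ∷ _) () p q
  rest-≤ : ∀ {s v} → s ∈ subseqs rest → v ∈ s → v ≤ m
  rest-≤ q v∈ with ∈-++⁻ (arrange α y) (subseqs-⊆ rest q v∈)
  ... | inj₁ r = <⇒≤ (≤-<-trans (proj₂ (arrange-range α y r)) (+-monoʳ-< y ≤-refl))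
  ... | inj₂ (here refl) = ≤-refl
  outer : ∀ s₁ {s₂} → a ∷ b ∷ c ∷ [] ≡ s₁ ++ s₂ → s₁ ∈ subseqs (arrange γ m) → s₂ ∈ subseqs rest → ⊥
  outer [] refl p q with subseqs-++⁻ (arrange α y) (m ∷ []) q
  ... | s₃ , s₄ , e , r , u = inner s₃ e r u
  outer (_ ∷ []) refl p q = <⇒≱ (<-trans (above p (here refl)) a<c) (rest-≤ q (there (here refl)))
  outer (_ ∷ _ ∷ []) refl p q = <⇒≱ (<-trans (above p (here refl)) a<c) (rest-≤ q (here refl))
  outer (_ ∷ _ ∷ _ ∷ []) refl p q = arrange-avoids γ m p a<c c<b
  outer (_ ∷ _ ∷ _ ∷ _ ∷ _) () p q

arrange-avoids-132 : ∀ t → Avoids (arrange t 0) (pat p132)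
arrange-avoids-132 t av with contains⁻ p132 {arrange t 0} av
... | a , b , c , s , a<c , c<b = arrange-avoids t 0 s a<c c<b

-- The hypothesis is what avoiding 132 means for triples whose last entry is a `v` appended to `σ`:
-- no entry below `v` precedes one above it.
split-at-value : ∀ v σ → (∀ {a c} → (a ∷ c ∷ []) ∈ subseqs σ → a < v → ¬ (v < c)) → v ∉ σ →
  ∃₂ λ γ α → σ ≡ γ ++ α × All (v <_) γ × All (_< v) α
split-at-value v [] _ _ = [] , [] , refl , [] , []
split-at-value v (x ∷ σ) h v∉ with <-cmp x v
... | tri≈ _ e _ = contradiction (here (sym e)) v∉
... | tri< x<v _ _ = [] , x ∷ σ , refl , [] , x<v ∷ All.tabulate λ {c} c∈ →
      ≤∧≢⇒< (≮⇒≥ (h (keep x σ (∈⇒subseq c∈)) x<v)) λ { refl → v∉ (there c∈) }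
... | tri> _ _ v<x with split-at-value v σ (h ∘ skip x σ) (v∉ ∘ there)
... | γ , α , refl , aγ , aα = x ∷ γ , α , refl , v<x ∷ aγ , aα

range-length-≤ : ∀ {σ lo k} → Unique σ → (∀ {v} → v ∈ σ → lo < v × v ≤ lo + k) → length σ ≤ k
range-length-≤ {σ} {lo} {k} u h = subst (length σ ≤_) (trans (length-map (lo +_) (oneTo k)) (length-oneTo k))
  (unique-⊆⇒≤ u λ {v} v∈ → let (a , b) = h v∈ in subst (_∈ map (lo +_) (oneTo k)) (m+[n∸m]≡n (<⇒≤ a))
    (∈-map⁺ (lo +_) (∈-oneTo⁺ (m<n⇒0<n∸m a) (m≤n+o⇒m∸n≤o v lo b))))

unique-++⁻ : ∀ (xs : List ℕ) {ys} → Unique (xs ++ ys) → Unique xs × Unique ys × (∀ {v} → v ∈ xs → v ∉ ys)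
unique-++⁻ [] u = [] , u , λ ()
unique-++⁻ (x ∷ xs) (x∉ ∷ u) with unique-++⁻ xs u
... | ux , uy , d = AllP.++⁻ˡ xs x∉ ∷ ux , uy , λ
  { (here refl) q → All.lookup (AllP.++⁻ʳ xs x∉) q refl ; (there p) q → d p q }

snoc : ∀ {A : Set} (x : A) xs → ∃₂ λ ys y → x ∷ xs ≡ ys ++ y ∷ []
snoc x [] = [] , x , refl
snoc x (z ∷ xs) with snoc z xs
... | ys , y , e = x ∷ ys , y , cong (x ∷_) e

arrange-surjective : ∀ σ y → Unique σ → (∀ {v} → v ∈ σ → y < v × v ≤ y + length σ) → Avoids132 σ →
  ∃ λ t → arrange t y ≡ σ
arrange-surjective σ y = go (length σ) σ y ≤-refl
  where
  Covered : ℕ → ℕ → List ℕ → Set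
  Covered fuel y σ = length σ ≤ fuel → Unique σ → (∀ {v} → v ∈ σ → y < v × v ≤ y + length σ) → Avoids132 σ →
    ∃ λ t → arrange t y ≡ σ
  go : ∀ fuel σ y → Covered fuel y σ
  covered-∷ʳ : ∀ fuel σ' v y → Covered (suc fuel) y (σ' ++ v ∷ [])
  go fuel [] y _ _ _ _ = leaf , refl
  go zero (_ ∷ _) y ()
  go (suc fuel) (x ∷ σ) y with snoc x σ
  ... | σ' , v , eq = subst (Covered (suc fuel) y) (sym eq) (covered-∷ʳ fuel σ' v y)
  covered-∷ʳ fuel σ' v y le u r av
    with unique-++⁻ σ' u
  ... | u' , _ , d
    with split-at-value v σ' (λ s a<v v<c → av (subseqs-++⁺ σ' (v ∷ []) s (keep v [] (here refl))) a<v v<c) (λ v∈ → d v∈ (here refl))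
  ... | γ , α , refl , aγ , aα
    with unique-++⁻ γ u' | r (∈-++⁺ʳ (γ ++ α) (here refl))
  ... | uγ , uα , _ | y<v , v≤
    with m≤n⇒∃[o]m+o≡n y<v
  ... | k , refl
    with m≤n⇒∃[o]m+o≡n (+-cancelˡ-≤ y (suc k) _ (subst (_≤ y + length ((γ ++ α) ++ suc (y + k) ∷ [])) (sym (+-suc y k)) v≤))
  ... | l , e = node (proj₁ tα) (proj₁ tγ) , combine
    where
    length≡ : length ((γ ++ α) ++ v ∷ []) ≡ suc (length γ + length α)
    length≡ = trans (length-++ (γ ++ α)) (trans (+-comm _ 1) (cong suc (length-++ γ)))
    range-∈ : ∀ {w} → w ∈ γ ++ α → y < w × w ≤ y + (suc k + l)
    range-∈ w∈ = let (a , b) = r (∈-++⁺ˡ w∈) in a , ≤-trans b (≤-reflexive (cong (y +_) (sym e)))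
    rangeα : ∀ {w} → w ∈ α → y < w × w ≤ y + k
    rangeα w∈ = proj₁ (range-∈ (∈-++⁺ʳ γ w∈)) , s≤s⁻¹ (All.lookup aα w∈)
    rangeγ : ∀ {w} → w ∈ γ → v < w × w ≤ v + l
    rangeγ w∈ = All.lookup aγ w∈ , ≤-trans (proj₂ (range-∈ (∈-++⁺ˡ w∈))) (≤-reflexive (trans (sym (+-assoc y (suc k) l)) (cong (_+ l) (+-suc y k))))
    -- `α` fits into an interval of `k` values and `γ` into one of `l` values. As their lengths add
    -- up to `k + l`, both intervals are filled, which is the range hypothesis for the two recursive
    -- calls.
    total : length γ + length α ≡ k + l
    total = suc-injective (trans (sym length≡) (sym e))
    α≤k : length α ≤ k
    α≤k = range-length-≤ uα rangeα
    γ≤l : length γ ≤ l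
    γ≤l = range-length-≤ uγ rangeγ
    α≡k : length α ≡ k
    α≡k = ≤-antisym α≤k (+-cancelʳ-≤ l k _ (≤-trans (≤-reflexive (sym total)) (≤-trans (+-monoˡ-≤ _ γ≤l) (≤-reflexive (+-comm l _)))))
    γ≡l : length γ ≡ l
    γ≡l = +-cancelʳ-≡ (length α) _ l (trans total (trans (+-comm k l) (cong (l +_) (sym α≡k))))
    fuel≥ : length γ + length α ≤ fuel
    fuel≥ = s≤s⁻¹ (≤-trans (≤-reflexive (sym length≡)) le)
    tα : ∃ λ t → arrange t y ≡ α
    tα = go fuel α y (≤-trans (m≤n+m _ _) fuel≥) uα (λ w∈ → let (a , b) = rangeα w∈ in a , ≤-trans b (+-monoʳ-≤ y (≤-reflexive (sym α≡k))))
      λ s → av (subseqs-++ˡ (γ ++ α) _ (subseqs-++ʳ γ α s))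
    tγ : ∃ λ t → arrange t v ≡ γ
    tγ = go fuel γ v (≤-trans (m≤m+n _ _) fuel≥) uγ (λ w∈ → let (a , b) = rangeγ w∈ in a , ≤-trans b (+-monoʳ-≤ v (≤-reflexive (sym γ≡l))))
      λ s → av (subseqs-++ˡ (γ ++ α) _ (subseqs-++ˡ γ α s))
    sizeα : size (proj₁ tα) ≡ k
    sizeα = trans (sym (length-arrange (proj₁ tα) y)) (trans (cong length (proj₂ tα)) α≡k)
    combine : arrange (node (proj₁ tα) (proj₁ tγ)) y ≡ (γ ++ α) ++ v ∷ []
    combine = trans (cong₂ (λ a b → arrange (proj₁ tγ) a ++ arrange (proj₁ tα) y ++ b ∷ []) root≡v root≡v)
      (trans (cong₂ (λ a b → a ++ b ++ v ∷ []) (proj₂ tγ) (proj₂ tα)) (sym (++-assoc γ α (v ∷ []))))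
      where
      root≡v : y + suc (size (proj₁ tα)) ≡ v
      root≡v = trans (cong (λ a → y + suc a) sizeα) (+-suc y k)

arrange-covers : ∀ {n σ} → Perm n σ → Avoids σ (pat p132) → ∃ λ t → arrange t 0 ≡ σ
arrange-covers {n} {σ} p av = arrange-surjective σ 0 (unique p) (λ v∈ → let (a , b) = range p v∈ in a , ≤-trans b (≤-reflexive (sym (len p))))
  λ s a<c c<b → av (subseq⇒contains p132 {σ} s (a<c , c<b))

++-cancel : ∀ {A : Set} (xs xs' : List A) {ys ys'} → length xs ≡ length xs' → xs ++ ys ≡ xs' ++ ys' → xs ≡ xs' × ys ≡ ys'
++-cancel [] [] _ e = refl , e
++-cancel (x ∷ xs) (x' ∷ xs') l e with ∷-injective e
... | refl , e' with ++-cancel xs xs' (suc-injective l) e'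
... | refl , e'' = refl , e''

arrange-injective : ∀ t t' y → arrange t y ≡ arrange t' y → t ≡ t'
arrange-injective t t' y e with trans (sym (length-arrange t y)) (trans (cong length e) (length-arrange t' y))
arrange-injective leaf leaf y e | _ = refl
arrange-injective (node α γ) (node α' γ') y e | s with
  ++-cancel (arrange γ (y + suc (size α)) ++ arrange α y) (arrange γ' (y + suc (size α')) ++ arrange α' y) lengths
    (trans (++-assoc (arrange γ _) (arrange α y) _) (trans e (sym (++-assoc (arrange γ' _) (arrange α' y) _))))
  where
  lengths : length (arrange γ (y + suc (size α)) ++ arrange α y) ≡ length (arrange γ' (y + suc (size α')) ++ arrange α' y)
  lengths = trans (trans (length-++ (arrange γ _)) (cong₂ _+_ (length-arrange γ _) (length-arrange α y)))
    (trans (trans (+-comm (size γ) (size α)) (trans (suc-injective s) (+-comm (size α') (size γ'))))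
      (sym (trans (length-++ (arrange γ' _)) (cong₂ _+_ (length-arrange γ' _) (length-arrange α' y)))))
... | e₁ , e₂ with suc-injective (+-cancelˡ-≡ y _ _ (∷-injectiveˡ e₂))
... | a≡ with ++-cancel (arrange γ (y + suc (size α))) (arrange γ' (y + suc (size α'))) lengths e₁
  where
  lengths : length (arrange γ (y + suc (size α))) ≡ length (arrange γ' (y + suc (size α')))
  lengths = trans (length-arrange γ _) (trans (+-cancelˡ-≡ (size α) _ _ (trans (suc-injective s) (cong (_+ size γ') (sym a≡)))) (sym (length-arrange γ' _)))
... | eγ , eα = cong₂ node (arrange-injective α α' y eα)
  (arrange-injective γ γ' (y + suc (size α)) (trans eγ (cong (λ k → arrange γ' (y + suc k)) (sym a≡))))

-- Crossings of a 132-avoiding permutation, node by node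

arcs : ℕ → List ℕ → List (ℕ × ℕ)
arcs x [] = []
arcs x (v ∷ σ) = (suc x , v) ∷ arcs (suc x) σ

∑-arcs : ∀ x σ (f : ℕ × ℕ → ℕ) → ∑ (oneTo (length σ)) (λ i → f (x + i , at σ i)) ≡ ∑ (arcs x σ) f
∑-arcs x [] f = refl
∑-arcs x (v ∷ σ) f = trans (cong (λ xs → ∑ xs (λ i → f (x + i , at (v ∷ σ) i))) (oneTo-suc (length σ)))
  (cong₂ _+_ (cong (λ k → f (k , v)) (+-comm x 1))
    (trans (∑-map suc (oneTo (length σ)) _) (trans (∑-cong (oneTo (length σ)) step) (∑-arcs (suc x) σ f))))
  where
  step : ∀ {i} → i ∈ oneTo (length σ) → f (x + suc i , at (v ∷ σ) (suc i)) ≡ f (suc x + i , at σ i)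
  step {zero} i∈ = contradiction (proj₁ (∈-oneTo⁻ i∈)) λ ()
  step {suc i} i∈ = cong (λ k → f (k , at σ (suc i))) (+-suc x (suc i))

arcs-++ : ∀ x σ τ → arcs x (σ ++ τ) ≡ arcs x σ ++ arcs (x + length σ) τ
arcs-++ x [] τ = cong (λ k → arcs k τ) (sym (+-identityʳ x))
arcs-++ x (v ∷ σ) τ = cong ((suc x , v) ∷_) (trans (arcs-++ (suc x) σ τ) (cong (λ k → arcs (suc x) σ ++ arcs k τ) (sym (+-suc x (length σ)))))

arcs-∈ : ∀ x σ {i v} → (i , v) ∈ arcs x σ → x < i × i ≤ x + length σ × v ∈ σ
arcs-∈ x (v ∷ σ) (here refl) = ≤-refl , ≤-trans (≤-reflexive (+-comm 1 x)) (+-monoʳ-≤ x (s≤s z≤n)) , here refl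
arcs-∈ x (v ∷ σ) (there p) with arcs-∈ (suc x) σ p
... | a , b , c = <⇒≤ a , ≤-trans b (≤-reflexive (sym (+-suc x (length σ)))) , there c

∑-arcs-value : ∀ x σ f → ∑ (arcs x σ) (f ∘ proj₂) ≡ ∑ σ f
∑-arcs-value x [] f = refl
∑-arcs-value x (v ∷ σ) f = cong (f v +_) (∑-arcs-value (suc x) σ f)

∑-arcs-position : ∀ x σ f → ∑ (arcs x σ) (f ∘ proj₁) ≡ ∑range f (suc x) (length σ)
∑-arcs-position x [] f = refl
∑-arcs-position x (v ∷ σ) f = cong (f (suc x) +_) (∑-arcs-position (suc x) σ f)

crossings : List (ℕ × ℕ) → List (ℕ × ℕ) → ℕ
crossings E F = ∑ E λ (i , v) → ∑ F λ (j , w) → χ (cross? i v j w)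

crs-arcs : ∀ σ → crs σ ≡ crossings (arcs 0 σ) (arcs 0 σ)
crs-arcs σ = trans (crs-∑ σ) (trans (∑-cong (oneTo (length σ)) λ {i} _ → ∑-arcs 0 σ (λ (j , w) → χ (cross? i (at σ i) j w)))
  (∑-arcs 0 σ (λ (i , v) → ∑ (arcs 0 σ) λ (j , w) → χ (cross? i v j w))))

crossings-++ʳ : ∀ E F G → crossings E (F ++ G) ≡ crossings E F + crossings E G
crossings-++ʳ E F G = trans (∑-cong E λ {e} _ → ∑-++ F G _) (∑-+ E _ _)

crossings-++ˡ : ∀ E F G → crossings (E ++ F) G ≡ crossings E G + crossings F G
crossings-++ˡ E F G = ∑-++ E F _

-- Both kinds of crossing are noninversions: positions and values increase together. Hence the block
-- of `γ`, which lies above and to the left of the rest, has no crossings with it.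
crossings-0 : ∀ E F → (∀ {i v j w} → (i , v) ∈ E → (j , w) ∈ F → ¬ (i < j × v < w)) → crossings E F ≡ 0
crossings-0 E F h = ∑-0 E λ {(i , v)} e∈ → ∑-0 F λ {(j , w)} f∈ → χ-no (cross? i v j w)
  λ { (inj₁ (a , _ , b)) → h e∈ f∈ (a , b) ; (inj₂ (a , _ , b)) → h e∈ f∈ (b , a) }

crossings-disjoint : ∀ E F → crossings E F ≡ 0 → crossings F E ≡ 0 → crossings (E ++ F) (E ++ F) ≡ crossings E E + crossings F F
crossings-disjoint E F ef fe rewrite crossings-++ˡ E F (E ++ F) | crossings-++ʳ E E F | crossings-++ʳ F E F | ef | fe | +-identityʳ (crossings E E) = refl

∑range-split : ∀ f t m k → ∑range f t (m + k) ≡ ∑range f t m + ∑range f (t + m) k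
∑range-split f t zero k rewrite +-identityʳ t = refl
∑range-split f t (suc m) k rewrite ∑range-split f (suc t) m k | +-suc t m = sym (+-assoc (f t) _ _)

∑-arrange : ∀ t y f → ∑ (arrange t y) f ≡ ∑range f (suc y) (size t)
∑-arrange leaf y f = refl
∑-arrange (node α γ) y f = begin
  ∑ (arrange γ m ++ arrange α y ++ m ∷ []) f ≡⟨ ∑-++ (arrange γ m) _ f ⟩
  ∑ (arrange γ m) f + ∑ (arrange α y ++ m ∷ []) f ≡⟨ cong (∑ (arrange γ m) f +_) (∑-++ (arrange α y) (m ∷ []) f) ⟩
  ∑ (arrange γ m) f + (∑ (arrange α y) f + (f m + 0)) ≡⟨ cong₂ _+_ (∑-arrange γ m f) (cong₂ _+_ (∑-arrange α y f) refl) ⟩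
  ∑range f (suc m) (size γ) + (∑range f (suc y) (size α) + (f m + 0)) ≡⟨ shuffle (∑range f (suc m) (size γ)) (∑range f (suc y) (size α)) (f m) ⟩
  ∑range f (suc y) (size α) + (f m + ∑range f (suc m) (size γ)) ≡⟨ cong (λ k → ∑range f (suc y) (size α) + (f k + ∑range f (suc k) (size γ))) (+-suc y (size α)) ⟩
  ∑range f (suc y) (size α) + ∑range f (suc y + size α) (suc (size γ)) ≡⟨ sym (∑range-split f (suc y) (size α) (suc (size γ))) ⟩
  ∑range f (suc y) (size α + suc (size γ)) ≡⟨ cong (∑range f (suc y)) (+-suc (size α) (size γ)) ⟩
  ∑range f (suc y) (suc (size α + size γ)) ∎
  where
  open ≡-Reasoning
  m = y + suc (size α)
  shuffle : ∀ g a b → g + (a + (b + 0)) ≡ a + (b + g)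
  shuffle = solve 3 (λ g a b → g :+ (a :+ (b :+ con 0)) := a :+ (b :+ g)) refl where open +-*-Solver

count-above : ∀ b y a → ∑range (λ v → χ (b <? v)) (suc y) a ≡ a ∸ (b ∸ y)
count-above b y zero = sym (0∸n≡0 (b ∸ y))
count-above b y (suc a) with b <? suc y
... | yes (s≤s b≤y) rewrite χ-yes (b <? suc y) (s≤s b≤y) | count-above b (suc y) a | m≤n⇒m∸n≡0 b≤y | m≤n⇒m∸n≡0 (m≤n⇒m≤1+n b≤y) = refl
... | no b≮ rewrite χ-no (b <? suc y) b≮ | count-above b (suc y) a = cong (suc a ∸_) (suc-∸ (≮⇒≥ b≮))
  where
  suc-∸ : ∀ {b y} → suc y ≤ b → suc (b ∸ suc y) ≡ b ∸ y
  suc-∸ {suc b} {y} (s≤s y≤b) = sym (+-∸-assoc 1 y≤b)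

module _ (α : Tree) (X y : ℕ) where
  private
    a = size α
    I = X + suc a
    V = y + suc a

  -- The entries of α lie directly below and to the left of the root (I , V), so every one of them with
  -- value > I or position ≥ V crosses it.
  crossings-root : crossings (arcs X (arrange α y)) ((I , V) ∷ []) ≡ (a ∸ (I ∸ y)) + (a ∸ ((y + a) ∸ X))
  crossings-root = begin
    crossings E ((I , V) ∷ []) ≡⟨ ∑-cong E (λ {(i , v)} e∈ → trans (+-identityʳ _) (χ-⊎ (cross? i v I V) (I <? v) (V ≤? i)
        (λ { (inj₁ (_ , b , _)) → inj₁ b ; (inj₂ (_ , b , _)) → inj₂ b })
        (λ b → inj₁ (i<I e∈ , b , v<V e∈)) (λ b → inj₂ (v<V e∈ , b , i<I e∈))
        λ (b , c) → <⇒≱ (<-trans b (v<V e∈)) (≤-trans c (<⇒≤ (i<I e∈))))) ⟩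
    ∑ E (λ (i , v) → χ (I <? v) + χ (V ≤? i)) ≡⟨ ∑-+ E _ _ ⟩
    ∑ E (λ (i , v) → χ (I <? v)) + ∑ E (λ (i , v) → χ (V ≤? i)) ≡⟨ cong₂ _+_ (trans (∑-arcs-value X (arrange α y) _) (∑-arrange α y _)) (∑-arcs-position X (arrange α y) _) ⟩
    ∑range (λ v → χ (I <? v)) (suc y) a + ∑range (λ i → χ (V ≤? i)) (suc X) (length (arrange α y)) ≡⟨ cong₂ _+_ (count-above I y a)
        (trans (cong₂ (λ b l → ∑range (λ i → χ (b ≤? i)) (suc X) l) (+-suc y a) (length-arrange α y)) (count-above (y + a) X a)) ⟩
    (a ∸ (I ∸ y)) + (a ∸ ((y + a) ∸ X)) ∎
    where
    open ≡-Reasoning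
    E = arcs X (arrange α y)
    i<I : ∀ {i v} → (i , v) ∈ E → i < I
    i<I e∈ = ≤-<-trans (proj₁ (proj₂ (arcs-∈ X (arrange α y) e∈))) (+-monoʳ-< X (s≤s (≤-reflexive (length-arrange α y))))
    v<V : ∀ {i v} → (i , v) ∈ E → v < V
    v<V e∈ = ≤-<-trans (proj₂ (arrange-range α y (proj₂ (proj₂ (arcs-∈ X (arrange α y) e∈))))) (+-monoʳ-< y ≤-refl)

-- Each node contributes | |C - l| - |C - r| |, where l < r are the positions of its two parentheses
-- when the parenthesis word of t starts right after position o.
spread : ℕ → Tree → ℕ → ℕ
spread C leaf o = 0
spread C (node α γ) o =
  ∣ ∣ C - suc o ∣ - ∣ C - (o + suc (suc (size α + size α))) ∣ ∣ + (spread C α (suc o) + spread C γ (o + suc (suc (size α + size α))))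

dist-shift : ∀ {c y l z} → c + y ≡ l + z → ∣ c - l ∣ ≡ ∣ z - y ∣
dist-shift {c} {y} {l} {z} e = begin
  ∣ c - l ∣ ≡⟨ sym (∣m+n-m+o∣≡∣n-o∣ y c l) ⟩
  ∣ y + c - y + l ∣ ≡⟨ cong₂ ∣_-_∣ (+-comm y c) (+-comm y l) ⟩
  ∣ c + y - l + y ∣ ≡⟨ cong (λ k → ∣ k - l + y ∣) e ⟩
  ∣ l + z - l + y ∣ ≡⟨ ∣m+n-m+o∣≡∣n-o∣ l z y ⟩
  ∣ z - y ∣ ∎
  where open ≡-Reasoning

∣-∣-≥ : ∀ m k → ∣ m + k - m ∣ ≡ k
∣-∣-≥ m k = trans (∣-∣-comm (m + k) m) (∣m-m+n∣≡n m k)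

-- `a ∸ (a ∸ e)` is min(a, e), so this is 2 min(a, e) + 1 = (e + a + 1) - |e - a|.
min-spread : ∀ a e → suc ((a ∸ (a ∸ e)) + (a ∸ (a ∸ e))) ≡ ∣ e + suc a - ∣ e - a ∣ ∣
min-spread a e with ≤-total e a
... | inj₁ e≤a with m≤n⇒∃[o]m+o≡n e≤a
... | f , refl rewrite m+n∸m≡n e f | m+n∸n≡m e f | ∣m-m+n∣≡n e f =
  sym (trans (cong (λ k → ∣ k - f ∣) (reorder e f)) (∣-∣-≥ f (suc (e + e))))
  where
  reorder : ∀ e f → e + suc (e + f) ≡ f + suc (e + e)
  reorder = solve 2 (λ e f → e :+ (con 1 :+ (e :+ f)) := f :+ (con 1 :+ (e :+ e))) refl where open +-*-Solver
min-spread a e | inj₂ a≤e with m≤n⇒∃[o]m+o≡n a≤e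
... | f , refl rewrite m≤n⇒m∸n≡0 a≤e | ∣-∣-≥ a f =
  sym (trans (cong (λ k → ∣ k - f ∣) (reorder a f)) (∣-∣-≥ f (suc (a + a))))
  where
  reorder : ∀ a f → a + f + suc a ≡ f + suc (a + a)
  reorder = solve 2 (λ a f → a :+ f :+ (con 1 :+ a) := f :+ (con 1 :+ (a :+ a))) refl where open +-*-Solver

root-count : ℕ → ℕ → ℕ → ℕ
root-count a X y = (a ∸ ((X + suc a) ∸ y)) + (a ∸ ((y + a) ∸ X))

-- At most one summand of `root-count` is nonzero: the second if y ≤ X, the first if X < y. That one
-- equals min(a, e), with e = X - y in the former case and e = y - X - 1 in the latter.
spread-node : ∀ a X y → suc (root-count a X y + root-count a X y) ≡ ∣ ∣ X + suc a - y ∣ - ∣ X - (y + a) ∣ ∣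
spread-node a X y with ≤-total y X
spread-node a X y | inj₁ y≤X with m≤n⇒∃[o]m+o≡n y≤X
... | e , refl rewrite +-assoc y e (suc a) | m+n∸m≡n y (e + suc a) | [m+n]∸[m+o]≡n∸o y a e | ∣-∣-≥ y (e + suc a)
                     | ∣m+n-m+o∣≡∣n-o∣ y e a | m≤n⇒m∸n≡0 (≤-trans (n≤1+n a) (m≤n+m (suc a) e)) = min-spread a e
spread-node a X y | inj₂ X≤y with m≤n⇒∃[o]m+o≡n X≤y
... | zero , refl rewrite +-identityʳ X | m+n∸m≡n X (suc a) | m+n∸m≡n X a | ∣-∣-≥ X (suc a) | ∣m-m+n∣≡n X a
                        | n∸n≡0 a | m≤n⇒m∸n≡0 (n≤1+n a) = sym (trans (cong (λ k → ∣ k - a ∣) (+-comm 1 a)) (∣-∣-≥ a 1))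
... | suc e , refl rewrite [m+n]∸[m+o]≡n∸o X (suc a) (suc e) | +-assoc X (suc e) a | m+n∸m≡n X (suc e + a) | ∣m+n-m+o∣≡∣n-o∣ X (suc a) (suc e)
                         | ∣m-m+n∣≡n X (suc (e + a)) | m≤n⇒m∸n≡0 (≤-trans (m≤n+m a e) (n≤1+n _)) | +-identityʳ (a ∸ (a ∸ e)) =
  trans (min-spread a e) (trans (∣-∣-comm (e + suc a) ∣ e - a ∣) (cong₂ ∣_-_∣ (∣-∣-comm e a) (+-suc e a)))

-- The hypothesis ties the centre to the place of the block: `x` positions precede it, `y` values
-- lie below it, and `o` letters precede its word. It makes the distances of the root's parentheses
-- from `C` functions of `x`, `y` and the subtree sizes, and it passes on to both subtrees. The
-- summand `size t` collects the 1 in each odd term of `spread`.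
crossings-spread : ∀ C t x y o → C + y ≡ suc (o + size t + x) → let E = arcs x (arrange t y) in
  crossings E E + crossings E E + size t ≡ spread C t o
crossings-spread C leaf x y o e = refl
crossings-spread C (node α γ) x y o e = begin
  crossings E E + crossings E E + suc (a + g) ≡⟨ cong (λ k → k + k + suc (a + g)) total ⟩
  (Kγ + (Kα + Kρ)) + (Kγ + (Kα + Kρ)) + suc (a + g) ≡⟨ regroup Kγ Kα Kρ a g ⟩
  suc (Kρ + Kρ) + ((Kα + Kα + a) + (Kγ + Kγ + g)) ≡⟨ cong₂ _+_ (trans (spread-node a X y) (cong₂ (λ p q → ∣ p - q ∣) (sym dist-l) (sym dist-r)))
      (cong₂ _+_ (crossings-spread C α X y (suc o) (trans e eα)) (crossings-spread C γ x m (o + suc (suc (a + a))) eγ)) ⟩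
  spread C (node α γ) o ∎
  where
  open ≡-Reasoning
  a = size α
  g = size γ
  X = x + g
  m = y + suc a
  E = arcs x (arrange (node α γ) y)
  Eγ = arcs x (arrange γ m)
  Eα = arcs X (arrange α y)
  r = (X + suc a , m)
  Kγ = crossings Eγ Eγ
  Kα = crossings Eα Eα
  Kρ = root-count a X y
  E≡ : E ≡ Eγ ++ (Eα ++ r ∷ [])
  E≡ = trans (arcs-++ x (arrange γ m) _) (cong (Eγ ++_) (trans (cong (λ k → arcs (x + k) (arrange α y ++ m ∷ [])) (length-arrange γ m))
    (trans (arcs-++ X (arrange α y) (m ∷ [])) (cong (λ k → Eα ++ (k , m) ∷ []) (trans (cong (λ k → suc (X + k)) (length-arrange α y)) (sym (+-suc X a)))))))
  γ-info : ∀ {i v} → (i , v) ∈ Eγ → i ≤ X × m < v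
  γ-info e∈ = let (_ , b , c) = arcs-∈ x (arrange γ m) e∈ in ≤-trans b (≤-reflexive (cong (x +_) (length-arrange γ m))) , proj₁ (arrange-range γ m c)
  α-info : ∀ {i v} → (i , v) ∈ Eα → X < i × i < X + suc a × v < m
  α-info e∈ = let (b , c , d) = arcs-∈ X (arrange α y) e∈ in
    b , ≤-<-trans c (+-monoʳ-< X (s≤s (≤-reflexive (length-arrange α y)))) , ≤-<-trans (proj₂ (arrange-range α y d)) (+-monoʳ-< y ≤-refl)
  rest-info : ∀ {i v} → (i , v) ∈ Eα ++ r ∷ [] → X < i × v ≤ m
  rest-info e∈ with ∈-++⁻ Eα e∈
  ... | inj₁ p = let (b , _ , c) = α-info p in b , <⇒≤ c
  ... | inj₂ (here refl) = m<m+n X (s≤s z≤n) , ≤-refl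
  total : crossings E E ≡ Kγ + (Kα + Kρ)
  total = begin
    crossings E E ≡⟨ cong (λ F → crossings F F) E≡ ⟩
    crossings (Eγ ++ (Eα ++ r ∷ [])) (Eγ ++ (Eα ++ r ∷ [])) ≡⟨ crossings-disjoint Eγ (Eα ++ r ∷ [])
       (crossings-0 Eγ (Eα ++ r ∷ []) λ p q (_ , v<w) → <-asym (<-≤-trans v<w (proj₂ (rest-info q))) (proj₂ (γ-info p)))
       (crossings-0 (Eα ++ r ∷ []) Eγ λ p q (i<j , _) → <-asym (<-≤-trans i<j (proj₁ (γ-info q))) (proj₁ (rest-info p))) ⟩
    Kγ + crossings (Eα ++ r ∷ []) (Eα ++ r ∷ []) ≡⟨ cong (Kγ +_) (begin
      crossings (Eα ++ r ∷ []) (Eα ++ r ∷ []) ≡⟨ crossings-++ˡ Eα (r ∷ []) (Eα ++ r ∷ []) ⟩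
      crossings Eα (Eα ++ r ∷ []) + crossings (r ∷ []) (Eα ++ r ∷ []) ≡⟨ cong₂ _+_ (crossings-++ʳ Eα Eα (r ∷ []))
         (crossings-0 (r ∷ []) (Eα ++ r ∷ []) λ { (here refl) q (i<j , v<w) → <⇒≱ v<w (proj₂ (rest-info q)) }) ⟩
      Kα + crossings Eα (r ∷ []) + 0 ≡⟨ +-identityʳ _ ⟩
      Kα + crossings Eα (r ∷ []) ≡⟨ cong (Kα +_) (crossings-root α X y) ⟩
      Kα + Kρ ∎) ⟩
    Kγ + (Kα + Kρ) ∎
  regroup : ∀ Kγ Kα Kρ a g → (Kγ + (Kα + Kρ)) + (Kγ + (Kα + Kρ)) + suc (a + g) ≡ suc (Kρ + Kρ) + ((Kα + Kα + a) + (Kγ + Kγ + g))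
  regroup = solve 5 (λ Kγ Kα Kρ a g → (Kγ :+ (Kα :+ Kρ)) :+ (Kγ :+ (Kα :+ Kρ)) :+ (con 1 :+ (a :+ g)) := (con 1 :+ (Kρ :+ Kρ)) :+ ((Kα :+ Kα :+ a) :+ (Kγ :+ Kγ :+ g))) refl
    where open +-*-Solver
  eα : suc (o + suc (a + g) + x) ≡ suc (suc o + a + X)
  eα = solve 4 (λ o a g x → con 1 :+ (o :+ (con 1 :+ (a :+ g)) :+ x) := con 1 :+ (con 1 :+ o :+ a :+ (x :+ g))) refl o a g x
    where open +-*-Solver
  eγ : C + m ≡ suc (o + suc (suc (a + a)) + g + x)
  eγ = trans (sym (+-assoc C y (suc a))) (trans (cong (_+ suc a) e)
    (solve 4 (λ o a g x → con 1 :+ (o :+ (con 1 :+ (a :+ g)) :+ x) :+ (con 1 :+ a) := con 1 :+ (o :+ (con 2 :+ (a :+ a)) :+ g :+ x)) refl o a g x))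
    where open +-*-Solver
  dist-l : ∣ C - suc o ∣ ≡ ∣ X + suc a - y ∣
  dist-l = dist-shift {C} {y} {suc o} (trans e (solve 4 (λ o a g x → con 1 :+ (o :+ (con 1 :+ (a :+ g)) :+ x) := con 1 :+ o :+ (x :+ g :+ (con 1 :+ a))) refl o a g x))
    where open +-*-Solver
  dist-r : ∣ C - (o + suc (suc (a + a))) ∣ ≡ ∣ X - (y + a) ∣
  dist-r = dist-shift {C} {y + a} {o + suc (suc (a + a))} (trans (sym (+-assoc C y a)) (trans (cong (_+ a) e)
    (solve 4 (λ o a g x → con 1 :+ (o :+ (con 1 :+ (a :+ g)) :+ x) :+ a := o :+ (con 2 :+ (a :+ a)) :+ (x :+ g)) refl o a g x)))
    where open +-*-Solver

crs-spread : ∀ t → crs (arrange t 0) + crs (arrange t 0) + size t ≡ spread (suc (size t)) t 0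
crs-spread t rewrite crs-arcs (arrange t 0) = crossings-spread (suc (size t)) t 0 0 0 (cong suc (trans (+-identityʳ (size t)) (sym (+-identityʳ (size t)))))

-- Parenthesis words and bicoloured Motzkin paths

data Letter : Set where
  U D : Letter

-- The state (p , m) stands for the reduced word DᵖUᵐ: matched pairs U…D cancel.
State : Set
State = ℕ × ℕ

∥_∥ : State → ℕ
∥ p , m ∥ = p + m

addˡ addʳ : Letter → State → State
addˡ D (p , m)     = suc p , m
addˡ U (suc p , m) = p , m
addˡ U (zero , m)  = zero , suc m
addʳ U (p , m)     = p , suc m
addʳ D (p , suc m) = p , m
addʳ D (p , zero)  = suc p , zero

reduceOn : State → List Letter → State
reduceOn = foldr addˡ

reduce : List Letter → State
reduce = reduceOn (0 , 0)

-- Associativity of cancellation. The delicate case is a U and a D around the empty word: whichever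
-- comes first, the other cancels it.
addˡ-addʳ : ∀ ℓ r s → addˡ ℓ (addʳ r s) ≡ addʳ r (addˡ ℓ s)
addˡ-addʳ D U (p , m) = refl
addˡ-addʳ D D (p , zero) = refl
addˡ-addʳ D D (p , suc m) = refl
addˡ-addʳ U U (zero , m) = refl
addˡ-addʳ U U (suc p , m) = refl
addˡ-addʳ U D (zero , zero) = refl
addˡ-addʳ U D (zero , suc m) = refl
addˡ-addʳ U D (suc p , zero) = refl
addˡ-addʳ U D (suc p , suc m) = refl

reduce-∷ʳ : ∀ w r → reduce (w ++ r ∷ []) ≡ addʳ r (reduce w)
reduce-∷ʳ [] U = refl
reduce-∷ʳ [] D = refl
reduce-∷ʳ (ℓ ∷ w) r = trans (cong (addˡ ℓ) (reduce-∷ʳ w r)) (addˡ-addʳ ℓ r (reduce w))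

word : Tree → List Letter
word leaf = []
word (node α γ) = U ∷ word α ++ D ∷ word γ

length-word : ∀ t → length (word t) ≡ size t + size t
length-word leaf = refl
length-word (node α γ) = cong suc (begin
  length (word α ++ D ∷ word γ) ≡⟨ length-++ (word α) ⟩
  length (word α) + suc (length (word γ)) ≡⟨ cong₂ (λ a g → a + suc g) (length-word α) (length-word γ) ⟩
  size α + size α + suc (size γ + size γ) ≡⟨ arith (size α) (size γ) ⟩
  size α + size γ + suc (size α + size γ) ∎)
  where
  open ≡-Reasoning
  arith : ∀ a g → a + a + suc (g + g) ≡ a + g + suc (a + g)
  arith = solve 2 (λ a g → a :+ a :+ (con 1 :+ (g :+ g)) := a :+ g :+ (con 1 :+ (a :+ g))) refl where open +-*-Solver

reduceOn-word : ∀ t s w → reduceOn s (word t ++ w) ≡ reduceOn s w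
reduceOn-word leaf s w = refl
reduceOn-word (node α γ) s w rewrite ++-assoc (word α) (D ∷ word γ) w | reduceOn-word α s (D ∷ word γ ++ w) | reduceOn-word γ s w = refl

reduce-word : ∀ t → reduce (word t) ≡ (0 , 0)
reduce-word t = trans (cong reduce (sym (++-identityʳ (word t)))) (reduceOn-word t (0 , 0) [])

-- The words that reduce to Dᵖ: p unmatched letters D separate p + 1 balanced words. The induction
-- on letters in `forest` needs all p, since removing a leading U unmatches a D.
data Forest : ℕ → List Letter → Set where
  single : ∀ t → Forest 0 (word t)
  cons   : ∀ {p w} t → Forest p w → Forest (suc p) (word t ++ D ∷ w)

graft : ∀ {p w} t → Forest p w → Forest p (U ∷ word t ++ D ∷ w)
graft t (single t') = single (node t t')
graft t (cons {w = w} t' F) = subst (Forest _) (cong (U ∷_) (++-assoc (word t) (D ∷ word t') (D ∷ w))) (cons (node t t') F)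

forest : ∀ w {p} → reduce w ≡ (p , 0) → Forest p w
forest [] refl = single leaf
forest (D ∷ w) e with reduce w in eq
forest (D ∷ w) refl | p , zero = cons leaf (forest w eq)
forest (U ∷ w) e with reduce w in eq
forest (U ∷ w) refl | suc p , zero with forest w eq
... | cons t F = graft t F
forest (U ∷ w) () | zero , m

word-covers : ∀ {w} → reduce w ≡ (0 , 0) → ∃ λ t → word t ≡ w
word-covers {w} e with forest w e
... | single t = t , refl

data NoLeadingU : List Letter → Set where
  []  : NoLeadingU []
  D∷_ : ∀ w → NoLeadingU (D ∷ w)

-- The letter following the word of a tree is never U, so a U announces a node and anything else a
-- leaf.
word-++-injective : ∀ t t' {z z'} → NoLeadingU z → NoLeadingU z' → word t ++ z ≡ word t' ++ z' → t ≡ t' × z ≡ z'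
word-++-injective leaf leaf _ _ e = refl , e
word-++-injective leaf (node _ _) [] _ ()
word-++-injective leaf (node _ _) (D∷ _) _ ()
word-++-injective (node _ _) leaf _ [] ()
word-++-injective (node _ _) leaf _ (D∷ _) ()
word-++-injective (node α γ) (node α' γ') {z} {z'} n n' e
  with word-++-injective α α' (D∷ _) (D∷ _) (trans (sym (++-assoc (word α) (D ∷ word γ) z)) (trans (∷-injectiveʳ e) (++-assoc (word α') (D ∷ word γ') z')))
... | refl , e' with word-++-injective γ γ' n n' (∷-injectiveʳ e')
... | refl , e'' = refl , e''

word-injective : ∀ t t' → word t ≡ word t' → t ≡ t'
word-injective t t' e = proj₁ (word-++-injective t t' [] [] (trans (++-identityʳ (word t)) (trans e (sym (++-identityʳ (word t'))))))

-- A word of odd length, given by its middle letter and the pairs of letters at equal distance from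
-- it, outermost pair first.
central : Letter → List (Letter × Letter) → List Letter
central c [] = c ∷ []
central c ((ℓ , r) ∷ ps) = ℓ ∷ central c ps ++ r ∷ []

state : Letter → List (Letter × Letter) → State
state c ps = reduce (central c ps)

state-∷ : ∀ c ℓ r ps → state c ((ℓ , r) ∷ ps) ≡ addʳ r (addˡ ℓ (state c ps))
state-∷ c ℓ r ps = trans (cong (addˡ ℓ) (reduce-∷ʳ (central c ps) r)) (addˡ-addʳ ℓ r (state c ps))

length-central : ∀ c ps → length (central c ps) ≡ suc (length ps + length ps)
length-central c [] = refl
length-central c ((ℓ , r) ∷ ps) = cong suc (trans (length-++ (central c ps)) (trans (+-comm _ 1)
  (cong suc (trans (length-central c ps) (sym (+-suc (length ps) (length ps)))))))

central-covers : ∀ n w → length w ≡ suc (n + n) → ∃₂ λ c ps → length ps ≡ n × central c ps ≡ w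
central-covers zero (c ∷ []) _ = c , [] , refl , refl
central-covers (suc n) (ℓ ∷ x ∷ w) e with snoc x w
... | w' , r , eq with central-covers n w' (suc-injective (begin
        suc (length w') ≡⟨ +-comm 1 (length w') ⟩
        length w' + 1 ≡⟨ sym (length-++ w') ⟩
        length (w' ++ r ∷ []) ≡⟨ cong length (sym eq) ⟩
        suc (length w) ≡⟨ suc-injective e ⟩
        suc (n + suc n) ≡⟨ cong suc (+-suc n n) ⟩
        suc (suc (n + n)) ∎))
  where open ≡-Reasoning
... | c , ps , l , refl = c , (ℓ , r) ∷ ps , cong suc l , cong (ℓ ∷_) (sym eq)

central-injective : ∀ c c' ps ps' → central c ps ≡ central c' ps' → c ≡ c' × ps ≡ ps'
central-injective c c' [] [] refl = refl , refl
central-injective c c' [] ((ℓ , r) ∷ ps') e with central c' ps'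
... | [] = case e of λ ()
... | _ ∷ _ = case e of λ ()
central-injective c c' ((ℓ , r) ∷ ps) [] e with central c ps
... | [] = case e of λ ()
... | _ ∷ _ = case e of λ ()
central-injective c c' ((ℓ , r) ∷ ps) ((ℓ' , r') ∷ ps') e with ∷-injective e
... | refl , e' with ∷ʳ-injective (central c ps) (central c' ps') e'
... | e'' , refl with central-injective c c' ps ps' e''
... | refl , refl = refl , refl

lengthensˡ shortensʳ : Letter → State → Bool
lengthensˡ D _           = true
lengthensˡ U (zero , _)  = true
lengthensˡ U (suc _ , _) = false
shortensʳ U _           = false
shortensʳ D (_ , zero)  = false
shortensʳ D (_ , suc _) = true

-- The second bit says that the left letter lengthens, the first that the right letter shortens.
-- With these opposite conventions the reduced length grows outwards by twice the second bit minus
-- the first. Read inwards, from the whole word to its middle letter, this is the step convention of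
-- `Path`.
bits : Letter → List (Letter × Letter) → List Step
bits c [] = []
bits c ((ℓ , r) ∷ ps) = (shortensʳ r (addˡ ℓ (state c ps)) , lengthensˡ ℓ (state c ps)) ∷ bits c ps

∥addˡ∥ : ∀ ℓ s → (lengthensˡ ℓ s ≡ true × ∥ addˡ ℓ s ∥ ≡ suc ∥ s ∥) ⊎ (lengthensˡ ℓ s ≡ false × suc ∥ addˡ ℓ s ∥ ≡ ∥ s ∥)
∥addˡ∥ D (p , m) = inj₁ (refl , refl)
∥addˡ∥ U (zero , m) = inj₁ (refl , refl)
∥addˡ∥ U (suc p , m) = inj₂ (refl , refl)

∥addʳ∥ : ∀ r s → (shortensʳ r s ≡ false × ∥ addʳ r s ∥ ≡ suc ∥ s ∥) ⊎ (shortensʳ r s ≡ true × suc ∥ addʳ r s ∥ ≡ ∥ s ∥)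
∥addʳ∥ U (p , m) = inj₁ (refl , +-suc p m)
∥addʳ∥ D (p , zero) = inj₁ (refl , refl)
∥addʳ∥ D (p , suc m) = inj₂ (refl , sym (+-suc p m))

lengths : Letter → List (Letter × Letter) → ℕ
lengths c [] = ∥ state c [] ∥
lengths c (q ∷ ps) = ∥ state c (q ∷ ps) ∥ + lengths c ps

bits-path : ∀ c ps → ∃₂ λ k s → ∥ state c ps ∥ ≡ suc (k + k) × Path k (bits c ps) s × lengths c ps ≡ s + s + suc (length ps)
bits-path D [] = 0 , 0 , refl , [] , refl
bits-path U [] = 0 , 0 , refl , [] , refl
bits-path c ((ℓ , r) ∷ ps) with bits-path c ps
... | k , s , e , P , W = step (∥addˡ∥ ℓ (state c ps)) (∥addʳ∥ r (addˡ ℓ (state c ps)))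
  where
  inner = state c ps
  outer = state c ((ℓ , r) ∷ ps)
  weight : ∀ j → ∥ outer ∥ ≡ suc (j + j) → lengths c ((ℓ , r) ∷ ps) ≡ (j + s) + (j + s) + suc (suc (length ps))
  weight j e' = trans (cong₂ _+_ e' W) (arith j s (length ps))
    where
    arith : ∀ j s l → suc (j + j) + (s + s + suc l) ≡ (j + s) + (j + s) + suc (suc l)
    arith = solve 3 (λ j s l → con 1 :+ (j :+ j) :+ (s :+ s :+ (con 1 :+ l)) := (j :+ s) :+ (j :+ s) :+ (con 2 :+ l)) refl where open +-*-Solver
  conclude : ∀ j {b a} → shortensʳ r (addˡ ℓ inner) ≡ b → lengthensˡ ℓ inner ≡ a → ∥ outer ∥ ≡ suc (j + j) → Path j ((b , a) ∷ bits c ps) (j + s) →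
    ∃₂ λ k s → ∥ outer ∥ ≡ suc (k + k) × Path k (bits c ((ℓ , r) ∷ ps)) s × lengths c ((ℓ , r) ∷ ps) ≡ s + s + suc (suc (length ps))
  conclude j refl refl e' P' = j , j + s , e' , P' , weight j e'
  outer≡ : ∥ outer ∥ ≡ ∥ addʳ r (addˡ ℓ inner) ∥
  outer≡ = cong ∥_∥ (state-∷ c ℓ r ps)
  2+ : ∀ k → suc (suc (k + k)) ≡ suc k + suc k
  2+ k = cong suc (sym (+-suc k k))
  step : _ → _ → ∃₂ λ k s → ∥ outer ∥ ≡ suc (k + k) × Path k (bits c ((ℓ , r) ∷ ps)) s × lengths c ((ℓ , r) ∷ ps) ≡ s + s + suc (suc (length ps))
  step (inj₁ (a , x)) (inj₁ (b , y)) = conclude (suc k) b a (trans outer≡ (trans y (cong suc (trans x (trans (cong suc e) (2+ k)))))) (down P)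
  step (inj₁ (a , x)) (inj₂ (b , y)) = conclude k b a (trans outer≡ (suc-injective (trans y (trans x (cong suc e))))) (level₁ P)
  step (inj₂ (a , x)) (inj₁ (b , y)) = conclude k b a (trans outer≡ (trans y (trans x e))) (level₀ P)
  -- Both letters shorten, so the inner reduced length is at least 2 and, being odd, at least 3.
  -- This excludes `k = 0`, and the path rises inwards.
  step (inj₂ (a , x)) (inj₂ (b , y)) = fall k (suc-injective (trans x e)) P
    where
    fall : ∀ k → ∥ addˡ ℓ inner ∥ ≡ k + k → Path k (bits c ps) s →
      ∃₂ λ k s → ∥ outer ∥ ≡ suc (k + k) × Path k (bits c ((ℓ , r) ∷ ps)) s × lengths c ((ℓ , r) ∷ ps) ≡ s + s + suc (suc (length ps))
    fall zero z _ = contradiction (trans y z) λ ()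
    fall (suc j) z P' = conclude j b a (trans outer≡ (suc-injective (trans y (trans z (sym (2+ j)))))) (up P')

-- A letter that lengthened the reduced word is now its first letter; a letter that shortened it can
-- only be a U that cancelled a D. Either way the letter and the old state can be read off.
addˡ-injective : ∀ ℓ ℓ' s s' → addˡ ℓ s ≡ addˡ ℓ' s' → lengthensˡ ℓ s ≡ lengthensˡ ℓ' s' → ℓ ≡ ℓ' × s ≡ s'
addˡ-injective D D (p , m) (p' , m') refl _ = refl , refl
addˡ-injective D U (p , m) (zero , m') () _
addˡ-injective D U (p , m) (suc p' , m') _ ()
addˡ-injective U D (zero , m) (p' , m') () _
addˡ-injective U D (suc p , m) (p' , m') _ ()
addˡ-injective U U (zero , m) (zero , m') refl _ = refl , refl
addˡ-injective U U (zero , m) (suc p' , m') _ ()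
addˡ-injective U U (suc p , m) (zero , m') _ ()
addˡ-injective U U (suc p , m) (suc p' , m') refl _ = refl , refl

addʳ-injective : ∀ r r' s s' → addʳ r s ≡ addʳ r' s' → shortensʳ r s ≡ shortensʳ r' s' → r ≡ r' × s ≡ s'
addʳ-injective U U (p , m) (p' , m') refl _ = refl , refl
addʳ-injective U D (p , m) (p' , zero) () _
addʳ-injective U D (p , m) (p' , suc m') _ ()
addʳ-injective D U (p , zero) (p' , m') () _
addʳ-injective D U (p , suc m) (p' , m') _ ()
addʳ-injective D D (p , zero) (p' , zero) refl _ = refl , refl
addʳ-injective D D (p , zero) (p' , suc m') _ ()
addʳ-injective D D (p , suc m) (p' , zero) _ ()
addʳ-injective D D (p , suc m) (p' , suc m') refl _ = refl , refl

bits-injective : ∀ c c' ps ps' → state c ps ≡ state c' ps' → bits c ps ≡ bits c' ps' → c ≡ c' × ps ≡ ps'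
bits-injective D D [] [] _ _ = refl , refl
bits-injective U U [] [] _ _ = refl , refl
bits-injective D U [] [] () _
bits-injective U D [] [] () _
bits-injective c c' ((ℓ , r) ∷ ps) ((ℓ' , r') ∷ ps') es eb
  with addʳ-injective r r' _ _ (trans (sym (state-∷ c ℓ r ps)) (trans es (state-∷ c' ℓ' r' ps'))) (cong proj₁ (∷-injectiveˡ eb))
... | refl , e with addˡ-injective ℓ ℓ' _ _ e (cong proj₂ (∷-injectiveˡ eb))
... | refl , e' with bits-injective c c' ps ps' e' (∷-injectiveʳ eb)
... | refl , refl = refl , refl

unaddˡ⁺ : ∀ s n → ∥ s ∥ ≡ suc n → ∃₂ λ ℓ s' → addˡ ℓ s' ≡ s × lengthensˡ ℓ s' ≡ true × ∥ s' ∥ ≡ n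
unaddˡ⁺ (suc p , m) n e = D , (p , m) , refl , refl , suc-injective e
unaddˡ⁺ (zero , suc m) n e = U , (zero , m) , refl , refl , suc-injective e

unaddˡ⁻ : ∀ s → ∃₂ λ ℓ s' → addˡ ℓ s' ≡ s × lengthensˡ ℓ s' ≡ false × ∥ s' ∥ ≡ suc ∥ s ∥
unaddˡ⁻ (p , m) = U , (suc p , m) , refl , refl , refl

unaddʳ⁺ : ∀ s n → ∥ s ∥ ≡ suc n → ∃₂ λ r s' → addʳ r s' ≡ s × shortensʳ r s' ≡ false × ∥ s' ∥ ≡ n
unaddʳ⁺ (p , suc m) n e = U , (p , m) , refl , refl , suc-injective (trans (sym (+-suc p m)) e)
unaddʳ⁺ (suc p , zero) n e = D , (p , zero) , refl , refl , suc-injective e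

unaddʳ⁻ : ∀ s → ∃₂ λ r s' → addʳ r s' ≡ s × shortensʳ r s' ≡ true × ∥ s' ∥ ≡ suc ∥ s ∥
unaddʳ⁻ (p , m) = D , (p , suc m) , refl , refl , +-suc p m

-- The letters are undone inwards, the right one before the left one. Undoing a shortening is always
-- possible; undoing a lengthening needs a nonempty reduced word, which the known length provides.
bits-surjective : ∀ {k w s} → Path k w s → ∀ S → ∥ S ∥ ≡ suc (k + k) → ∃₂ λ c ps → state c ps ≡ S × bits c ps ≡ w
bits-surjective [] (suc zero , zero) refl = D , [] , refl , refl
bits-surjective [] (zero , suc zero) refl = U , [] , refl , refl
bits-surjective {w = _ ∷ w} (up {k} P) S e with unaddʳ⁻ S
... | r , S₁ , x , b , y with unaddˡ⁻ S₁
... | ℓ , S₂ , x' , a , y' with bits-surjective P S₂ (trans y' (cong suc (trans y (cong suc (trans e (sym (+-suc k k)))))))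
... | c , ps , refl , refl = c , (ℓ , r) ∷ ps , trans (state-∷ c ℓ r ps) (trans (cong (addʳ r) x') x) , cong₂ (λ p q → (p , q) ∷ w) (trans (cong (shortensʳ r) x') b) a
bits-surjective {w = _ ∷ w} (down {k} P) S e with unaddʳ⁺ S _ e
... | r , S₁ , x , b , y with unaddˡ⁺ S₁ _ (trans y (cong suc (+-suc k k)))
... | ℓ , S₂ , x' , a , y' with bits-surjective P S₂ y'
... | c , ps , refl , refl = c , (ℓ , r) ∷ ps , trans (state-∷ c ℓ r ps) (trans (cong (addʳ r) x') x) , cong₂ (λ p q → (p , q) ∷ w) (trans (cong (shortensʳ r) x') b) a
bits-surjective {w = _ ∷ w} (level₀ P) S e with unaddʳ⁺ S _ e
... | r , S₁ , x , b , y with unaddˡ⁻ S₁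
... | ℓ , S₂ , x' , a , y' with bits-surjective P S₂ (trans y' (cong suc y))
... | c , ps , refl , refl = c , (ℓ , r) ∷ ps , trans (state-∷ c ℓ r ps) (trans (cong (addʳ r) x') x) , cong₂ (λ p q → (p , q) ∷ w) (trans (cong (shortensʳ r) x') b) a
bits-surjective {w = _ ∷ w} (level₁ P) S e with unaddʳ⁻ S
... | r , S₁ , x , b , y with unaddˡ⁺ S₁ _ y
... | ℓ , S₂ , x' , a , y' with bits-surjective P S₂ (trans y' e)
... | c , ps , refl , refl = c , (ℓ , r) ∷ ps , trans (state-∷ c ℓ r ps) (trans (cong (addʳ r) x') x) , cong₂ (λ p q → (p , q) ∷ w) (trans (cong (shortensʳ r) x') b) a

-- Reduced lengths of centred windows

Within : ℕ → ℕ → ℕ → Set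
Within lo hi x = lo ≤ x × x ≤ hi

within? : ∀ lo hi x → Dec (Within lo hi x)
within? lo hi x = (lo ≤? x) ×-dec (x ≤? hi)

-- The first letter of the word has position o + 1.
window : ℕ → ℕ → ℕ → List Letter → List Letter
window lo hi o [] = []
window lo hi o (x ∷ w) = if does (within? lo hi (suc o)) then x ∷ window lo hi (suc o) w else window lo hi (suc o) w

module _ (lo hi : ℕ) where

  window-in : ∀ o x w → Within lo hi (suc o) → window lo hi o (x ∷ w) ≡ x ∷ window lo hi (suc o) w
  window-in o x w i = cong (λ b → if b then x ∷ window lo hi (suc o) w else window lo hi (suc o) w) (dec-true (within? lo hi (suc o)) i)

  window-out : ∀ o x w → ¬ Within lo hi (suc o) → window lo hi o (x ∷ w) ≡ window lo hi (suc o) w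
  window-out o x w i = cong (λ b → if b then x ∷ window lo hi (suc o) w else window lo hi (suc o) w) (dec-false (within? lo hi (suc o)) i)

  window-++ : ∀ o u w → window lo hi o (u ++ w) ≡ window lo hi o u ++ window lo hi (o + length u) w
  window-++ o [] w = cong (λ k → window lo hi k w) (sym (+-identityʳ o))
  window-++ o (x ∷ u) w with within? lo hi (suc o)
  ... | yes i rewrite window-in o x (u ++ w) i | window-in o x u i | window-++ (suc o) u w | +-suc o (length u) = refl
  ... | no i rewrite window-out o x (u ++ w) i | window-out o x u i | window-++ (suc o) u w | +-suc o (length u) = refl

  window-all : ∀ o w → lo ≤ suc o → o + length w ≤ hi → window lo hi o w ≡ w
  window-all o [] _ _ = refl
  window-all o (x ∷ w) l h rewrite window-in o x w (l , ≤-trans (s≤s (m≤m+n o _)) (≤-trans (≤-reflexive (sym (+-suc o _))) h)) =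
    cong (x ∷_) (window-all (suc o) w (m≤n⇒m≤1+n l) (≤-trans (≤-reflexive (sym (+-suc o _))) h))

  window-none : ∀ o w → (∀ {x} → o < x → x ≤ o + length w → ¬ Within lo hi x) → window lo hi o w ≡ []
  window-none o [] h = refl
  window-none o (x ∷ w) h rewrite window-out o x w (h ≤-refl (≤-trans (s≤s (m≤m+n o _)) (≤-reflexive (sym (+-suc o _))))) =
    window-none (suc o) w λ a b → h (<⇒≤ a) (≤-trans b (≤-reflexive (sym (+-suc o _))))

  -- The nodes of which the window contains exactly one parenthesis; for them the difference of
  -- indicators is 1.
  cutCount : Tree → ℕ → ℕ
  cutCount leaf o = 0
  cutCount (node α γ) o = let r = o + suc (suc (size α + size α)) in
    ∣ χ (within? lo hi (suc o)) - χ (within? lo hi r) ∣ + (cutCount α (suc o) + cutCount γ r)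

reduceOn-D : ∀ w {p} s → reduce w ≡ (p , 0) → reduceOn s w ≡ (p + proj₁ s , proj₂ s)
reduceOn-D [] s refl = refl
reduceOn-D (D ∷ w) s e with reduce w in eq
reduceOn-D (D ∷ w) s refl | p , zero rewrite reduceOn-D w s eq = refl
reduceOn-D (U ∷ w) s e with reduce w in eq
reduceOn-D (U ∷ w) s refl | suc p , zero rewrite reduceOn-D w s eq = refl
reduceOn-D (U ∷ w) s () | zero , m

reduce-++ : ∀ u w → reduce (u ++ w) ≡ reduceOn (reduce w) u
reduce-++ [] w = refl
reduce-++ (x ∷ u) w = cong (addˡ x) (reduce-++ u w)

-- `prefix` and `suffix` strengthen the induction for `reduced`: a window reaching back to the start
-- of the word leaves no unmatched D, and one reaching its end no unmatched U. Without this the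
-- parentheses of a node might cancel letters of its subtrees.
record Cut (lo hi : ℕ) (t : Tree) (o : ℕ) (s : State) : Set where
  field
    reduced  : ∥ s ∥ ≡ cutCount lo hi t o
    prefix : lo ≤ suc o → proj₁ s ≡ 0
    suffix : o + (size t + size t) ≤ hi → proj₂ s ≡ 0
open Cut

reduce-window : ∀ lo hi t o → Cut lo hi t o (reduce (window lo hi o (word t)))
reduce-window lo hi leaf o = record { reduced = refl ; prefix = λ _ → refl ; suffix = λ _ → refl }
reduce-window lo hi (node α γ) o = subst (Cut lo hi (node α γ) o) (sym reduce≡)
    (assemble (result (within? lo hi l) (within? lo hi r) (reduce-window lo hi α (suc o)) (reduce-window lo hi γ r)))
  where
  a = size α
  l = suc o
  r = o + suc (suc (a + a))
  wα = window lo hi (suc o) (word α)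
  wγ = window lo hi r (word γ)
  keepIf : ∀ {P : Set} → Dec P → Letter → State → State
  keepIf d x s = if does d then addˡ x s else s
  l<r : l < r
  l<r = ≤-trans (≤-reflexive (+-comm 2 o)) (+-monoʳ-≤ o (s≤s (s≤s z≤n)))
  r-1 : suc (suc o + length (word α)) ≡ r
  r-1 rewrite length-word α = sym (trans (+-suc o (suc (a + a))) (cong suc (+-suc o (a + a))))
  end : r + (size γ + size γ) ≡ o + (size (node α γ) + size (node α γ))
  end = solve 3 (λ o a g → o :+ (con 2 :+ (a :+ a)) :+ (g :+ g) := o :+ ((con 1 :+ (a :+ g)) :+ (con 1 :+ (a :+ g)))) refl o a (size γ)
    where open +-*-Solver
  α-end : suc o + (a + a) ≤ r
  α-end = ≤-trans (≤-reflexive (sym (+-suc o (a + a)))) (+-monoʳ-≤ o (n≤1+n _))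
  reduce-first : ∀ o' x w {k} → suc o' ≡ k → reduce (window lo hi o' (x ∷ w)) ≡ keepIf (within? lo hi k) x (reduce (window lo hi k w))
  reduce-first o' x w refl with within? lo hi (suc o')
  ... | yes i rewrite window-in lo hi o' x w i | dec-true (within? lo hi (suc o')) i = refl
  ... | no i rewrite window-out lo hi o' x w i | dec-false (within? lo hi (suc o')) i = refl
  reduce≡ : reduce (window lo hi o (word (node α γ))) ≡ keepIf (within? lo hi l) U (reduceOn (keepIf (within? lo hi r) D (reduce wγ)) wα)
  reduce≡ = trans (reduce-first o U (word α ++ D ∷ word γ) refl) (cong (keepIf (within? lo hi l) U)
    (trans (cong reduce (window-++ lo hi (suc o) (word α) (D ∷ word γ))) (trans (reduce-++ wα _) (cong (λ s → reduceOn s wα) (reduce-first _ D (word γ) r-1)))))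
  empty : ∀ {o' w} → (∀ {x} → o' < x → x ≤ o' + length w → ¬ Within lo hi x) → reduce (window lo hi o' w) ≡ (0 , 0)
  empty {o'} {w} h = cong reduce (window-none lo hi o' w h)
  cut-0 : ∀ {t o s} → Cut lo hi t o s → s ≡ (0 , 0) → cutCount lo hi t o ≡ 0
  cut-0 c refl = sym (reduced c)
  state≡ : ∀ {s : State} {p m} → proj₁ s ≡ p → proj₂ s ≡ m → s ≡ (p , m)
  state≡ refl refl = refl
  Conclusion : Dec (Within lo hi l) → Dec (Within lo hi r) → Set
  Conclusion il ir = let s = keepIf il U (reduceOn (keepIf ir D (reduce wγ)) wα) in
    (∥ s ∥ ≡ ∣ χ il - χ ir ∣ + (cutCount lo hi α (suc o) + cutCount lo hi γ r)) × (lo ≤ suc o → proj₁ s ≡ 0) × (r + (size γ + size γ) ≤ hi → proj₂ s ≡ 0)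
  assemble : Conclusion (within? lo hi l) (within? lo hi r) →
    Cut lo hi (node α γ) o (keepIf (within? lo hi l) U (reduceOn (keepIf (within? lo hi r) D (reduce wγ)) wα))
  assemble (x , y , z) = record { reduced = x ; prefix = y ; suffix = λ h → z (≤-trans (≤-reflexive end) h) }
  sα = reduce wα
  sγ = reduce wγ
  summary : ∀ (il : Dec (Within lo hi l)) (ir : Dec (Within lo hi r)) {s p m} → reduceOn (keepIf ir D sγ) wα ≡ s → keepIf il U s ≡ (p , m) →
    p + m ≡ ∣ χ il - χ ir ∣ + (cutCount lo hi α (suc o) + cutCount lo hi γ r) →
    (lo ≤ suc o → p ≡ 0) → (r + (size γ + size γ) ≤ hi → m ≡ 0) →
    Conclusion il ir
  summary il ir e₁ e₂ x y z rewrite e₁ | e₂ = x , y , z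
  addU : ∀ s → proj₁ s ≡ 0 → addˡ U s ≡ (0 , suc ∥ s ∥)
  addU (zero , m) refl = refl
  γ-empty : hi < r → sγ ≡ (0 , 0)
  γ-empty hi<r = empty {r} {word γ} λ r<x _ (_ , x≤hi) → <-asym hi<r (<-≤-trans r<x x≤hi)
  result : ∀ il ir → Cut lo hi α (suc o) sα → Cut lo hi γ r sγ → Conclusion il ir
  result (yes (lo≤l , l≤hi)) (yes (lo≤r , r≤hi)) cα cγ =
      summary (yes (lo≤l , l≤hi)) (yes (lo≤r , r≤hi)) (reduceOn-D wα (addˡ D sγ) α≡0) refl
        (trans (reduced cγ) (cong (_+ cutCount lo hi γ r) (sym (cut-0 cα α≡0)))) (λ _ → prefix cγ (m≤n⇒m≤1+n lo≤r)) (suffix cγ)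
    where
    α≡0 : sα ≡ (0 , 0)
    α≡0 = state≡ (prefix cα (m≤n⇒m≤1+n lo≤l)) (suffix cα (≤-trans α-end r≤hi))
  -- The window ends before `r`: nothing of `γ` is left, and the visible part of `α` reduces to
  -- letters U alone, to which the left parenthesis adds one.
  result (yes (lo≤l , l≤hi)) (no ¬r) cα cγ =
      summary (yes (lo≤l , l≤hi)) (no ¬r) (cong (λ s → reduceOn s wα) (γ-empty hi<r)) (addU sα (prefix cα (m≤n⇒m≤1+n lo≤l)))
        (cong suc (trans (reduced cα) (sym (trans (cong (cutCount lo hi α (suc o) +_) (cut-0 cγ (γ-empty hi<r))) (+-identityʳ _)))))
        (λ _ → refl) (λ h → contradiction (≤-trans (m≤m+n r _) h) (<⇒≱ hi<r))
    where
    hi<r : hi < r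
    hi<r = ≰⇒> λ r≤hi → ¬r (≤-trans lo≤l (<⇒≤ l<r) , r≤hi)
  result (no ¬l) (yes (lo≤r , r≤hi)) cα cγ =
      summary (no ¬l) (yes (lo≤r , r≤hi)) (reduceOn-D wα (addˡ D sγ) (state≡ refl (suffix cα (≤-trans α-end r≤hi)))) refl sizes
        (λ lo≤l → contradiction (lo≤l , ≤-trans (<⇒≤ l<r) r≤hi) ¬l) (suffix cγ)
    where
    sizes : proj₁ sα + suc (proj₁ sγ) + proj₂ sγ ≡ suc (cutCount lo hi α (suc o) + cutCount lo hi γ r)
    sizes = begin
      proj₁ sα + suc (proj₁ sγ) + proj₂ sγ ≡⟨ cong (_+ proj₂ sγ) (+-suc (proj₁ sα) (proj₁ sγ)) ⟩
      suc (proj₁ sα + proj₁ sγ + proj₂ sγ) ≡⟨ cong suc (+-assoc (proj₁ sα) _ _) ⟩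
      suc (proj₁ sα + ∥ sγ ∥) ≡⟨ cong₂ (λ p q → suc (p + q)) (sym (trans (cong (proj₁ sα +_) (suffix cα (≤-trans α-end r≤hi))) (+-identityʳ _))) (reduced cγ) ⟩
      suc (∥ sα ∥ + cutCount lo hi γ r) ≡⟨ cong (λ p → suc (p + cutCount lo hi γ r)) (reduced cα) ⟩
      suc (cutCount lo hi α (suc o) + cutCount lo hi γ r) ∎
      where open ≡-Reasoning
  -- A window that avoids `r` lies on one side of it: it misses `γ` if `lo ≤ r`, and `α` otherwise.
  result (no ¬l) (no ¬r) cα cγ with lo ≤? r
  ... | yes lo≤r = summary (no ¬l) (no ¬r) (cong (λ s → reduceOn s wα) (γ-empty hi<r)) refl
        (trans (reduced cα) (sym (trans (cong (cutCount lo hi α (suc o) +_) (cut-0 cγ (γ-empty hi<r))) (+-identityʳ _))))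
        (λ lo≤l → prefix cα (m≤n⇒m≤1+n lo≤l)) (λ h → contradiction (≤-trans (m≤m+n r _) h) (<⇒≱ hi<r))
    where
    hi<r : hi < r
    hi<r = ≰⇒> λ r≤hi → ¬r (lo≤r , r≤hi)
  ... | no lo≰r = summary (no ¬l) (no ¬r) (cong (reduceOn sγ) α-none) refl
        (trans (reduced cγ) (cong (_+ cutCount lo hi γ r) (sym (cut-0 cα (cong reduce α-none)))))
        (λ lo≤l → contradiction (≤-trans lo≤l (<⇒≤ l<r)) lo≰r) (suffix cγ)
    where
    α-none : wα ≡ []
    α-none = window-none lo hi (suc o) (word α) λ _ x≤ (lo≤x , _) →
      lo≰r (≤-trans lo≤x (≤-trans x≤ (≤-trans (≤-reflexive (cong (suc o +_) (length-word α))) α-end)))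

-- Summation over the radii of the windows

∑below : (ℕ → ℕ) → ℕ → ℕ
∑below f zero = 0
∑below f (suc J) = f J + ∑below f J

∑below-+ : ∀ f g J → ∑below (λ j → f j + g j) J ≡ ∑below f J + ∑below g J
∑below-+ f g zero = refl
∑below-+ f g (suc J) rewrite ∑below-+ f g J = +-interchange (f J) (g J) _ _

∑below-cong : ∀ {f g} J → (∀ j → j < J → f j ≡ g j) → ∑below f J ≡ ∑below g J
∑below-cong zero h = refl
∑below-cong (suc J) h = cong₂ _+_ (h J ≤-refl) (∑below-cong J λ j lt → h j (m≤n⇒m≤1+n lt))

∑below-0 : ∀ J → ∑below (λ _ → 0) J ≡ 0
∑below-0 zero = refl
∑below-0 (suc J) = ∑below-0 J

∑below-threshold : ∀ a b J → ∑below (λ j → ∣ χ (a ≤? j) - χ (b ≤? j) ∣) J ≡ ∣ (J ∸ a) - (J ∸ b) ∣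
∑below-threshold a b zero rewrite 0∸n≡0 a | 0∸n≡0 b = refl
∑below-threshold a b (suc J) with a ≤? J | b ≤? J
... | yes p | yes q rewrite χ-yes (a ≤? J) p | χ-yes (b ≤? J) q | ∑below-threshold a b J | +-∸-assoc 1 p | +-∸-assoc 1 q = refl
... | yes p | no q rewrite χ-yes (a ≤? J) p | χ-no (b ≤? J) q | ∑below-threshold a b J | +-∸-assoc 1 p
                         | m≤n⇒m∸n≡0 (≰⇒> q) | m≤n⇒m∸n≡0 (<⇒≤ (≰⇒> q)) | ∣-∣-identityʳ (J ∸ a) = refl
... | no p | yes q rewrite χ-no (a ≤? J) p | χ-yes (b ≤? J) q | ∑below-threshold a b J | +-∸-assoc 1 q
                         | m≤n⇒m∸n≡0 (≰⇒> p) | m≤n⇒m∸n≡0 (<⇒≤ (≰⇒> p)) = refl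
... | no p | no q rewrite χ-no (a ≤? J) p | χ-no (b ≤? J) q | ∑below-threshold a b J
                         | m≤n⇒m∸n≡0 (≰⇒> p) | m≤n⇒m∸n≡0 (<⇒≤ (≰⇒> p)) | m≤n⇒m∸n≡0 (≰⇒> q) | m≤n⇒m∸n≡0 (<⇒≤ (≰⇒> q)) = refl

-- Truncation does no harm: for j > C the lower bound `C ∸ j` is 0, which admits every x below C, as
-- does the distance condition.
within⇔dist : ∀ C j x → (Within (C ∸ j) (C + j) x → ∣ C - x ∣ ≤ j) × (∣ C - x ∣ ≤ j → Within (C ∸ j) (C + j) x)
within⇔dist C j x with ≤-total C x
... | inj₁ C≤x rewrite m≤n⇒∣m-n∣≡n∸m C≤x =
  (λ (_ , x≤) → m≤n+o⇒m∸n≤o x C x≤) , λ le → ≤-trans (m∸n≤m C j) C≤x , ≤-trans (≤-reflexive (sym (m+[n∸m]≡n C≤x))) (+-monoʳ-≤ C le)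
... | inj₂ x≤C rewrite m≤n⇒∣n-m∣≡n∸m x≤C =
  (λ (le , _) → m≤n+o⇒m∸n≤o C x (≤-trans (m≤n+m∸n C j) (≤-trans (+-monoʳ-≤ j le) (≤-reflexive (+-comm j x))))) ,
  λ le → m≤n+o⇒m∸n≤o C j (≤-trans (m≤n+m∸n C x) (≤-trans (+-monoʳ-≤ x le) (≤-reflexive (+-comm x j)))) , ≤-trans x≤C (m≤m+n C j)

module _ (C J : ℕ) where

  -- The radii separating `l` from `r` are those from the smaller distance up to, but excluding, the
  -- larger one. As `J` bounds both distances, the sum misses none.
  ∑below-node : ∀ {l r} → ∣ C - l ∣ ≤ J → ∣ C - r ∣ ≤ J →
    ∑below (λ j → ∣ χ (within? (C ∸ j) (C + j) l) - χ (within? (C ∸ j) (C + j) r) ∣) J ≡ ∣ ∣ C - l ∣ - ∣ C - r ∣ ∣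
  ∑below-node {l} {r} a b = trans (∑below-cong J λ j _ → cong₂ ∣_-_∣ (χ-dist j l) (χ-dist j r)) (trans (∑below-threshold ∣ C - l ∣ ∣ C - r ∣ J)
      (trans (∣-∣-comm (J ∸ ∣ C - l ∣) _) (sym (dist-shift {∣ C - l ∣} {J ∸ ∣ C - l ∣} {∣ C - r ∣} {J ∸ ∣ C - r ∣} (trans (m+[n∸m]≡n a) (sym (m+[n∸m]≡n b)))))))
    where
    χ-dist : ∀ j x → χ (within? (C ∸ j) (C + j) x) ≡ χ (∣ C - x ∣ ≤? j)
    χ-dist j x = χ-cong (within? (C ∸ j) (C + j) x) (∣ C - x ∣ ≤? j) (proj₁ (within⇔dist C j x)) (proj₂ (within⇔dist C j x))

  ∑below-cutCount : ∀ t o → (∀ {x} → o < x → x ≤ o + (size t + size t) → ∣ C - x ∣ ≤ J) →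
    ∑below (λ j → cutCount (C ∸ j) (C + j) t o) J ≡ spread C t o
  ∑below-cutCount leaf o h = ∑below-0 J
  ∑below-cutCount (node α γ) o h = trans (∑below-+ _ _ J) (cong₂ _+_
      (∑below-node (h ≤-refl (≤-trans (s≤s (m≤m+n o _)) (≤-trans (≤-reflexive (sym (+-suc o (a + a)))) (≤-trans (+-monoʳ-≤ o (n≤1+n _)) r≤)))) (h (m<m+n o (s≤s z≤n)) r≤))
      (trans (∑below-+ _ _ J) (cong₂ _+_
        (∑below-cutCount α (suc o) λ x> x≤ → h (<⇒≤ x>) (≤-trans x≤ (≤-trans (≤-reflexive (sym (+-suc o (a + a)))) (≤-trans (+-monoʳ-≤ o (n≤1+n _)) r≤))))
        (∑below-cutCount γ r λ x> x≤ → h (<-trans (m<m+n o (s≤s z≤n)) x>) (≤-trans x≤ (≤-reflexive end))))))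
    where
    a = size α
    r = o + suc (suc (a + a))
    end : r + (size γ + size γ) ≡ o + (size (node α γ) + size (node α γ))
    end = solve 3 (λ o a g → o :+ (con 2 :+ (a :+ a)) :+ (g :+ g) := o :+ ((con 1 :+ (a :+ g)) :+ (con 1 :+ (a :+ g)))) refl o a (size γ)
      where open +-*-Solver
    r≤ : r ≤ o + (size (node α γ) + size (node α γ))
    r≤ = ≤-trans (m≤m+n r _) (≤-reflexive end)

  ∑below-reduce : ∀ t o → (∀ {x} → o < x → x ≤ o + (size t + size t) → ∣ C - x ∣ ≤ J) →
    ∑below (λ j → ∥ reduce (window (C ∸ j) (C + j) o (word t)) ∥) J ≡ spread C t o
  ∑below-reduce t o h = trans (∑below-cong J λ j _ → Cut.reduced (reduce-window (C ∸ j) (C + j) t o)) (∑below-cutCount t o h)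

lengths-windows : ∀ c ps o {C} → C ≡ suc (o + length ps) →
  lengths c ps ≡ ∑below (λ j → ∥ reduce (window (C ∸ j) (C + j) o (central c ps)) ∥) (suc (length ps))
lengths-windows c [] o {C} refl rewrite +-identityʳ o | window-in (suc o) (suc (o + 0)) o c [] (≤-refl , ≤-reflexive (cong suc (sym (+-identityʳ o)))) = sym (+-identityʳ _)
lengths-windows c ((ℓ , r) ∷ ps) o {C} e = cong₂ _+_ (cong (λ w → ∥ reduce w ∥) (sym outer))
    (trans (lengths-windows c ps (suc o) (trans e (cong suc (+-suc o (length ps))))) (∑below-cong (suc n) inner))
  where
  n = length ps
  C≡ : C ≡ suc o + suc n
  C≡ = e
  len≡ : length (central c ((ℓ , r) ∷ ps)) ≡ suc (suc n + suc n)
  len≡ = length-central c ((ℓ , r) ∷ ps)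
  outer : window (C ∸ suc n) (C + suc n) o (central c ((ℓ , r) ∷ ps)) ≡ central c ((ℓ , r) ∷ ps)
  outer = window-all (C ∸ suc n) (C + suc n) o (central c ((ℓ , r) ∷ ps))
    (≤-reflexive (trans (cong (_∸ suc n) C≡) (m+n∸n≡m (suc o) (suc n))))
    (≤-reflexive (trans (cong (o +_) len≡) (trans (+-suc o _) (trans (sym (+-assoc (suc o) (suc n) (suc n))) (cong (_+ suc n) (sym C≡))))))
  inner : ∀ j → j < suc n → ∥ reduce (window (C ∸ j) (C + j) (suc o) (central c ps)) ∥ ≡ ∥ reduce (window (C ∸ j) (C + j) o (central c ((ℓ , r) ∷ ps))) ∥
  inner j j<n = cong (λ w → ∥ reduce w ∥) (sym (begin
    window lo hi o (ℓ ∷ central c ps ++ r ∷ []) ≡⟨ window-out lo hi o ℓ (central c ps ++ r ∷ []) (λ (a , _) → <⇒≱ lo> a) ⟩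
    window lo hi (suc o) (central c ps ++ r ∷ []) ≡⟨ window-++ lo hi (suc o) (central c ps) (r ∷ []) ⟩
    window lo hi (suc o) (central c ps) ++ window lo hi (suc o + length (central c ps)) (r ∷ []) ≡⟨ cong (window lo hi (suc o) (central c ps) ++_)
       (window-out lo hi _ r [] (λ (_ , b) → <⇒≱ hi< b)) ⟩
    window lo hi (suc o) (central c ps) ++ [] ≡⟨ ++-identityʳ _ ⟩
    window lo hi (suc o) (central c ps) ∎))
    where
    open ≡-Reasoning
    lo = C ∸ j
    hi = C + j
    lo> : suc o < lo
    lo> = ≤-trans (≤-reflexive (sym (trans (cong (_∸ n) (trans C≡ (+-suc (suc o) n))) (m+n∸n≡m (suc (suc o)) n)))) (∸-monoʳ-≤ C (s≤s⁻¹ j<n))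
    hi< : hi < suc (suc o + length (central c ps))
    hi< = s≤s (≤-trans (+-monoʳ-≤ C (s≤s⁻¹ j<n)) (≤-reflexive (trans (cong (_+ n) C≡) (trans (+-assoc (suc o) (suc n) n) (cong (suc o +_) (sym (length-central c ps)))))))

-- `central c ps` starts at letter 2 of `word t`, hence the offset 1. All radii are below `size t`,
-- so no window centred at `size t + 1` reaches letter 1, and the dropped U makes no difference.
lengths-spread : ∀ t c ps → word t ≡ U ∷ central c ps → lengths c ps ≡ spread (suc (size t)) t 0
lengths-spread t c ps e = begin
  lengths c ps ≡⟨ lengths-windows c ps 1 {C} (cong suc size≡) ⟩
  ∑below (λ j → ∥ reduce (window (C ∸ j) (C + j) 1 (central c ps)) ∥) (suc (length ps)) ≡⟨ ∑below-cong (suc (length ps)) (λ j j< → cong (λ w → ∥ reduce w ∥)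
     (sym (trans (cong (window (C ∸ j) (C + j) 0) e) (window-out (C ∸ j) (C + j) 0 U (central c ps) λ (a , _) → <⇒≱ (first j j<) a)))) ⟩
  ∑below (λ j → ∥ reduce (window (C ∸ j) (C + j) 0 (word t)) ∥) (suc (length ps)) ≡⟨ cong (∑below _) (sym size≡) ⟩
  ∑below (λ j → ∥ reduce (window (C ∸ j) (C + j) 0 (word t)) ∥) (size t) ≡⟨ ∑below-reduce C (size t) t 0 (λ {x} 0<x x≤ → proj₁ (within⇔dist C (size t) x)
     (≤-trans (≤-reflexive (m+n∸n≡m 1 (size t))) 0<x , ≤-trans x≤ (n≤1+n _))) ⟩
  spread C t 0 ∎
  where
  open ≡-Reasoning
  C = suc (size t)
  double-injective : ∀ m n → m + m ≡ n + n → m ≡ n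
  double-injective zero zero _ = refl
  double-injective zero (suc n) ()
  double-injective (suc m) zero ()
  double-injective (suc m) (suc n) e rewrite +-suc m m | +-suc n n = cong suc (double-injective m n (suc-injective (suc-injective e)))
  size≡ : size t ≡ suc (length ps)
  size≡ = double-injective (size t) (suc (length ps)) (trans (sym (length-word t)) (trans (cong length e)
    (trans (cong suc (length-central c ps)) (cong suc (sym (+-suc (length ps) (length ps)))))))
  first : ∀ j → j < suc (length ps) → 1 < C ∸ j
  first j j< = m+n≤o⇒m≤o∸n 2 (s≤s (≤-trans j< (≤-reflexive (sym size≡))))

-- The classification

-- A word of length 2n has no middle letter. Dropping its first letter, which is always U, leaves 2n
-- - 1 letters with letter n + 1 in the middle. They reduce to a single D, so the path starts at
-- height 0; it has n - 1 steps.
record Encodes (t : Tree) (w : List Step) : Set where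
  field
    middle : Letter
    sides  : List (Letter × Letter)
    word≡  : word t ≡ U ∷ central middle sides
    bits≡  : bits middle sides ≡ w
open Encodes

double-injective : ∀ {m n} → m + m ≡ n + n → m ≡ n
double-injective {zero} {zero} _ = refl
double-injective {suc m} {suc n} e rewrite +-suc m m | +-suc n n = cong suc (double-injective (suc-injective (suc-injective e)))

state≡ : ∀ {t w} (E : Encodes t w) → state (middle E) (sides E) ≡ (1 , 0)
state≡ {t} E = unadd _ (trans (cong reduce (sym (word≡ E))) (reduce-word t))
  where
  unadd : ∀ s → addˡ U s ≡ (0 , 0) → s ≡ (1 , 0)
  unadd (suc p , m) refl = refl

length-sides : ∀ {t w} (E : Encodes t w) → size t ≡ suc (length (sides E))
length-sides {t} E = double-injective (trans (sym (length-word t)) (trans (cong length (word≡ E))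
  (trans (cong suc (length-central (middle E) (sides E))) (cong suc (sym (+-suc (length (sides E)) _))))))

length-bits : ∀ c ps → length (bits c ps) ≡ length ps
length-bits c [] = refl
length-bits c (_ ∷ ps) = cong suc (length-bits c ps)

encodes-length : ∀ {t w} → Encodes t w → size t ≡ suc (length w)
encodes-length E = trans (length-sides E) (cong suc (trans (sym (length-bits (middle E) (sides E))) (cong length (bits≡ E))))

encodes-path : ∀ {t w} → Encodes t w → Path 0 w (crs (arrange t 0))
encodes-path {t} {w} E with bits-path (middle E) (sides E)
... | k , s , e , P , W = subst₂ (λ w s → Path 0 w s) (bits≡ E) s≡crs (subst (λ k → Path k _ s) k≡0 P)
  where
  k≡0 : k ≡ 0
  k≡0 = double-injective (suc-injective (trans (sym e) (cong ∥_∥ (state≡ E))))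
  s≡crs : s ≡ crs (arrange t 0)
  s≡crs = double-injective (+-cancelʳ-≡ (size t) _ _ (begin
    s + s + size t ≡⟨ cong (s + s +_) (length-sides E) ⟩
    s + s + suc (length (sides E)) ≡⟨ sym W ⟩
    lengths (middle E) (sides E) ≡⟨ lengths-spread t (middle E) (sides E) (word≡ E) ⟩
    spread (suc (size t)) t 0 ≡⟨ sym (crs-spread t) ⟩
    crs (arrange t 0) + crs (arrange t 0) + size t ∎))
    where open ≡-Reasoning

encodes-total : ∀ t {n} → size t ≡ suc n → ∃ λ w → Encodes t w
encodes-total (node α γ) {n} e with central-covers n (word α ++ D ∷ word γ) (suc-injective (trans (length-word (node α γ)) (trans (cong₂ _+_ e e) (cong suc (+-suc n n)))))
... | c , ps , _ , eq = bits c ps , record { middle = c ; sides = ps ; word≡ = cong (U ∷_) (sym eq) ; bits≡ = refl }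

encodes-functional : ∀ {t w w'} → Encodes t w → Encodes t w' → w ≡ w'
encodes-functional E F with central-injective (middle E) (middle F) (sides E) (sides F) (∷-injectiveʳ (trans (sym (word≡ E)) (word≡ F)))
... | c≡ , ps≡ = trans (sym (bits≡ E)) (trans (cong₂ bits c≡ ps≡) (bits≡ F))

encodes-injective : ∀ {t t' w} → Encodes t w → Encodes t' w → t ≡ t'
encodes-injective {t} {t'} E F with bits-injective (middle E) (middle F) (sides E) (sides F) (trans (state≡ E) (sym (state≡ F))) (trans (bits≡ E) (sym (bits≡ F)))
... | c≡ , ps≡ = word-injective t t' (trans (word≡ E) (trans (cong₂ (λ c ps → U ∷ central c ps) c≡ ps≡) (sym (word≡ F))))

encodes-surjective : ∀ {w s} → Path 0 w s → ∃ λ t → Encodes t w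
encodes-surjective P with bits-surjective P (1 , 0) refl
... | c , ps , e , b with word-covers {U ∷ central c ps} (cong (addˡ U) e)
... | t , eq = t , record { middle = c ; sides = ps ; word≡ = eq ; bits≡ = b }

length-steps : ∀ f g t m → length (steps f g t m) ≡ m
length-steps f g t zero = refl
length-steps f g t (suc m) = cong suc (length-steps f g (suc t) m)

-- The `crs`-equivalence of 321 and 132

Matched : List ℕ → List ℕ → Set
Matched σ τ = ∃ λ t → arrange t 0 ≡ τ × Encodes t (encode σ)

transfer-321-132 : ∀ n → Transfer crsSt (pat p321) (pat p132) (suc n)
transfer-321-132 n = record { _∼_ = Matched ; total = total ; inj = inj }
  where
  total : ∀ {σ} → Perm (suc n) σ → Avoids σ (pat p321) → ∃ λ τ → Perm (suc n) τ × Avoids τ (pat p132) × crsSt τ ≡ crsSt σ × Matched σ τ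
  total {σ} p av = arrange t 0 , subst (λ m → Perm m (arrange t 0)) size≡ (arrange-perm t) , arrange-avoids-132 t
      , cong (_∷ []) (proj₂ (path-functional (encodes-path E) path)) , t , refl , E
    where
    path : Path 0 (encode σ) (crs σ)
    path = encode-path p (avoids⇒monotone p av)
    t = proj₁ (encodes-surjective path)
    E = proj₂ (encodes-surjective path)
    size≡ : size t ≡ suc n
    size≡ = trans (encodes-length E) (cong suc (trans (length-steps (excBit σ) (valueBit σ) 1 (length σ ∸ 1)) (cong (_∸ 1) (len p))))
  inj : ∀ {σ ρ τ} → Perm (suc n) σ → Avoids σ (pat p321) → Perm (suc n) ρ → Avoids ρ (pat p321) → Perm (suc n) τ → Matched σ τ → Matched ρ τ → σ ≡ ρ
  inj p av q av' _ (t , e , E) (t' , e' , E') = encode-injective p (avoids⇒monotone p av) q (avoids⇒monotone q av')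
    (encodes-functional E (subst (λ t → Encodes t _) (arrange-injective t' t 0 (trans e' (sym e))) E'))

unmatch : ∀ {n t w} → size t ≡ suc n → Encodes t w → ∃ λ σ → Perm (suc n) σ × Avoids σ (pat p321) × crsSt σ ≡ crsSt (arrange t 0) × Matched σ (arrange t 0)
unmatch {n} {t} {w} size≡ E = conclude (decode (encodes-path E))
  where
  conclude : (∃ λ σ → Perm (suc (length w)) σ × Monotone (suc (length w)) σ × encode σ ≡ w) →
    ∃ λ σ → Perm (suc n) σ × Avoids σ (pat p321) × crsSt σ ≡ crsSt (arrange t 0) × Matched σ (arrange t 0)
  conclude (σ , p , m , e) = σ , subst (λ k → Perm k σ) (trans (sym (encodes-length E)) size≡) p , monotone⇒avoids p m
    , cong (_∷ []) (proj₂ (path-functional (subst (λ w → Path 0 w (crs σ)) e (encode-path p m)) (encodes-path E))) , t , refl , subst (Encodes t) (sym e) E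

transfer-132-321 : ∀ n → Transfer crsSt (pat p132) (pat p321) (suc n)
transfer-132-321 n = record { _∼_ = λ τ σ → Matched σ τ ; total = λ p av → total p (arrange-covers p av) ; inj = inj }
  where
  total : ∀ {τ} → Perm (suc n) τ → (∃ λ t → arrange t 0 ≡ τ) → ∃ λ σ → Perm (suc n) σ × Avoids σ (pat p321) × crsSt σ ≡ crsSt τ × Matched σ τ
  total p (t , refl) = unmatch size≡ (proj₂ (encodes-total t size≡))
    where
    size≡ : size t ≡ suc n
    size≡ = trans (sym (length-arrange t 0)) (len p)
  inj : ∀ {τ τ' σ} → Perm (suc n) τ → Avoids τ (pat p132) → Perm (suc n) τ' → Avoids τ' (pat p132) → Perm (suc n) σ → Matched σ τ → Matched σ τ' → τ ≡ τ'
  inj _ _ _ _ _ (t , e , E) (t' , e' , E') = trans (sym e) (trans (cong (λ t → arrange t 0) (encodes-injective E E')) e')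

-- Assembling and separating the classes

transfer-map : ∀ {st st' τ τ' n} (f : List ℕ → List ℕ) → (∀ σ → st' σ ≡ f (st σ)) → Transfer st τ τ' n → Transfer st' τ τ' n
transfer-map f h tr = record
  { _∼_ = _∼_
  ; total = λ {σ} p av → let (σ' , p' , av' , e , r) = total p av in σ' , p' , av' , trans (h σ') (trans (cong f e) (sym (h σ))) , r
  ; inj = inj }
  where open Transfer tr

crsPart nesPart : List ℕ → List ℕ
crsPart (c ∷ _) = c ∷ []
crsPart [] = []
nesPart (_ ∷ ns) = ns
nesPart [] = []

wilf-sym : ∀ {st τ τ'} → WilfEquiv st τ τ' → WilfEquiv st τ' τ
wilf-sym e n 1≤n v = sym (e n 1≤n v)

wilf-trans : ∀ {st τ τ' τ''} → WilfEquiv st τ τ' → WilfEquiv st τ' τ'' → WilfEquiv st τ τ''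
wilf-trans e f n 1≤n v = trans (e n 1≤n v) (f n 1≤n v)

wilf-refl : ∀ st τ → WilfEquiv st τ τ
wilf-refl st τ _ _ _ = refl

module _ where
  open ReverseComplementInverse

  crsNes-213-132 : WilfEquiv crsNesSt (pat p213) (pat p132)
  crsNes-213-132 = wilf (λ n _ → transfer-213-132 n) (λ n _ → transfer-132-213 n)

  crs-213-132 : WilfEquiv crsSt (pat p213) (pat p132)
  crs-213-132 = wilf (λ n _ → transfer-map crsPart (λ _ → refl) (transfer-213-132 n)) (λ n _ → transfer-map crsPart (λ _ → refl) (transfer-132-213 n))

  nes-213-132 : WilfEquiv nesSt (pat p213) (pat p132)
  nes-213-132 = wilf (λ n _ → transfer-map nesPart (λ _ → refl) (transfer-213-132 n)) (λ n _ → transfer-map nesPart (λ _ → refl) (transfer-132-213 n))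

nes-312-231 : WilfEquiv nesSt (pat p312) (pat p231)
nes-312-231 = wilf (λ n _ → Inverse.transfer-312-231 n) (λ n _ → Inverse.transfer-231-312 n)

crs-321-132 : WilfEquiv crsSt (pat p321) (pat p132)
crs-321-132 = wilf (λ { (suc n) _ → transfer-321-132 n }) (λ { (suc n) _ → transfer-132-321 n })

classification : ∀ st (class : Pat3 → ℕ) (representative : ℕ → Pat3) →
  (∀ τ → WilfEquiv st (pat τ) (pat (representative (class τ)))) →
  (∀ {τ τ'} → WilfEquiv st (pat τ) (pat τ') → class τ ≡ class τ') →
  ∀ τ τ' → WilfEquiv st (pat τ) (pat τ') ⇔ (class τ ≡ class τ')
classification st class rep canonical separated τ τ' = mk⇔ separated λ e →
  wilf-trans {st} {pat τ} {pat (rep (class τ'))} {pat τ'} (subst (λ k → WilfEquiv st (pat τ) (pat (rep k))) e (canonical τ))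
    (wilf-sym {st} {pat τ'} {pat (rep (class τ'))} (canonical τ'))

nesRep crsRep crsNesRep : ℕ → Pat3
nesRep 0 = p123
nesRep 1 = p132
nesRep 2 = p231
nesRep _ = p321
crsRep 0 = p123
crsRep 1 = p132
crsRep 2 = p231
crsRep _ = p312
crsNesRep 0 = p123
crsNesRep 1 = p132
crsNesRep 2 = p231
crsNesRep 3 = p312
crsNesRep _ = p321

nes-canonical : ∀ τ → WilfEquiv nesSt (pat τ) (pat (nesRep (nesClass τ)))
nes-canonical p123 = wilf-refl nesSt (pat p123)
nes-canonical p132 = wilf-refl nesSt (pat p132)
nes-canonical p213 = nes-213-132
nes-canonical p231 = wilf-refl nesSt (pat p231)
nes-canonical p312 = nes-312-231
nes-canonical p321 = wilf-refl nesSt (pat p321)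

crs-canonical : ∀ τ → WilfEquiv crsSt (pat τ) (pat (crsRep (crsClass τ)))
crs-canonical p123 = wilf-refl crsSt (pat p123)
crs-canonical p132 = wilf-refl crsSt (pat p132)
crs-canonical p213 = crs-213-132
crs-canonical p231 = wilf-refl crsSt (pat p231)
crs-canonical p312 = wilf-refl crsSt (pat p312)
crs-canonical p321 = crs-321-132

crsNes-canonical : ∀ τ → WilfEquiv crsNesSt (pat τ) (pat (crsNesRep (crsNesClass τ)))
crsNes-canonical p123 = wilf-refl crsNesSt (pat p123)
crsNes-canonical p132 = wilf-refl crsNesSt (pat p132)
crsNes-canonical p213 = crsNes-213-132
crsNes-canonical p231 = wilf-refl crsNesSt (pat p231)
crsNes-canonical p312 = wilf-refl crsNesSt (pat p312)
crsNes-canonical p321 = wilf-refl crsNesSt (pat p321)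

-- Coefficients at n = 4 that tell the classes apart.
nesCoeff crsCoeff crsNesCoeff crsNesCoeff' : Pat3 → ℕ
nesCoeff τ = coeff nesSt (pat τ) 4 (0 ∷ [])
crsCoeff τ = coeff crsSt (pat τ) 4 (1 ∷ [])
crsNesCoeff τ = coeff crsNesSt (pat τ) 4 (0 ∷ 0 ∷ [])
crsNesCoeff' τ = coeff crsNesSt (pat τ) 4 (1 ∷ 0 ∷ [])

-- The numerals are the coefficients that occur, listed by label; the last label falls to the
-- catch-all clause.
nesCoeff-class crsCoeff-class : ℕ → ℕ
nesCoeff-class 4 = 0
nesCoeff-class 7 = 1
nesCoeff-class 8 = 2
nesCoeff-class _ = 3
crsCoeff-class 6 = 0
crsCoeff-class 4 = 1
crsCoeff-class 5 = 2
crsCoeff-class _ = 3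

-- The patterns 312 and 321 share the coefficient for crs = nes = 0. The coefficient for crs = 1,
-- nes = 0 decides between them: it vanishes for 312 but not for 321.
crsNesCoeff-class : ℕ → ℕ → ℕ
crsNesCoeff-class 1 _ = 0
crsNesCoeff-class 4 _ = 1
crsNesCoeff-class 5 _ = 2
crsNesCoeff-class _ 0 = 3
crsNesCoeff-class _ _ = 4

nes-class : ∀ τ → nesCoeff-class (nesCoeff τ) ≡ nesClass τ
nes-class p123 = refl
nes-class p132 = refl
nes-class p213 = refl
nes-class p231 = refl
nes-class p312 = refl
nes-class p321 = refl

crs-class : ∀ τ → crsCoeff-class (crsCoeff τ) ≡ crsClass τ
crs-class p123 = refl
crs-class p132 = refl
crs-class p213 = refl
crs-class p231 = refl
crs-class p312 = refl
crs-class p321 = refl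

crsNes-class : ∀ τ → crsNesCoeff-class (crsNesCoeff τ) (crsNesCoeff' τ) ≡ crsNesClass τ
crsNes-class p123 = refl
crsNes-class p132 = refl
crsNes-class p213 = refl
crsNes-class p231 = refl
crsNes-class p312 = refl
crsNes-class p321 = refl

separated : ∀ {class : Pat3 → ℕ} (f : ℕ → ℕ → ℕ) (x y : Pat3 → ℕ) → (∀ τ → f (x τ) (y τ) ≡ class τ) →
  ∀ τ τ' → x τ ≡ x τ' → y τ ≡ y τ' → class τ ≡ class τ'
separated f x y h τ τ' ex ey = trans (sym (h τ)) (trans (cong₂ f ex ey) (h τ'))

theorem1p1 : (∀ (τ τ' : Pat3) → WilfEquiv nesSt (pat τ) (pat τ') ⇔ (nesClass τ ≡ nesClass τ'))
    × (∀ (τ τ' : Pat3) → WilfEquiv crsSt (pat τ) (pat τ') ⇔ (crsClass τ ≡ crsClass τ'))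
    × (∀ (τ τ' : Pat3) → WilfEquiv crsNesSt (pat τ) (pat τ') ⇔ (crsNesClass τ ≡ crsNesClass τ'))
theorem1p1 =
    classification nesSt nesClass nesRep nes-canonical (λ {τ} {τ'} e →
      separated (λ x _ → nesCoeff-class x) nesCoeff (λ _ → 0) nes-class τ τ' (e 4 (s≤s z≤n) (0 ∷ [])) refl)
  , classification crsSt crsClass crsRep crs-canonical (λ {τ} {τ'} e →
      separated (λ x _ → crsCoeff-class x) crsCoeff (λ _ → 0) crs-class τ τ' (e 4 (s≤s z≤n) (1 ∷ [])) refl)
  , classification crsNesSt crsNesClass crsNesRep crsNes-canonical (λ {τ} {τ'} e →
      separated crsNesCoeff-class crsNesCoeff crsNesCoeff' crsNes-class τ τ' (e 4 (s≤s z≤n) (0 ∷ 0 ∷ [])) (e 4 (s≤s z≤n) (1 ∷ 0 ∷ [])))
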